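{- Every planar graph $G$ with maximum degree $d$ can be drawn with at most one bend per edge, using segments of at most $2d$ distinct slopes.
   Context: A drawing with at most $k$ bends per edge maps vertices to distinct points and each edge to a polygonal path between its endpoints consisting of at most $k+1$ segments, not passing through other vertices, such that no two paths representing different edges share an interior point (non-crossing). The slopes used are the slopes of all segments of all these paths. -}

module Defs where

open import Data.Nat using (ℕ; zero; suc; _⊔_) renaming (_≤_ to _≤ℕ_; _<_ to _<ℕ_)
open import Data.Fin using (Fin; toℕ)
open import Data.Bool using (Bool; true; false; if_then_else_)
open import Data.List using (List; []; _∷_; _++_; [_]; length; map; foldr; allFin; lookup)
open import Data.Nat.ListAction using (sum)
open import Data.List.Relation.Unary.All using (All)
open import Data.List.Relation.Unary.Any using (Any)
open import Data.Product using (Σ; ∃; _×_; _,_; proj₁; proj₂)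
open import Data.Sum using (_⊎_)
open import Relation.Nullary using (¬_)
open import Relation.Binary.PropositionalEquality using (_≡_; _≢_)
open import Relation.Binary.Structures using (IsStrictTotalOrder)
open import Algebra.Structures using (IsCommutativeRing)

-- The real numbers, axiomatised as a Dedekind-complete ordered field
-- (with decidable order, as holds classically).  Every model is
-- isomorphic to ℝ, so quantifying over all models = stating for ℝ.

record RealField : Set₁ where
  infixl 6 _+_
  infixl 7 _*_
  infix 4 _<_
  field
    Carrier : Set
    _+_ _*_ : Carrier → Carrier → Carrier
    -_      : Carrier → Carrier
    0# 1#   : Carrier
    _<_     : Carrier → Carrier → Set
    isCommutativeRing : IsCommutativeRing _≡_ _+_ _*_ -_ 0# 1#
    0≢1     : 0# ≢ 1#
    inverse : ∀ x → x ≢ 0# → ∃ λ y → x * y ≡ 1#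
    isStrictTotalOrder : IsStrictTotalOrder _≡_ _<_
    +-mono-< : ∀ {x y} z → x < y → x + z < y + z
    *-pos    : ∀ {x y} → 0# < x → 0# < y → 0# < x * y

  _≤_ : Carrier → Carrier → Set
  x ≤ y = x < y ⊎ x ≡ y

  IsUpperBound : (Carrier → Set) → Carrier → Set
  IsUpperBound P b = ∀ x → P x → x ≤ b

  field
    complete : (P : Carrier → Set) → (∃ P) → (∃ (IsUpperBound P)) →
               ∃ λ s → IsUpperBound P s × (∀ b → IsUpperBound P b → s ≤ b)

record Graph (n : ℕ) : Set where
  field
    adj    : Fin n → Fin n → Bool
    sym    : ∀ u v → adj u v ≡ adj v u
    irrefl : ∀ u → adj u u ≡ false

module _ {n : ℕ} (G : Graph n) where
  open Graph G

  degree : Fin n → ℕ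
  degree v = sum (map (λ w → if adj v w then 1 else 0) (allFin n))

  -- maximum degree (0 for the empty graph)
  maxDegree : ℕ
  maxDegree = foldr _⊔_ 0 (map degree (allFin n))

  -- edges {u,v}, represented once with u < v
  Edge : Set
  Edge = Σ (Fin n × Fin n) λ uv → (toℕ (proj₁ uv) <ℕ toℕ (proj₂ uv)) × (adj (proj₁ uv) (proj₂ uv) ≡ true)

  src tgt : Edge → Fin n
  src e = proj₁ (proj₁ e)
  tgt e = proj₂ (proj₁ e)

module Geometry (ℝ : RealField) where
  open RealField ℝ

  Point : Set
  Point = Carrier × Carrier

  _-ᵖ_ : Point → Point → Point
  (a , b) -ᵖ (c , d) = (a + (- c)) , (b + (- d))

  origin : Point
  origin = 0# , 0#

  Parallel : Point → Point → Set
  Parallel (a , b) (c , d) = a * d + (- (b * c)) ≡ 0#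

  OnSeg : Point → Point → Point → Set
  OnSeg (p₁ , p₂) (q₁ , q₂) (x₁ , x₂) =
    ∃ λ t → 0# ≤ t × t ≤ 1# ×
      x₁ ≡ p₁ + t * (q₁ + (- p₁)) × x₂ ≡ p₂ + t * (q₂ + (- p₂))

  segs : List Point → List (Point × Point)
  segs (p ∷ q ∷ r) = (p , q) ∷ segs (q ∷ r)
  segs _ = []

  OnPoly : List Point → Point → Set
  OnPoly ps x = Any (λ s → OnSeg (proj₁ s) (proj₂ s) x) (segs ps)

  NonDegenerate : List Point → Set
  NonDegenerate ps = All (λ s → proj₁ s ≢ proj₂ s) (segs ps)

  Simple : List Point → Set
  Simple ps = ∀ (i j : Fin (length (segs ps))) → toℕ i <ℕ toℕ j → ∀ x →
    OnSeg (proj₁ (lookup (segs ps) i)) (proj₂ (lookup (segs ps) i)) x →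
    OnSeg (proj₁ (lookup (segs ps) j)) (proj₂ (lookup (segs ps) j)) x →
    (toℕ j ≡ suc (toℕ i)) × (x ≡ proj₂ (lookup (segs ps) i))

  record Drawing {n : ℕ} (G : Graph n) (k : ℕ) : Set where
    field
      pos     : Fin n → Point
      pos-inj : ∀ u v → pos u ≡ pos v → u ≡ v
      bends   : Edge G → List Point
      bends-≤ : ∀ e → length (bends e) ≤ℕ k

    curve : Edge G → List Point
    curve e = pos (src G e) ∷ (bends e ++ [ pos (tgt G e) ])

    field
      nondeg : ∀ e → NonDegenerate (curve e)
      simple : ∀ e → Simple (curve e)
      avoids : ∀ e w → w ≢ src G e → w ≢ tgt G e → ¬ OnPoly (curve e) (pos w)
      noncrossing : ∀ e e' → proj₁ e ≢ proj₁ e' → ∀ x →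
        OnPoly (curve e) x → OnPoly (curve e') x →
        (x ≡ pos (src G e) ⊎ x ≡ pos (tgt G e)) ⊎ (x ≡ pos (src G e') ⊎ x ≡ pos (tgt G e'))

  UsesAtMostSlopes : ∀ {n} {G : Graph n} {k} → Drawing G k → ℕ → Set
  UsesAtMostSlopes {G = G} D m = ∃ λ (dirs : List Point) →
    length dirs ≤ℕ m × All (λ v → v ≢ origin) dirs ×
    (∀ e → All (λ s → Any (Parallel (proj₂ s -ᵖ proj₁ s)) dirs) (segs (Drawing.curve D e)))

  Planar : ∀ {n} → Graph n → Set
  Planar G = ∃ λ k → Drawing G k

-- A drawing determines the counterclockwise order of the edges at each vertex,
-- and every closed walk bounds modulo 2: the corners of the drawing are coloured
-- by the parity of the number of segments of the walk above them.  This is all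
-- that is used of planarity.  Remove the vertices one at a time, keeping track of
-- the contour of the removed part; by the colouring, edges between vertices of
-- the contour do not interleave, so some vertex of the contour has no neighbours
-- on it other than the adjacent ones, and it is removed next.
--
-- In the reverse order each new vertex is placed above all earlier ones, and its
-- earlier neighbours are consecutive, up to vertices that need no further edges,
-- on the upper contour.  An edge then rises vertically from its lower end to the
-- height of its upper end and continues horizontally; these L-shaped curves may
-- overlap but do not cross.  The overlaps are removed by tilting the verticals
-- into d nearly vertical directions and the horizontals into d nearly horizontal
-- ones, chosen by rank among the neighbours of the end where the segment starts.

module Submission where

open import Defs
open import Algebra.Bundles using (CommutativeMonoid; CommutativeRing)
import Algebra.Properties.Ring as RingProperties
import Algebra.Properties.Semiring.Mult.TCOptimised as Multiples
import Algebra.Solver.Ring as RingSolver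
open import Algebra.Solver.Ring.AlmostCommutativeRing using (AlmostCommutativeRing; fromCommutativeRing; _-Raw-AlmostCommutative⟶_)
open import Data.Bool using (Bool; true; false; not; _xor_; _∧_; if_then_else_)
import Data.Bool as Bool
open import Data.Bool.Properties using (xor-assoc; xor-comm; xor-identityʳ; xor-same; ∧-comm; xor-∧-commutativeRing)
import Algebra.Properties.CommutativeSemigroup as CommutativeSemigroup
open import Data.Empty using (⊥; ⊥-elim)
open import Data.Fin using (Fin)
import Data.Fin as Fin
import Data.Fin.Properties as Fin
open import Data.Integer using (ℤ; -[1+_]) renaming (+_ to int)
import Data.Integer as ℤ
import Data.Integer.Properties as ℤ
open import Data.List using (List; []; _∷_; _++_; [_]; length; map; filter; foldr; lookup; upTo; allFin; concatMap; cartesianProductWith)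
import Data.List.Properties as List
open import Data.List.Membership.Propositional using (_∈_; _∉_; find; lose)
open import Data.List.Membership.Propositional.Properties using (∈-++⁺ˡ; ∈-++⁺ʳ; ∈-++⁻; ∈-∃++; ∈-filter⁺; ∈-filter⁻; ∈-map⁺; ∈-map⁻; ∈-allFin; ∈-upTo⁺; ∈-concatMap⁺; ∈-cartesianProductWith⁺)
open import Data.List.Relation.Unary.All using (All; []; _∷_)
import Data.List.Relation.Unary.All as All
import Data.List.Relation.Unary.All.Properties as All
open import Data.List.Relation.Unary.AllPairs using (AllPairs; []; _∷_) renaming (map to AllPairs-map)
import Data.List.Relation.Unary.AllPairs.Properties as AllPairs
open import Data.List.Relation.Unary.Any using (Any; here; there)
import Data.List.Relation.Unary.Any as Any
import Data.List.Relation.Unary.Any.Properties as Any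
open import Data.List.Relation.Unary.Unique.Propositional using (Unique)
import Data.List.Relation.Unary.Unique.Propositional.Properties as Unique
open import Data.Maybe using (Maybe; just; nothing)
open import Data.Nat using (ℕ; zero; suc; z≤n; s≤s)
import Data.Nat as ℕ
import Data.Nat.Properties as ℕ
open import Data.Nat.ListAction using (sum)
open import Data.Product using (Σ; ∃; _×_; _,_; proj₁; proj₂)
open import Data.Product.Properties using (≡-dec)
open import Data.Sum using (_⊎_; inj₁; inj₂) renaming ([_,_]′ to either)
open import Data.Unit using (⊤; tt)
open import Function using (_∘_; id; case_of_)
open import Relation.Binary.Definitions using (Tri; tri<; tri≈; tri>)
open import Relation.Binary.PropositionalEquality using (_≡_; _≢_; refl; sym; trans; cong; cong₂; subst; subst₂; module ≡-Reasoning)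
open import Relation.Binary.Structures using (IsStrictTotalOrder)
open import Relation.Nullary using (¬_; ¬?; Dec; yes; no; contradiction)
open import Relation.Nullary.Decidable using (does; dec-true; dec-false; _×-dec_; _⊎-dec_)

-- Parity colourings take the place of faces and of the Jordan curve theorem. The colour of a corner
-- is found by casting a vertical ray; that it does not change along an edge is a cancellation over
-- the strip above that edge. Such rays need points with distinct abscissae, which a shear provides.
-- What remains of the plane is a cyclic order at each vertex and, for each closed walk, equalities
-- between the colours of neighbouring corners.
--
-- Merging the orders at the removed vertices into one contour keeps only one edge to each contour
-- vertex, so the equalities survive only for walks that avoid the dropped edges. The kept edges
-- still connect the contour to a root, and an edge between two contour vertices therefore closes up
-- to an admissible walk.
--
-- The graph is neither triangulated nor assumed connected: an empty contour means that a component
-- is finished, and a new root is chosen.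
--
-- Verticals compete only at a common lower end and horizontals only at a common upper end, so d
-- directions of each kind serve all vertices. Rows and columns are spaced by 4 while tilting moves
-- a curve by at most 1, so no unrelated pieces come together.

-- Ordered-field arithmetic

module OrderedField (ℝ : RealField) where
  open RealField ℝ public renaming (_≤_ to infix 4 _≤_)

  ring : CommutativeRing _ _
  ring = record { isCommutativeRing = isCommutativeRing }

  open CommutativeRing ring public
    using (+-assoc; +-comm; +-identityˡ; +-identityʳ; *-assoc; *-identityʳ; zeroˡ; zeroʳ; -‿inverseˡ; -‿inverseʳ; semiring)
  open RingProperties (CommutativeRing.ring ring) using (-‿distribˡ-*; -‿distribʳ-*; -‿involutive; -‿+-comm; -0#≈0#)
  open IsStrictTotalOrder isStrictTotalOrder public
    using (compare) renaming (irrefl to <-irrefl; trans to <-trans; _≟_ to _≟ᶠ_; _<?_ to _<?_)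

  module _ where
    open Multiples semiring renaming (_×_ to _·_)
    open ≡-Reasoning

    private
      -- Integers serve as the coefficients of the ring solver, so that numerals in an identity
      -- cancel by computation instead of being treated as unknown field elements.
      fromℤ : ℤ → Carrier
      fromℤ (int n) = n · 1#
      fromℤ -[1+ n ] = - (suc n · 1#)

      fromℤ-⊖ : ∀ m n → fromℤ (m ℤ.⊖ n) ≡ m · 1# + - (n · 1#)
      fromℤ-⊖ m zero = sym (trans (cong (m · 1# +_) -0#≈0#) (+-identityʳ _))
      fromℤ-⊖ zero (suc n) = sym (+-identityˡ _)
      fromℤ-⊖ (suc m) (suc n) = begin
        fromℤ (suc m ℤ.⊖ suc n)                     ≡⟨ cong fromℤ (ℤ.[1+m]⊖[1+n]≡m⊖n m n) ⟩
        fromℤ (m ℤ.⊖ n)                             ≡⟨ fromℤ-⊖ m n ⟩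
        m · 1# + - (n · 1#)                         ≡⟨ cong (_+ - (n · 1#)) (sym (+-identityʳ _)) ⟩
        m · 1# + 0# + - (n · 1#)                    ≡⟨ cong (λ z → m · 1# + z + - (n · 1#)) (sym (-‿inverseʳ 1#)) ⟩
        m · 1# + (1# + - 1#) + - (n · 1#)           ≡⟨ cong (_+ - (n · 1#)) (sym (+-assoc _ _ _)) ⟩
        m · 1# + 1# + - 1# + - (n · 1#)             ≡⟨ +-assoc _ _ _ ⟩
        m · 1# + 1# + (- 1# + - (n · 1#))           ≡⟨ cong₂ _+_ (+-comm _ _) (-‿+-comm 1# (n · 1#)) ⟩
        1# + m · 1# + - (1# + n · 1#)               ≡⟨ cong₂ (λ a b → a + - b) (sym (1+× m 1#)) (sym (1+× n 1#)) ⟩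
        suc m · 1# + - (suc n · 1#)                 ∎

      fromℤ-+ : ∀ i j → fromℤ (i ℤ.+ j) ≡ fromℤ i + fromℤ j
      fromℤ-+ (int m) (int n) = ×-homo-+ 1# m n
      fromℤ-+ (int m) -[1+ n ] = fromℤ-⊖ m (suc n)
      fromℤ-+ -[1+ m ] (int n) = trans (fromℤ-⊖ n (suc m)) (+-comm _ _)
      fromℤ-+ -[1+ m ] -[1+ n ] = begin
        - (suc (suc (m ℕ.+ n)) · 1#)          ≡⟨ cong (λ k → - (suc k · 1#)) (sym (ℕ.+-suc m n)) ⟩
        - ((suc m ℕ.+ suc n) · 1#)            ≡⟨ cong -_ (×-homo-+ 1# (suc m) (suc n)) ⟩
        - (suc m · 1# + suc n · 1#)           ≡⟨ sym (-‿+-comm _ _) ⟩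
        - (suc m · 1#) + - (suc n · 1#)       ∎

      fromℤ-neg : ∀ i → fromℤ (ℤ.- i) ≡ - fromℤ i
      fromℤ-neg (int zero) = sym -0#≈0#
      fromℤ-neg (int (suc n)) = refl
      fromℤ-neg -[1+ n ] = sym (-‿involutive _)

      fromℤ-*⁺ : ∀ m j → fromℤ (int m ℤ.* j) ≡ fromℤ (int m) * fromℤ j
      fromℤ-*⁺ m (int n) = trans (cong fromℤ (sym (ℤ.pos-* m n))) (×1-homo-* m n)
      fromℤ-*⁺ m -[1+ n ] = begin
        fromℤ (int m ℤ.* -[1+ n ])             ≡⟨ cong fromℤ (sym (ℤ.neg-distribʳ-* (int m) (int (suc n)))) ⟩
        fromℤ (ℤ.- (int m ℤ.* int (suc n)))        ≡⟨ fromℤ-neg (int m ℤ.* int (suc n)) ⟩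
        - fromℤ (int m ℤ.* int (suc n))            ≡⟨ cong -_ (fromℤ-*⁺ m (int (suc n))) ⟩
        - (fromℤ (int m) * fromℤ (int (suc n)))    ≡⟨ -‿distribʳ-* _ _ ⟩
        fromℤ (int m) * - fromℤ (int (suc n))      ∎

      fromℤ-* : ∀ i j → fromℤ (i ℤ.* j) ≡ fromℤ i * fromℤ j
      fromℤ-* (int m) j = fromℤ-*⁺ m j
      fromℤ-* -[1+ m ] j = begin
        fromℤ (-[1+ m ] ℤ.* j)               ≡⟨ cong fromℤ (sym (ℤ.neg-distribˡ-* (int (suc m)) j)) ⟩
        fromℤ (ℤ.- (int (suc m) ℤ.* j))          ≡⟨ fromℤ-neg (int (suc m) ℤ.* j) ⟩
        - fromℤ (int (suc m) ℤ.* j)              ≡⟨ cong -_ (fromℤ-*⁺ (suc m) j) ⟩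
        - (fromℤ (int (suc m)) * fromℤ j)        ≡⟨ -‿distribˡ-* _ _ ⟩
        - fromℤ (int (suc m)) * fromℤ j          ∎

      acr : AlmostCommutativeRing _ _
      acr = fromCommutativeRing ring

      morphism : CommutativeRing.rawRing ℤ.+-*-commutativeRing -Raw-AlmostCommutative⟶ acr
      morphism = record
        { ⟦_⟧ = fromℤ ; +-homo = fromℤ-+ ; *-homo = fromℤ-* ; -‿homo = fromℤ-neg
        ; 0-homo = refl ; 1-homo = refl }

      coefficient≟ : ∀ i j → Maybe (fromℤ i ≡ fromℤ j)
      coefficient≟ i j with i ℤ.≟ j
      ... | yes i≡j = just (cong fromℤ i≡j)
      ... | no _ = nothing

    open RingSolver (CommutativeRing.rawRing ℤ.+-*-commutativeRing) acr morphism coefficient≟ public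
      using (solve; _:=_; con; _:+_; _:*_; :-_; _:-_; Polynomial)

  infixl 6 _-_
  _-_ : Carrier → Carrier → Carrier
  x - y = x + - y

  :0 :1 : ∀ {n} → Polynomial n
  :0 = con (int 0)
  :1 = con (int 1)

  <-irr : ∀ {x} → ¬ (x < x)
  <-irr = <-irrefl refl

  <⇒0< : ∀ {x y} → x < y → 0# < y - x
  <⇒0< {x} {y} p = subst (_< y - x) (-‿inverseʳ x) (+-mono-< (- x) p)

  0<⇒< : ∀ {x y} → 0# < y - x → x < y
  0<⇒< {x} {y} p = subst₂ _<_ (+-identityˡ x) (solve 2 (λ x y → (y :- x) :+ x := y) refl x y) (+-mono-< x p)

  ≤⇒0≤ : ∀ {x y} → x ≤ y → 0# ≤ (y - x)
  ≤⇒0≤ (inj₁ p) = inj₁ (<⇒0< p)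
  ≤⇒0≤ {x} (inj₂ refl) = inj₂ (sym (-‿inverseʳ x))

  0≤⇒≤ : ∀ {x y} → 0# ≤ (y - x) → x ≤ y
  0≤⇒≤ (inj₁ p) = inj₁ (0<⇒< p)
  0≤⇒≤ {x} {y} (inj₂ e) = inj₂ (trans (sym (+-identityˡ x)) (trans (cong (_+ x) e) (solve 2 (λ x y → (y :- x) :+ x := y) refl x y)))

  0<+ : ∀ {x y} → 0# < x → 0# < y → 0# < x + y
  0<+ {x} {y} p q = <-trans q (subst (_< x + y) (+-identityˡ y) (+-mono-< y p))

  0≤0 : 0# ≤ 0#
  0≤0 = inj₂ refl

  0<+≤ : ∀ {x y} → 0# < x → 0# ≤ y → 0# < x + y
  0<+≤ p (inj₁ q) = 0<+ p q
  0<+≤ p (inj₂ refl) = subst (0# <_) (sym (+-identityʳ _)) p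

  0≤+ : ∀ {x y} → 0# ≤ x → 0# ≤ y → 0# ≤ (x + y)
  0≤+ (inj₁ p) q = inj₁ (0<+≤ p q)
  0≤+ (inj₂ refl) q = subst (0# ≤_) (sym (+-identityˡ _)) q

  0≤* : ∀ {x y} → 0# ≤ x → 0# ≤ y → 0# ≤ (x * y)
  0≤* (inj₁ p) (inj₁ q) = inj₁ (*-pos p q)
  0≤* {x} (inj₁ p) (inj₂ refl) = inj₂ (sym (zeroʳ x))
  0≤* {y = y} (inj₂ refl) _ = inj₂ (sym (zeroˡ y))

  ≤-refl : ∀ {x} → x ≤ x
  ≤-refl = inj₂ refl

  ≤-<-trans : ∀ {x y z} → x ≤ y → y < z → x < z
  ≤-<-trans (inj₁ p) q = <-trans p q
  ≤-<-trans (inj₂ refl) q = q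

  <-≤-trans : ∀ {x y z} → x < y → y ≤ z → x < z
  <-≤-trans p (inj₁ q) = <-trans p q
  <-≤-trans p (inj₂ refl) = p

  ≤-trans : ∀ {x y z} → x ≤ y → y ≤ z → x ≤ z
  ≤-trans (inj₁ p) q = inj₁ (<-≤-trans p q)
  ≤-trans (inj₂ refl) q = q

  -- Certificates: an inequality follows once the difference of its sides is
  -- rewritten, by a ring identity, as a combination known to be nonnegative.
  0<-by : ∀ {x y e} → 0# < e → y - x ≡ e → x < y
  0<-by p q = 0<⇒< (subst (0# <_) (sym q) p)

  0≤-by : ∀ {x y e} → 0# ≤ e → y - x ≡ e → x ≤ y
  0≤-by p q = 0≤⇒≤ (subst (0# ≤_) (sym q) p)

  absurd-by : ∀ {e} → 0# < e → e ≡ 0# → ⊥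
  absurd-by p refl = <-irr p

  0<1 : 0# < 1#
  0<1 with compare 0# 1#
  ... | tri< p _ _ = p
  ... | tri≈ _ e _ = ⊥-elim (0≢1 e)
  ... | tri> _ _ p = subst (0# <_) (solve 0 ((:- :1) :* (:- :1) := :1) refl) (*-pos q q)
    where q = subst (0# <_) (+-identityˡ _) (<⇒0< p)

  inv⁺ : ∀ {x} → 0# < x → ∃ λ y → 0# < y × x * y ≡ 1#
  inv⁺ {x} p with inverse x (λ { refl → <-irr p })
  ... | y , e with compare 0# y
  ... | tri< q _ _ = y , q , e
  ... | tri≈ _ refl _ = ⊥-elim (0≢1 (trans (sym (zeroʳ x)) e))
  ... | tri> _ _ q = ⊥-elim (absurd-by (0<+ (*-pos p (<⇒0< q)) 0<1)
          (trans (solve 2 (λ x y → x :* (:0 :- y) :+ :1 := :- (x :* y) :+ :1) refl x y)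
          (trans (cong (λ z → - z + 1#) e) (-‿inverseˡ 1#))))

  *-cancel : ∀ {x y} → x * y ≡ 0# → y ≢ 0# → x ≡ 0#
  *-cancel {x} {y} e n with inverse y n
  ... | z , q = begin
    x             ≡⟨ sym (*-identityʳ x) ⟩
    x * 1#        ≡⟨ cong (x *_) (sym q) ⟩
    x * (y * z)   ≡⟨ sym (*-assoc x y z) ⟩
    x * y * z     ≡⟨ cong (_* z) e ⟩
    0# * z        ≡⟨ zeroˡ z ⟩
    0#            ∎
    where open ≡-Reasoning

  -≡0⇒≡ : ∀ {x y} → x - y ≡ 0# → x ≡ y
  -≡0⇒≡ {x} {y} e = trans (solve 2 (λ x y → x := (x :- y) :+ y) refl x y) (trans (cong (_+ y) e) (+-identityˡ y))

  ≡⇒-≡0 : ∀ {x y} → x ≡ y → x - y ≡ 0#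
  ≡⇒-≡0 {x} refl = -‿inverseʳ x

-- Points on segments

module Incidence (ℝ : RealField) where
  open OrderedField ℝ
  open Geometry ℝ

  OnSeg-left : ∀ p q → OnSeg p q p
  OnSeg-left (p₁ , p₂) (q₁ , q₂) = 0# , 0≤0 , inj₁ 0<1 , st p₁ q₁ , st p₂ q₂
    where
      st : ∀ a b → a ≡ a + 0# * (b - a)
      st a b = solve 2 (λ a b → a := a :+ :0 :* (b :- a)) refl a b

  OnSeg-right : ∀ p q → OnSeg p q q
  OnSeg-right (p₁ , p₂) (q₁ , q₂) = 1# , inj₁ 0<1 , ≤-refl , en p₁ q₁ , en p₂ q₂
    where
      en : ∀ a b → b ≡ a + 1# * (b - a)
      en a b = solve 2 (λ a b → b := a :+ :1 :* (b :- a)) refl a b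

  OnSeg-reverse : ∀ {p q z} → OnSeg p q z → OnSeg q p z
  OnSeg-reverse {p₁ , p₂} {q₁ , q₂} (t , t≥0 , t≤1 , refl , refl) =
    1# - t , ≤⇒0≤ t≤1 , 0≤-by t≥0 (solve 1 (λ t → :1 :- (:1 :- t) := t) refl t) , rev p₁ q₁ , rev p₂ q₂
    where
      rev : ∀ a b → a + t * (b - a) ≡ b + (1# - t) * (a - b)
      rev a b = solve 3 (λ a b t → a :+ t :* (b :- a) := b :+ (:1 :- t) :* (a :- b)) refl a b t

-- Layouts: coordinates for L-shaped edges

module _ {a r} {A : Set a} {R : A → A → Set r} where

  AllPairs-++⁻ : ∀ xs {ys} → AllPairs R (xs ++ ys) →
    AllPairs R xs × AllPairs R ys × All (λ x → All (R x) ys) xs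
  AllPairs-++⁻ [] p = [] , p , []
  AllPairs-++⁻ (x ∷ xs) (p ∷ ps) with All.++⁻ xs p | AllPairs-++⁻ xs ps
  ... | q , q' | r , s , t = q ∷ r , s , q' ∷ t

-- Renumbering of the columns that vacates column `k` for a new vertex and preserves the order of
-- the others.
bump : ℕ → ℕ → ℕ
bump k m with m ℕ.<? k
... | yes _ = m
... | no _ = suc m

bump-< : ∀ k {m} → m ℕ.< k → bump k m ℕ.< k
bump-< k {m} p with m ℕ.<? k
... | yes _ = p
... | no q = contradiction p q

bump-> : ∀ k {m} → k ℕ.≤ m → k ℕ.< bump k m
bump-> k {m} p with m ℕ.<? k
... | yes q = contradiction p (ℕ.<⇒≱ q)
... | no _ = s≤s p

bump-≢ : ∀ k m → bump k m ≢ k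
bump-≢ k m e with m ℕ.<? k
... | yes q = ℕ.<⇒≢ q e
... | no q = q (ℕ.≤-reflexive e)

bump-mono : ∀ k {a b} → a ℕ.< b → bump k a ℕ.< bump k b
bump-mono k {a} {b} p with a ℕ.<? k | b ℕ.<? k
... | yes _ | yes _ = p
... | yes _ | no _ = ℕ.m<n⇒m<1+n p
... | no a≮k | yes b<k = contradiction (ℕ.<-trans p b<k) a≮k
... | no _ | no _ = s≤s p

bump-cancel-< : ∀ k {a b} → bump k a ℕ.< bump k b → a ℕ.< b
bump-cancel-< k {a} {b} p with ℕ.<-cmp a b
... | tri< q _ _ = q
... | tri≈ _ refl _ = contradiction p (ℕ.<-irrefl refl)
... | tri> _ _ q = contradiction p (ℕ.<-asym (bump-mono k q))

bump-injective : ∀ k {a b} → bump k a ≡ bump k b → a ≡ b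
bump-injective k {a} {b} e with ℕ.<-cmp a b
... | tri< q _ _ = contradiction e (ℕ.<⇒≢ (bump-mono k q))
... | tri≈ _ e' _ = e'
... | tri> _ _ q = contradiction (sym e) (ℕ.<⇒≢ (bump-mono k q))

Between : ℕ → ℕ → ℕ → Set
Between a b c = (a ℕ.< b × b ℕ.< c) ⊎ (c ℕ.< b × b ℕ.< a)

module Layouts {n : ℕ} (G : Graph n) where
  open Graph G using (adj; irrefl)

  V : Set
  V = Fin n

  infix 4 _~_
  _~_ : V → V → Set
  u ~ v = adj u v ≡ true

  ~-sym : ∀ {u v} → u ~ v → v ~ u
  ~-sym {u} {v} p = trans (Graph.sym G v u) p

  ~-irrefl : ∀ {u} → ¬ (u ~ u)
  ~-irrefl {u} p with () ← trans (sym p) (irrefl u)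

  remove : V → List V → List V
  remove x = filter (λ y → ¬? (y Fin.≟ x))

  ∈-remove⁺ : ∀ {x y xs} → y ∈ xs → y ≢ x → y ∈ remove x xs
  ∈-remove⁺ = ∈-filter⁺ _

  ∈-remove⁻ : ∀ {x y xs} → y ∈ remove x xs → y ∈ xs × y ≢ x
  ∈-remove⁻ {xs = xs} = ∈-filter⁻ _ {xs = xs}

  length-remove : ∀ {x xs} → x ∈ xs → length (remove x xs) ℕ.< length xs
  length-remove {x} {xs} p = List.filter-notAll _ xs (Any.map (λ e ne → ne (sym e)) p)

  -- The edge with lower end u and upper end v is drawn as the vertical from
  -- (X u , Y u) to (X u , Y v) followed by the horizontal to (X v , Y v).
  -- A vertex w is hidden by it once the horizontal passes over w, and `free`
  -- says that no edge leaves a hidden vertex upwards.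
  record Layout (S F : List V) : Set where
    field
      X Y : V → ℕ
      height : ℕ
      Y<height : ∀ {v} → v ∈ S → Y v ℕ.< height
      X-injective : ∀ {u v} → u ∈ S → v ∈ S → X u ≡ X v → u ≡ v
      Y-injective : ∀ {u v} → u ∈ S → v ∈ S → Y u ≡ Y v → u ≡ v
      sorted : AllPairs (λ u v → X u ℕ.< X v) F
      frontier⊆ : ∀ {v} → v ∈ F → v ∈ S
      visible : ∀ {u v w} → u ∈ S → v ∈ S → w ∈ F → u ~ v → Y u ℕ.< Y v → Y w ℕ.< Y v →
                ¬ Between (X u) (X w) (X v)
      free : ∀ {u v w z} → u ∈ S → v ∈ S → w ∈ S → z ∈ S → u ~ v → w ~ z →
             Y u ℕ.< Y v → Y w ℕ.< Y v → Y v ℕ.< Y z → ¬ Between (X u) (X w) (X v)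

  emptyLayout : ∀ {S} → (∀ {v} → v ∉ S) → Layout S []
  emptyLayout e = record
    { X = λ _ → 0 ; Y = λ _ → 0 ; height = 0 ; Y<height = ⊥-elim ∘ e
    ; X-injective = λ p → ⊥-elim (e p) ; Y-injective = λ p → ⊥-elim (e p)
    ; sorted = [] ; frontier⊆ = λ () ; visible = λ p → ⊥-elim (e p) ; free = λ p → ⊥-elim (e p) }

  forgetFrontier : ∀ {S F} → Layout S F → Layout S []
  forgetFrontier l = record
    { X = X ; Y = Y ; height = height ; Y<height = Y<height ; X-injective = X-injective ; Y-injective = Y-injective
    ; sorted = [] ; frontier⊆ = λ () ; visible = λ _ _ () ; free = free }
    where open Layout l

  -- The column `k` is one more than the largest column in `P`, or 0 if `P` is empty, so it exists
  -- even when `Q` is empty.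
  split-at : ∀ (X : V → ℕ) P {Q} → AllPairs (λ u v → X u ℕ.< X v) (P ++ Q) →
    ∃ λ k → (∀ {p} → p ∈ P → X p ℕ.< k) × (∀ {q} → q ∈ Q → k ℕ.≤ X q)
  split-at X [] _ = 0 , (λ ()) , λ _ → z≤n
  split-at X (p ∷ P) {Q} (a ∷ as) with split-at X P as
  ... | k , below , above = suc (X p) ℕ.⊔ k
      , (λ { (here refl) → ℕ.m≤m⊔n (suc (X p)) k
           ; (there q) → ℕ.≤-trans (below q) (ℕ.m≤n⊔m (suc (X p)) k) })
      , λ q → ℕ.⊔-lub (All.lookup a (∈-++⁺ʳ P q)) (above q)

  last-max : ∀ (X : V → ℕ) P {u w} → AllPairs (λ u v → X u ℕ.< X v) (P ++ [ u ]) → w ∈ P ++ [ u ] → X w ℕ.≤ X u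
  last-max X [] _ (here refl) = ℕ.≤-refl
  last-max X (p ∷ P) (a ∷ _) (here refl) = ℕ.<⇒≤ (All.lookup a (∈-++⁺ʳ P (here refl)))
  last-max X (p ∷ P) (_ ∷ as) (there q) = last-max X P as q

  IsLast IsHead : V → List V → Set
  IsLast u P = ∃ λ P' → P ≡ P' ++ [ u ]
  IsHead u S = ∃ λ S' → S ≡ u ∷ S'

  -- The vertices of `N` leave the frontier and may be hidden by the edges into `x`. By `near` every
  -- lower neighbour of `x` lies in `N` or borders it, so the horizontals into `x` pass over no
  -- vertex that stays in the frontier.
  module AddTop {S} (x : V) (x∈S : x ∈ S) (P N Q : List V) (l : Layout (remove x S) (P ++ N ++ Q))
    (near : ∀ {u} → u ∈ S → u ~ x → IsLast u P ⊎ u ∈ N ⊎ IsHead u Q) where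
    open Layout l

    private
      parts = AllPairs-++⁻ P sorted
      parts' = AllPairs-++⁻ N (proj₁ (proj₂ parts))
      sortedP = proj₁ parts
      sortedN = proj₁ parts'
      sortedQ = proj₁ (proj₂ parts')
      cut = split-at X P sorted
      k = proj₁ cut
      P<k = proj₁ (proj₂ cut)
      k≤ = proj₂ (proj₂ cut)

      N<Q : ∀ {u v} → u ∈ N → v ∈ Q → X u ℕ.< X v
      N<Q p q = All.lookup (All.lookup (proj₂ (proj₂ parts')) p) q

      X' Y' : V → ℕ
      X' v with v Fin.≟ x
      ... | yes _ = k
      ... | no _ = bump k (X v)
      Y' v with v Fin.≟ x
      ... | yes _ = height
      ... | no _ = Y v

      X'-top : X' x ≡ k
      X'-top with x Fin.≟ x
      ... | yes _ = refl
      ... | no q = contradiction refl q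

      Y'-top : Y' x ≡ height
      Y'-top with x Fin.≟ x
      ... | yes _ = refl
      ... | no q = contradiction refl q

      X'-old : ∀ {v} → v ≢ x → X' v ≡ bump k (X v)
      X'-old {v} ne with v Fin.≟ x
      ... | yes q = contradiction q ne
      ... | no _ = refl

      Y'-old : ∀ {v} → v ≢ x → Y' v ≡ Y v
      Y'-old {v} ne with v Fin.≟ x
      ... | yes q = contradiction q ne
      ... | no _ = refl

      old : ∀ {v} → v ∈ S → v ≢ x → v ∈ remove x S
      old = ∈-remove⁺

      F-old : ∀ {v} → v ∈ P ++ N ++ Q → v ≢ x
      F-old p = proj₂ (∈-remove⁻ {xs = S} (frontier⊆ p))

      Y'-max : ∀ {v} → v ∈ S → Y' v ℕ.≤ height
      Y'-max {v} p with v Fin.≟ x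
      ... | yes _ = ℕ.≤-refl
      ... | no q = ℕ.<⇒≤ (Y<height (old p q))

      lower≢ : ∀ {u v} → v ∈ S → Y' u ℕ.< Y' v → u ≢ x
      lower≢ p q refl = ℕ.<⇒≱ q (ℕ.≤-trans (Y'-max p) (ℕ.≤-reflexive (sym Y'-top)))

      Y-old : ∀ {u v} → u ≢ x → v ≢ x → Y' u ℕ.< Y' v → Y u ℕ.< Y v
      Y-old p q r = subst₂ ℕ._<_ (Y'-old p) (Y'-old q) r

      X-old : ∀ {u v} → u ≢ x → v ≢ x → X' u ℕ.< X' v → X u ℕ.< X v
      X-old p q r = bump-cancel-< k (subst₂ ℕ._<_ (X'-old p) (X'-old q) r)

      X'-mono : ∀ {u v} → u ≢ x → v ≢ x → X u ℕ.< X v → X' u ℕ.< X' v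
      X'-mono p q r = subst₂ ℕ._<_ (sym (X'-old p)) (sym (X'-old q)) (bump-mono k r)

      Between-old : ∀ {u v w} → u ≢ x → v ≢ x → w ≢ x → Between (X' u) (X' w) (X' v) → Between (X u) (X w) (X v)
      Between-old p q r (inj₁ (s , t)) = inj₁ (X-old p r s , X-old r q t)
      Between-old p q r (inj₂ (s , t)) = inj₂ (X-old q r s , X-old r p t)

      left : ∀ {p} → p ∈ P → X' p ℕ.< k
      left {p} q = subst (ℕ._< k) (sym (X'-old (F-old (∈-++⁺ˡ q)))) (bump-< k (P<k q))

      right : ∀ {p} → p ∈ N ++ Q → k ℕ.< X' p
      right {p} q = subst (k ℕ.<_) (sym (X'-old (F-old (∈-++⁺ʳ P q)))) (bump-> k (k≤ q))

      asym : ∀ {a b} → a ℕ.< b → ¬ (b ℕ.< a)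
      asym = ℕ.<-asym

      -- One argument for both coordinates: abscissae are renumbered by `bump k` and `x` receives
      -- `k`; ordinates are kept and `x` receives `height`.
      injective : ∀ (f f' : V → ℕ) (g : ℕ → ℕ) {t} → f' x ≡ t → (∀ {v} → v ≢ x → f' v ≡ g (f v)) →
        (∀ {a b} → g a ≡ g b → a ≡ b) → (∀ {v} → v ∈ remove x S → g (f v) ≢ t) →
        (∀ {u v} → u ∈ remove x S → v ∈ remove x S → f u ≡ f v → u ≡ v) →
        ∀ {u v} → u ∈ S → v ∈ S → f' u ≡ f' v → u ≡ v
      injective f f' g top olds g-inj ne inj {u} {v} p q e with u Fin.≟ x | v Fin.≟ x
      ... | yes refl | yes refl = refl
      ... | yes refl | no v≢x = contradiction (trans (sym (olds v≢x)) (trans (sym e) top)) (ne (old q v≢x))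
      ... | no u≢x | yes refl = contradiction (trans (sym (olds u≢x)) (trans e top)) (ne (old p u≢x))
      ... | no u≢x | no v≢x = inj (old p u≢x) (old q v≢x) (g-inj (trans (sym (olds u≢x)) (trans e (olds v≢x))))

      sorted-old : ∀ {F} → AllPairs (λ u v → X u ℕ.< X v) F → (∀ {v} → v ∈ F → v ≢ x) → AllPairs (λ u v → X' u ℕ.< X' v) F
      sorted-old [] _ = []
      sorted-old (a ∷ as) ne =
        All.tabulate (λ q → X'-mono (ne (here refl)) (ne (there q)) (All.lookup a q)) ∷ sorted-old as (ne ∘ there)

      -- A horizontal into `x` ends at column `k` and starts no farther out than the last vertex of
      -- `P` or the first of `Q`; the other remaining frontier vertices lie farther out still.
      unhidden : ∀ {u w} → u ∈ S → u ~ x → w ∈ P ++ x ∷ Q → ¬ Between (X' u) (X' w) k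
      unhidden {u} {w} u∈ e w∈ b with ∈-++⁻ P w∈
      unhidden u∈ e w∈ (inj₁ (_ , lt)) | inj₂ (here refl) = ℕ.<-irrefl X'-top lt
      unhidden u∈ e w∈ (inj₂ (lt , _)) | inj₂ (here refl) = ℕ.<-irrefl (sym X'-top) lt
      unhidden u∈ e w∈ (inj₂ (k<w , _)) | inj₁ w∈P = asym k<w (left w∈P)
      unhidden u∈ e w∈ (inj₁ (u<w , w<k)) | inj₁ w∈P with near u∈ e
      ... | inj₂ (inj₁ u∈N) = asym (ℕ.<-trans u<w w<k) (right (∈-++⁺ˡ u∈N))
      ... | inj₂ (inj₂ (_ , refl)) = asym (ℕ.<-trans u<w w<k) (right (∈-++⁺ʳ N (here refl)))
      ... | inj₁ (P' , refl) =
        ℕ.<⇒≱ (X-old (F-old (∈-++⁺ˡ (∈-++⁺ʳ P' (here refl)))) (F-old (∈-++⁺ˡ w∈P)) u<w) (last-max X P' sortedP w∈P)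
      unhidden u∈ e w∈ (inj₁ (_ , w<k)) | inj₂ (there w∈Q) = asym w<k (right (∈-++⁺ʳ N w∈Q))
      unhidden u∈ e w∈ (inj₂ (k<w , w<u)) | inj₂ (there w∈Q) with near u∈ e
      ... | inj₁ (P' , refl) = asym (ℕ.<-trans k<w w<u) (left (∈-++⁺ʳ P' (here refl)))
      ... | inj₂ (inj₁ u∈N) = asym w<u (X'-mono (F-old (∈-++⁺ʳ P (∈-++⁺ˡ u∈N))) (F-old (∈-++⁺ʳ P (∈-++⁺ʳ N w∈Q))) (N<Q u∈N w∈Q))
      unhidden u∈ e w∈ (inj₂ (k<w , w<u)) | inj₂ (there (here refl)) | inj₂ (inj₂ (_ , refl)) = ℕ.<-irrefl refl w<u
      unhidden u∈ e w∈ (inj₂ (k<w , w<u)) | inj₂ (there w∈Q@(there w∈Q')) | inj₂ (inj₂ (_ , refl)) =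
        asym w<u (X'-mono (F-old (∈-++⁺ʳ P (∈-++⁺ʳ N (here refl)))) (F-old (∈-++⁺ʳ P (∈-++⁺ʳ N w∈Q))) (All.lookup (head sortedQ) w∈Q'))
        where
          head : ∀ {R : V → V → Set} {y ys} → AllPairs R (y ∷ ys) → All (R y) ys
          head (a ∷ _) = a

    addTop : Layout S (P ++ x ∷ Q)
    addTop = record
      { X = X' ; Y = Y' ; height = suc height
      ; Y<height = λ p → s≤s (Y'-max p)
      ; X-injective = injective X X' (bump k) X'-top X'-old (bump-injective k) (λ _ → bump-≢ k _) X-injective
      ; Y-injective = injective Y Y' id Y'-top Y'-old id (λ p → ℕ.<⇒≢ (Y<height p)) Y-injective
      ; sorted = AllPairs.++⁺ (sorted-old sortedP (F-old ∘ ∈-++⁺ˡ))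
          (All.tabulate (λ {v} q → subst (λ t → t ℕ.< X' v) (sym X'-top) (right (∈-++⁺ʳ N q)))
            ∷ sorted-old sortedQ (F-old ∘ ∈-++⁺ʳ P ∘ ∈-++⁺ʳ N))
          (All.tabulate λ {u} p → subst (λ t → X' u ℕ.< t) (sym X'-top) (left p)
            ∷ All.tabulate λ q → ℕ.<-trans (left p) (right (∈-++⁺ʳ N q)))
      ; frontier⊆ = λ p → frontier⊆' (∈-++⁻ P p)
      ; visible = visible'
      ; free = free' }
      where
        frontier⊆' : ∀ {v} → v ∈ P ⊎ v ∈ x ∷ Q → v ∈ S
        frontier⊆' (inj₁ p) = proj₁ (∈-remove⁻ (frontier⊆ (∈-++⁺ˡ p)))
        frontier⊆' (inj₂ (here refl)) = x∈S
        frontier⊆' (inj₂ (there p)) = proj₁ (∈-remove⁻ (frontier⊆ (∈-++⁺ʳ P (∈-++⁺ʳ N p))))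

        shrink : ∀ {w} → w ∈ P ++ x ∷ Q → w ≢ x → w ∈ P ++ N ++ Q
        shrink p ne with ∈-++⁻ P p
        ... | inj₁ q = ∈-++⁺ˡ q
        ... | inj₂ (here refl) = contradiction refl ne
        ... | inj₂ (there q) = ∈-++⁺ʳ P (∈-++⁺ʳ N q)

        visible' : ∀ {u v w} → u ∈ S → v ∈ S → w ∈ P ++ x ∷ Q → u ~ v → Y' u ℕ.< Y' v → Y' w ℕ.< Y' v →
          ¬ Between (X' u) (X' w) (X' v)
        visible' {u} {v} {w} u∈ v∈ w∈ e u<v w<v b with v Fin.≟ x
        ... | yes refl = unhidden u∈ e w∈ b
        ... | no v≢x with lower≢ v∈ (subst (Y' u ℕ.<_) (sym (Y'-old v≢x)) u<v) | lower≢ v∈ (subst (Y' w ℕ.<_) (sym (Y'-old v≢x)) w<v)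
        ... | u≢x | w≢x = visible (old u∈ u≢x) (old v∈ v≢x) (shrink w∈ w≢x) e
            (subst (ℕ._< Y v) (Y'-old u≢x) u<v) (subst (ℕ._< Y v) (Y'-old w≢x) w<v)
            (Between-old u≢x v≢x w≢x (subst (Between (X' u) (X' w)) (sym (X'-old v≢x)) b))

        free' : ∀ {u v w z} → u ∈ S → v ∈ S → w ∈ S → z ∈ S → u ~ v → w ~ z →
          Y' u ℕ.< Y' v → Y' w ℕ.< Y' v → Y' v ℕ.< Y' z → ¬ Between (X' u) (X' w) (X' v)
        free' {u} {v} {w} {z} u∈ v∈ w∈ z∈ e e' u<v w<v v<z b = go (z Fin.≟ x)
          where
            v≢x = lower≢ z∈ v<z
            u≢x = lower≢ v∈ u<v
            w≢x = lower≢ v∈ w<v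
            b' = Between-old u≢x v≢x w≢x b
            go : Dec (z ≡ x) → ⊥
            go (no z≢x) = free (old u∈ u≢x) (old v∈ v≢x) (old w∈ w≢x) (old z∈ z≢x) e e'
              (Y-old u≢x v≢x u<v) (Y-old w≢x v≢x w<v) (Y-old v≢x z≢x v<z) b'
            -- An edge up to `x` starts at a neighbour of `x`, which belongs to the old frontier;
            -- there `visible` has ruled out being hidden.
            go (yes refl) = visible (old u∈ u≢x) (old v∈ v≢x) w∈F e (Y-old u≢x v≢x u<v) (Y-old w≢x v≢x w<v) b'
              where
                w∈F : w ∈ P ++ N ++ Q
                w∈F with near w∈ e'
                ... | inj₁ (P' , refl) = ∈-++⁺ˡ (∈-++⁺ʳ P' (here refl))
                ... | inj₂ (inj₁ q) = ∈-++⁺ʳ P (∈-++⁺ˡ q)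
                ... | inj₂ (inj₂ (_ , refl)) = ∈-++⁺ʳ P (∈-++⁺ʳ N (here refl))

-- Planar rotation systems and canonical orders

module _ {A : Set} where

  Unique-++⁻ : ∀ xs {ys : List A} → Unique (xs ++ ys) → Unique xs × Unique ys × (∀ {z} → z ∈ xs → z ∉ ys)
  Unique-++⁻ xs u with AllPairs-++⁻ xs u
  ... | p , q , r = p , q , λ z∈xs z∈ys → All.lookup (All.lookup r z∈xs) z∈ys refl

  Unique-middle : ∀ xs {y : A} {ys} → Unique (xs ++ y ∷ ys) → y ∉ xs × y ∉ ys
  Unique-middle xs u with Unique-++⁻ xs u
  ... | _ , (p ∷ _) , r = (λ q → r q (here refl)) , λ q → All.lookup p q refl

  Unique-drop : ∀ xs {y : A} {ys} → Unique (xs ++ y ∷ ys) → Unique (xs ++ ys)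
  Unique-drop xs u with Unique-++⁻ xs u
  ... | p , (_ ∷ q) , r = Unique.++⁺ p q λ (s , t) → r s (there t)

module _ {A B : Set} (f : A → B) where

  map-++⁻ : ∀ xs {ys zs} → map f xs ≡ ys ++ zs →
    ∃ λ us → ∃ λ vs → xs ≡ us ++ vs × map f us ≡ ys × map f vs ≡ zs
  map-++⁻ xs {[]} e = [] , xs , refl , refl , e
  map-++⁻ (x ∷ xs) {y ∷ ys} e with List.∷-injective e
  ... | refl , e' with map-++⁻ xs {ys} e'
  ... | us , vs , refl , refl , r = x ∷ us , vs , refl , refl , r

  map-∷⁻ : ∀ xs {y ys} → map f xs ≡ y ∷ ys → ∃ λ u → ∃ λ vs → xs ≡ u ∷ vs × f u ≡ y × map f vs ≡ ys
  map-∷⁻ (x ∷ xs) refl = x , xs , refl , refl , refl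

module Canonical {n : ℕ} (G : Graph n) where
  open Layouts G
  open import Data.List.Membership.DecPropositional (Fin._≟_ {n}) using (_∈?_)

  data Walk : V → V → Set where
    [] : ∀ {u} → Walk u u
    step : ∀ {u v w} → u ~ v → Walk v w → Walk u w

  _⁀_ : ∀ {u v w} → Walk u v → Walk v w → Walk u w
  [] ⁀ q = q
  step e p ⁀ q = step e (p ⁀ q)

  reverse : ∀ {u v} → Walk u v → Walk v u
  reverse [] = []
  reverse (step e p) = reverse p ⁀ step (~-sym e) []

  AllSteps : (V → V → Set) → ∀ {u v} → Walk u v → Set
  AllSteps P [] = ⊤
  AllSteps P (step {u} {v} _ p) = P u v × AllSteps P p

  module _ {P : V → V → Set} where
    AllSteps-⁀ : ∀ {u v w} (p : Walk u v) {q : Walk v w} → AllSteps P p → AllSteps P q → AllSteps P (p ⁀ q)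
    AllSteps-⁀ [] _ b = b
    AllSteps-⁀ (step _ p) (a , as) b = a , AllSteps-⁀ p as b

    AllSteps-reverse : (∀ {x y} → P x y → P y x) → ∀ {u v} (p : Walk u v) → AllSteps P p → AllSteps P (reverse p)
    AllSteps-reverse s [] _ = tt
    AllSteps-reverse s (step _ p) (a , as) = AllSteps-⁀ (reverse p) (AllSteps-reverse s p as) (s a , tt)

    AllSteps-map : ∀ {Q : V → V → Set} → (∀ {x y} → x ~ y → P x y → Q x y) → ∀ {u v} (p : Walk u v) → AllSteps P p → AllSteps Q p
    AllSteps-map f [] _ = tt
    AllSteps-map f (step e p) (a , as) = f e a , AllSteps-map f p as

  SameEdge : V → V → V → V → Set
  SameEdge x y u v = (x ≡ u × y ≡ v) ⊎ (x ≡ v × y ≡ u)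

  sameEdge? : ∀ x y u v → Dec (SameEdge x y u v)
  sameEdge? x y u v = ((x Fin.≟ u) ×-dec (y Fin.≟ v)) ⊎-dec ((x Fin.≟ v) ×-dec (y Fin.≟ u))

  parity : ∀ {a b} → Walk a b → V → V → Bool
  parity [] u v = false
  parity (step {x} {y} _ p) u v = does (sameEdge? x y u v) xor parity p u v

  parity-⁀ : ∀ {a b c} (p : Walk a b) {q : Walk b c} {u v} → parity (p ⁀ q) u v ≡ parity p u v xor parity q u v
  parity-⁀ [] = refl
  parity-⁀ (step {x} {y} _ p) {q} {u} {v} =
    trans (cong (does (sameEdge? x y u v) xor_) (parity-⁀ p)) (sym (xor-assoc (does (sameEdge? x y u v)) (parity p u v) (parity q u v)))

  parity-unused : ∀ {a b} (p : Walk a b) {u v} → AllSteps (λ x y → ¬ SameEdge x y u v) p → parity p u v ≡ false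
  parity-unused [] _ = refl
  parity-unused (step {x} {y} _ p) {u} {v} (a , as) = cong₂ _xor_ (dec-false (sameEdge? x y u v) a) (parity-unused p as)

  Dart : Set
  Dart = V × V

  -- `Flow L R a δs b`: reading off, for consecutive darts, the colour to the
  -- right and to the left of each, the colours in between agree.
  data Flow (L R : V → V → Bool) : Bool → List Dart → Bool → Set where
    [] : ∀ {a} → Flow L R a [] a
    _∷_ : ∀ {a b u v δs} → R u v ≡ a → Flow L R (L u v) δs b → Flow L R a ((u , v) ∷ δs) b

  module _ {L R : V → V → Bool} where
    Flow-++⁺ : ∀ {a b c xs ys} → Flow L R a xs b → Flow L R b ys c → Flow L R a (xs ++ ys) c
    Flow-++⁺ [] q = q
    Flow-++⁺ (e ∷ p) q = e ∷ Flow-++⁺ p q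

    Flow-++⁻ : ∀ xs {a c ys} → Flow L R a (xs ++ ys) c → ∃ λ b → Flow L R a xs b × Flow L R b ys c
    Flow-++⁻ [] p = _ , [] , p
    Flow-++⁻ (_ ∷ xs) (e ∷ p) with Flow-++⁻ xs p
    ... | _ , q , r = _ , e ∷ q , r

    Flow-constant : ∀ {a b} xs → (∀ {u v} → (u , v) ∈ xs → L u v ≡ R u v) → Flow L R a xs b →
      a ≡ b × (∀ {u v} → (u , v) ∈ xs → R u v ≡ a)
    Flow-constant [] _ [] = refl , λ ()
    Flow-constant (_ ∷ xs) c (e ∷ p) with Flow-constant xs (c ∘ there) p
    ... | q , r = trans (trans (sym e) (sym (c (here refl)))) q
                , λ { (here refl) → e ; (there s) → trans (r s) (trans (c (here refl)) e) }

    -- A dart with equal colours on its two sides can be skipped: the corners before and after it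
    -- merge into one.
    Flow-filter : ∀ {P : V → Set} (P? : ∀ v → Dec (P v)) {u a b} xs → (∀ {v} → v ∈ xs → ¬ P v → L u v ≡ R u v) →
      Flow L R a (map (u ,_) xs) b → Flow L R a (map (u ,_) (filter P? xs)) b
    Flow-filter P? [] c p = p
    Flow-filter P? (x ∷ xs) c (e ∷ p) with P? x
    ... | yes _ = e ∷ Flow-filter P? xs (c ∘ there) p
    ... | no ¬p = subst (λ a → Flow L R a _ _) (trans (c (here refl) ¬p) e) (Flow-filter P? xs (c ∘ there) p)

  -- Combinatorial planarity: every closed walk bounds mod 2, that is, the
  -- corners of the rotation system can be two-coloured so that the colour
  -- changes exactly across the edges used an odd number of times.
  record Rotation : Set where
    field
      rot : V → List V
      rot-unique : ∀ u → Unique (rot u)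
      rot⁺ : ∀ {u v} → u ~ v → v ∈ rot u
      rot⁻ : ∀ {u v} → v ∈ rot u → u ~ v

    record Colouring {a} (w : Walk a a) : Set where
      field
        L R : V → V → Bool
        cross : ∀ {u v} → u ~ v → L u v ≡ R u v xor parity w u v
        flip : ∀ {u v} → u ~ v → R u v ≡ L v u
        turn : ∀ u → ∃ λ b → Flow L R b (map (u ,_) (rot u)) b

    Bounding : Set
    Bounding = ∀ {a} (w : Walk a a) → Colouring w

  heads : List Dart → List V
  heads = map proj₂

  -- No two edges interleave along the list. Decomposing the list makes the four positions distinct
  -- and ordered without any indices.
  NonCrossing : List V → Set
  NonCrossing F = ∀ P {a} Q {b} R {c} S {d} T → F ≡ P ++ a ∷ Q ++ b ∷ R ++ c ∷ S ++ d ∷ T → a ~ c → b ~ d → ⊥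

  -- Start from the first vertex and, as long as the current vertex has a
  -- chord to the right, pass to its right neighbour: no chord then leaves the
  -- current interval.
  module _ {F : List V} (nc : NonCrossing F) where
    chordless-from : ∀ m P x S₁ S₂ → length S₁ ℕ.≤ m → F ≡ P ++ x ∷ S₁ ++ S₂ →
      (∀ {y} → y ∈ F → y ~ x → IsLast y P ⊎ y ∈ S₁) →
      ∃ λ P' → ∃ λ x' → ∃ λ S' → F ≡ P' ++ x' ∷ S' × (∀ {y} → y ∈ F → y ~ x' → IsLast y P' ⊎ IsHead y S')
    chordless-from m P x [] S₂ _ e near = P , x , S₂ , e , λ q r → either inj₁ (λ ()) (near q r)
    chordless-from (suc m) P x (y ∷ S₁) S₂ (s≤s len) e near with Any.any? (λ z → adj x z Bool.≟ true) S₁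
      where open Graph G using (adj)
    ... | no none = P , x , y ∷ S₁ ++ S₂ , e , λ q r → case near q r of λ
      { (inj₁ l) → inj₁ l
      ; (inj₂ (here refl)) → inj₂ (S₁ ++ S₂ , refl)
      ; (inj₂ (there s)) → contradiction (Any.map (λ { refl → ~-sym r }) s) none }
    ... | yes some with find some
    ... | c , c∈ , x~c with ∈-∃++ c∈
    ... | U , W , refl = chordless-from m (P ++ [ x ]) y (U ++ [ c ]) (W ++ S₂) len' e' near'
      where
        len' : length (U ++ [ c ]) ℕ.≤ m
        len' = ℕ.≤-trans (ℕ.≤-trans (ℕ.≤-reflexive (trans (List.length-++ U) (ℕ.+-comm _ 1)))
                 (ℕ.≤-trans (s≤s (ℕ.m≤m+n (length U) (length W))) (ℕ.≤-reflexive (trans (sym (ℕ.+-suc (length U) (length W))) (sym (List.length-++ U)))))) len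
        e₀ : F ≡ P ++ x ∷ y ∷ U ++ c ∷ W ++ S₂
        e₀ = trans e (cong (λ z → P ++ x ∷ y ∷ z) (List.++-assoc U (c ∷ W) S₂))
        e' : F ≡ (P ++ [ x ]) ++ y ∷ (U ++ [ c ]) ++ W ++ S₂
        e' = trans e₀ (trans (cong (λ z → P ++ x ∷ y ∷ z) (sym (List.++-assoc U [ c ] (W ++ S₂)))) (sym (List.++-assoc P [ x ] _)))
        near' : ∀ {z} → z ∈ F → z ~ y → IsLast z (P ++ [ x ]) ⊎ z ∈ U ++ [ c ]
        near' {z} z∈ z~y with ∈-++⁻ P (subst (z ∈_) e₀ z∈)
        ... | inj₂ (here refl) = inj₁ (P , refl)
        ... | inj₂ (there (here refl)) = ⊥-elim (~-irrefl z~y)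
        ... | inj₁ z∈P with ∈-∃++ z∈P
        -- A neighbour of `y` before `x` would make the chords zy and xc interleave in the order z,
        -- x, y, c. A neighbour beyond `c`, treated below, gives the order x, y, c, z.
        ... | P₁ , P₂ , refl = ⊥-elim (nc P₁ P₂ [] U (W ++ S₂) (trans e₀ (List.++-assoc P₁ (z ∷ P₂) _)) z~y x~c)
        near' {z} z∈ z~y | inj₂ (there (there q)) with ∈-++⁻ U q
        ... | inj₁ z∈U = inj₂ (∈-++⁺ˡ z∈U)
        ... | inj₂ (here refl) = inj₂ (∈-++⁺ʳ U (here refl))
        ... | inj₂ (there r) with ∈-∃++ r
        ... | W₁ , W₂ , eq = ⊥-elim (nc P [] U W₁ W₂
            (trans e₀ (cong (λ t → P ++ x ∷ y ∷ U ++ c ∷ t) eq)) x~c (~-sym z~y))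

  chordless : ∀ {F} → NonCrossing F → ∀ {x S} → F ≡ x ∷ S →
    ∃ λ P' → ∃ λ x' → ∃ λ S' → F ≡ P' ++ x' ∷ S' × (∀ {y} → y ∈ F → y ~ x' → IsLast y P' ⊎ IsHead y S')
  chordless nc {x} {S} refl = chordless-from nc (length S) [] x S [] ℕ.≤-refl (cong (x ∷_) (sym (List.++-identityʳ S)))
    λ { (here refl) r → ⊥-elim (~-irrefl r) ; (there q) _ → inj₂ q }

  -- Removal of the vertices along a contour

  module Construction (ρ : Rotation) (bounding : Rotation.Bounding ρ) where
    open Rotation ρ

    -- S consists of the vertices not yet removed, and Φ lists, in the order met
    -- around the removed vertices, one dart to each vertex of S next to them.
    -- Colourings count only for closed walks that avoid the other edges at
    -- removed vertices, except for the Tree joining these.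
    record State (S : List V) (Φ : List Dart) : Set₁ where
      field
        root : V
        Φ-unique : Unique (heads Φ)
        head∈ : ∀ {u v} → (u , v) ∈ Φ → v ∈ S
        tail∉ : ∀ {u v} → (u , v) ∈ Φ → u ∉ S
        dart : ∀ {u v} → (u , v) ∈ Φ → u ~ v
        complete : ∀ {u v} → u ∉ S → v ∈ S → u ~ v → v ∈ heads Φ
        Tree : V → V → Set
        tree-tail : ∀ {u v} → Tree u v → u ∉ S
        tree-dart : ∀ {u v} → Tree u v → v ∈ S → (u , v) ∈ Φ
        dart-tree : ∀ {u v} → (u , v) ∈ Φ → Tree u v
        path : ∀ {u v} → (u , v) ∈ Φ → Σ (Walk root u) (AllSteps λ x y → x ∉ S × y ∉ S × (Tree x y ⊎ Tree y x))

      Legal : V → V → Set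
      Legal x y = (x ∈ S × y ∈ S) ⊎ Tree x y ⊎ Tree y x

      field
        flow : ∀ {a} (w : Walk a a) → AllSteps Legal w → let open Colouring (bounding w) in ∃ λ b → ∃ λ c → Flow L R b Φ c

    -- The closed walk through a and c separates b from d around the removed
    -- vertices, while the edge bd does not meet it.
    module _ {S Φ} (st : State S Φ) where
      open State st

      crossing-absurd : ∀ P {ta a} Q {tb b} R' {tc c} U {td d} T →
        Φ ≡ P ++ (ta , a) ∷ Q ++ (tb , b) ∷ R' ++ (tc , c) ∷ U ++ (td , d) ∷ T → a ~ c → b ~ d → ⊥
      crossing-absurd P {ta} {a} Q {tb} {b} R' {tc} {c} U {td} {d} T refl a~c b~d = no-fixpoint (trans (cong not (sym Lb)) (trans through (trans Rd (sym βb≡βd))))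
        where
          da = ∈-++⁺ʳ P (here refl)
          inQ : ∀ {δ} → δ ∈ Q ++ (tb , b) ∷ R' ++ (tc , c) ∷ U ++ (td , d) ∷ T → δ ∈ Φ
          inQ p = ∈-++⁺ʳ P (there p)
          db = inQ (∈-++⁺ʳ Q (here refl))
          inR : ∀ {δ} → δ ∈ R' ++ (tc , c) ∷ U ++ (td , d) ∷ T → δ ∈ Φ
          inR p = inQ (∈-++⁺ʳ Q (there p))
          dc = inR (∈-++⁺ʳ R' (here refl))
          inU : ∀ {δ} → δ ∈ U ++ (td , d) ∷ T → δ ∈ Φ
          inU p = inR (∈-++⁺ʳ R' (there p))
          dd = inU (∈-++⁺ʳ U (here refl))

          head∈map : ∀ {u v xs} → (u , v) ∈ xs → v ∈ heads xs
          head∈map = ∈-map⁺ proj₂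

          uniqA = Unique-middle (heads P) (subst Unique (List.map-++ proj₂ P _) Φ-unique)
          a∉ : ∀ {u v} → (u , v) ∈ Q ++ (tb , b) ∷ R' ++ (tc , c) ∷ U ++ (td , d) ∷ T → v ≢ a
          a∉ p refl = proj₂ uniqA (head∈map p)
          uniqC = Unique-middle (heads P ++ a ∷ heads Q ++ b ∷ heads R') (subst Unique eq Φ-unique)
            where
              open ≡-Reasoning
              eq : heads Φ ≡ (heads P ++ a ∷ heads Q ++ b ∷ heads R') ++ c ∷ heads (U ++ (td , d) ∷ T)
              eq = begin
                heads Φ ≡⟨ List.map-++ proj₂ P _ ⟩
                heads P ++ a ∷ heads (Q ++ (tb , b) ∷ R' ++ (tc , c) ∷ U ++ (td , d) ∷ T)
                  ≡⟨ cong (λ z → heads P ++ a ∷ z) (List.map-++ proj₂ Q _) ⟩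
                heads P ++ a ∷ heads Q ++ b ∷ heads (R' ++ (tc , c) ∷ U ++ (td , d) ∷ T)
                  ≡⟨ cong (λ z → heads P ++ a ∷ heads Q ++ b ∷ z) (List.map-++ proj₂ R' _) ⟩
                heads P ++ a ∷ heads Q ++ b ∷ heads R' ++ c ∷ heads (U ++ (td , d) ∷ T)
                  ≡⟨ cong (λ z → heads P ++ a ∷ z) (sym (List.++-assoc (heads Q) (b ∷ heads R') _)) ⟩
                heads P ++ a ∷ (heads Q ++ b ∷ heads R') ++ c ∷ heads (U ++ (td , d) ∷ T)
                  ≡⟨ sym (List.++-assoc (heads P) _ _) ⟩
                (heads P ++ a ∷ heads Q ++ b ∷ heads R') ++ c ∷ heads (U ++ (td , d) ∷ T) ∎
          beforeC : ∀ {v} → v ∈ b ∷ heads R' → v ≢ c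
          beforeC p refl = proj₁ uniqC (∈-++⁺ʳ (heads P) (there (∈-++⁺ʳ (heads Q) p)))
          afterC : ∀ {u v} → (u , v) ∈ U ++ (td , d) ∷ T → v ≢ c
          afterC p refl = proj₂ uniqC (head∈map p)

          a≢c = λ (e : a ≡ c) → a∉ (∈-++⁺ʳ Q (there (∈-++⁺ʳ R' (here refl)))) (sym e)

          pa = proj₁ (path da)
          pc = proj₁ (path dc)
          last : Walk a root
          last = step a~c (step (~-sym (dart dc)) (reverse pc))
          ω : Walk root root
          ω = pa ⁀ step (dart da) last

          Inner : V → V → Set
          Inner x y = x ∉ S × y ∉ S × (Tree x y ⊎ Tree y x)
          swap-inner : ∀ {x y} → Inner x y → Inner y x
          swap-inner (p , q , t) = q , p , either inj₂ inj₁ t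
          pc' : AllSteps Inner (reverse pc)
          pc' = AllSteps-reverse swap-inner pc (proj₂ (path dc))

          legal : AllSteps Legal ω
          legal = AllSteps-⁀ pa (AllSteps-map (λ _ → inj₂ ∘ proj₂ ∘ proj₂) pa (proj₂ (path da)))
            (inj₂ (inj₁ (dart-tree da)) , inj₁ (head∈ da , head∈ dc) , inj₂ (inj₂ (dart-tree dc))
            , AllSteps-map (λ _ → inj₂ ∘ proj₂ ∘ proj₂) (reverse pc) pc')

          unused-inner : ∀ {u v} → u ∈ S ⊎ v ∈ S → ∀ {x y} → x ~ y → Inner x y → ¬ SameEdge x y u v
          unused-inner (inj₁ p) _ (q , _) (inj₁ (refl , refl)) = q p
          unused-inner (inj₁ p) _ (_ , q , _) (inj₂ (refl , refl)) = q p
          unused-inner (inj₂ p) _ (_ , q , _) (inj₁ (refl , refl)) = q p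
          unused-inner (inj₂ p) _ (q , _) (inj₂ (refl , refl)) = q p

          away : ∀ {u v} → u ∈ S ⊎ v ∈ S → ¬ SameEdge ta a u v → ¬ SameEdge a c u v → ¬ SameEdge c tc u v → parity ω u v ≡ false
          away m p q r = parity-unused ω (AllSteps-⁀ pa (AllSteps-map (unused-inner m) pa (proj₂ (path da)))
            (p , q , r , AllSteps-map (unused-inner m) (reverse pc) pc'))

          dart-away : ∀ {u v} → (u , v) ∈ Φ → v ≢ a → v ≢ c → parity ω u v ≡ false
          dart-away m v≢a v≢c = away (inj₂ (head∈ m))
            (λ { (inj₁ (_ , refl)) → v≢a refl ; (inj₂ (refl , _)) → tail∉ da (head∈ m) })
            (λ { (inj₁ (refl , _)) → tail∉ m (head∈ da) ; (inj₂ (refl , _)) → v≢a refl })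
            (λ { (inj₁ (refl , _)) → tail∉ m (head∈ dc) ; (inj₂ (refl , _)) → v≢c refl })

          vertex-away : ∀ {u v} → u ∈ S → u ≢ a → u ≢ c → parity ω u v ≡ false
          vertex-away m u≢a u≢c = away (inj₁ m)
            (λ { (inj₁ (refl , _)) → tail∉ da m ; (inj₂ (_ , refl)) → u≢a refl })
            (λ { (inj₁ (refl , _)) → u≢a refl ; (inj₂ (_ , refl)) → u≢c refl })
            (λ { (inj₁ (refl , _)) → u≢c refl ; (inj₂ (_ , refl)) → tail∉ dc m })

          c-used : parity ω tc c ≡ true
          c-used = begin
            parity ω tc c
              ≡⟨ parity-⁀ pa ⟩
            parity pa tc c xor parity (step (dart da) last) tc c
              ≡⟨ cong₂ _xor_ (parity-unused pa (AllSteps-map (unused-inner (inj₂ (head∈ dc))) pa (proj₂ (path da))))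
                   (cong₂ _xor_ (dec-false (sameEdge? ta a tc c) λ { (inj₁ (_ , e)) → a≢c e ; (inj₂ (refl , _)) → tail∉ da (head∈ dc) })
                   (cong₂ _xor_ (dec-false (sameEdge? a c tc c) λ { (inj₁ (refl , _)) → tail∉ dc (head∈ da) ; (inj₂ (e , _)) → a≢c e })
                   (cong₂ _xor_ (dec-true (sameEdge? c tc tc c) (inj₂ (refl , refl)))
                     (parity-unused (reverse pc) (AllSteps-map (unused-inner (inj₂ (head∈ dc))) (reverse pc) pc'))))) ⟩
            true ∎
            where open ≡-Reasoning

          open Colouring (bounding ω)

          same : ∀ {u v} → u ~ v → parity ω u v ≡ false → L u v ≡ R u v
          same e p = trans (cross e) (trans (cong (R _ _ xor_) p) (xor-identityʳ _))

          -- The walk uses no edge at `u`, so no dart at `u` separates two colours and all corners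
          -- there share one.
          at : ∀ {u} → u ∈ S → u ≢ a → u ≢ c → ∃ λ β → ∀ {v} → u ~ v → R u v ≡ β × L u v ≡ β
          at {u} m u≢a u≢c with turn u
          ... | β , fl with Flow-constant _ (λ p → case ∈-map⁻ _ p of λ { (v , v∈ , refl) → same (rot⁻ v∈) (vertex-away m u≢a u≢c) }) fl
          ... | _ , con = β , λ e → let r = con (∈-map⁺ _ (rot⁺ e)) in r , trans (same e (vertex-away m u≢a u≢c)) r

          atb = at (head∈ db) (a∉ (∈-++⁺ʳ Q (here refl))) (beforeC (here refl))
          atd = at (head∈ dd) (a∉ (∈-++⁺ʳ Q (there (∈-++⁺ʳ R' (there (∈-++⁺ʳ U (here refl))))))) (afterC (∈-++⁺ʳ U (here refl)))

          βb≡βd : proj₁ atb ≡ proj₁ atd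
          βb≡βd = trans (sym (proj₂ (proj₂ atb b~d))) (trans (sym (flip (~-sym b~d))) (proj₁ (proj₂ atd (~-sym b~d))))

          Lb : L tb b ≡ proj₁ atb
          Lb = trans (sym (flip (~-sym (dart db)))) (proj₁ (proj₂ atb (~-sym (dart db))))

          Rd : R td d ≡ proj₁ atd
          Rd = trans (flip (dart dd)) (proj₂ (proj₂ atd (~-sym (dart dd))))

          sameR : ∀ {u v} → (u , v) ∈ R' → L u v ≡ R u v
          sameR p = same (dart (inR (∈-++⁺ˡ p))) (dart-away (inR (∈-++⁺ˡ p)) (a∉ (∈-++⁺ʳ Q (there (∈-++⁺ˡ p)))) (beforeC (there (head∈map p))))

          sameU : ∀ {u v} → (u , v) ∈ U → L u v ≡ R u v
          sameU p = same (dart (inU (∈-++⁺ˡ p))) (dart-away (inU (∈-++⁺ˡ p)) (a∉ (∈-++⁺ʳ Q (there (∈-++⁺ʳ R' (there (∈-++⁺ˡ p)))))) (afterC (∈-++⁺ˡ p)))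

          -- Reading the contour from `b` to `d`, the colour flips exactly once, at the dart to `c`.
          -- The dart to `a`, which the walk also uses, comes before `b`.
          through : not (L tb b) ≡ R td d
          through with flow ω legal
          ... | _ , _ , f with Flow-++⁻ P f
          ... | _ , _ , (_ ∷ f₁) with Flow-++⁻ Q f₁
          ... | _ , _ , (_ ∷ f₂) with Flow-++⁻ R' f₂
          ... | _ , fR , (ec ∷ f₃) with Flow-++⁻ U f₃
          ... | _ , fU , (ed ∷ _) = begin
            not (L tb b)            ≡⟨ cong not (proj₁ (Flow-constant R' sameR fR)) ⟩
            not _                   ≡⟨ cong not (sym ec) ⟩
            not (R tc c)            ≡⟨ sym (trans (cross (dart dc)) (trans (cong (R tc c xor_) c-used) (xor-comm _ true))) ⟩
            L tc c                  ≡⟨ proj₁ (Flow-constant U sameU fU) ⟩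
            _                       ≡⟨ sym ed ⟩
            R td d                  ∎
            where
              open ≡-Reasoning

          no-fixpoint : ∀ {β} → not β ≡ β → ⊥
          no-fixpoint {true} ()
          no-fixpoint {false} ()

      nonCrossing : NonCrossing (heads Φ)
      nonCrossing P {a} Q {b} R' {c} U {d} T e a~c b~d with map-++⁻ proj₂ Φ {P} e
      ... | P₁ , r₁ , refl , _ , e₁ with map-∷⁻ proj₂ r₁ e₁
      ... | _ , r₂ , refl , refl , e₂ with map-++⁻ proj₂ r₂ {Q} e₂
      ... | Q₁ , r₃ , refl , _ , e₃ with map-∷⁻ proj₂ r₃ e₃
      ... | _ , r₄ , refl , refl , e₄ with map-++⁻ proj₂ r₄ {R'} e₄
      ... | R₁ , r₅ , refl , _ , e₅ with map-∷⁻ proj₂ r₅ e₅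
      ... | _ , r₆ , refl , refl , e₆ with map-++⁻ proj₂ r₆ {U} e₆
      ... | U₁ , r₇ , refl , _ , e₇ with map-∷⁻ proj₂ r₇ e₇
      ... | _ , T₁ , refl , refl , _ = crossing-absurd P₁ Q₁ R₁ U₁ T₁ refl a~c b~d

    -- With an empty contour, `complete` says that no edge joins the removed vertices to `S`, so
    -- root and tree can be chosen afresh. The cyclic order at `x` is cut open where its list
    -- happens to begin; `turn` makes the colours at the two ends of the cut agree.
    rootState : ∀ {S} x → x ∈ S → State S [] → State (remove x S) (map (x ,_) (rot x))
    rootState {S} x x∈S st = record
      { root = x
      ; Φ-unique = subst Unique (sym heads-rot) (rot-unique x)
      ; head∈ = λ p → let (_ , e) = fromRot p in ∈-remove⁺ (nbr∈ e) (λ { refl → ~-irrefl e })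
      ; tail∉ = λ p → λ q → proj₂ (∈-remove⁻ {xs = S} q) (proj₁ (fromRot p))
      ; dart = λ p → dart' p
      ; complete = complete'
      ; Tree = λ u v → u ≡ x × u ~ v
      ; tree-tail = λ { (refl , _) q → proj₂ (∈-remove⁻ {xs = S} q) refl }
      ; tree-dart = λ { (refl , e) _ → ∈-map⁺ _ (rot⁺ e) }
      ; dart-tree = λ p → proj₁ (fromRot p) , dart' p
      ; path = λ p → case proj₁ (fromRot p) of λ { refl → [] , tt }
      ; flow = λ w _ → let (b , f) = Colouring.turn (bounding w) x in b , b , f }
      where
        open State st using (complete)
        heads-rot : heads (map (x ,_) (rot x)) ≡ rot x
        heads-rot = trans (sym (List.map-∘ (rot x))) (List.map-id (rot x))
        fromRot : ∀ {u v} → (u , v) ∈ map (x ,_) (rot x) → u ≡ x × x ~ v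
        fromRot p with ∈-map⁻ _ p
        ... | _ , q , refl = refl , rot⁻ q
        dart' : ∀ {u v} → (u , v) ∈ map (x ,_) (rot x) → u ~ v
        dart' p with fromRot p
        ... | refl , e = e
        nbr∈ : ∀ {v} → x ~ v → v ∈ S
        nbr∈ {v} e with v ∈? S
        ... | yes p = p
        ... | no q with () ← complete q x∈S (~-sym e)
        complete' : ∀ {u v} → u ∉ remove x S → v ∈ remove x S → u ~ v → v ∈ heads (map (x ,_) (rot x))
        complete' {u} {v} u∉ v∈ e with u Fin.≟ x
        ... | yes refl = subst (v ∈_) (sym heads-rot) (rot⁺ e)
        ... | no u≢x with () ← complete (λ u∈ → u∉ (∈-remove⁺ u∈ u≢x)) (proj₁ (∈-remove⁻ {xs = S} v∈)) e

    -- The dart `(t , x)` gives way to the darts at `x`, read in rotation order starting just after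
    -- the one back to `t`. Those leading to removed vertices or to vertices already on the contour
    -- are skipped, which keeps the heads unique.
    module RemoveHead {S} {Φ₁ Φ₂ : List Dart} {t x : V} (st : State S (Φ₁ ++ (t , x) ∷ Φ₂)) where
      open State st

      private
        Φ = Φ₁ ++ (t , x) ∷ Φ₂
        S' = remove x S
        tx∈ : (t , x) ∈ Φ
        tx∈ = ∈-++⁺ʳ Φ₁ (here refl)
        x∈S = head∈ tx∈
        t∉S = tail∉ tx∈
        t~x = dart tx∈
        rot-split = ∈-∃++ (rot⁺ (~-sym t~x))
        before = proj₁ rot-split
        after = proj₁ (proj₂ rot-split)
        rot-eq : rot x ≡ before ++ t ∷ after
        rot-eq = proj₂ (proj₂ rot-split)
        others = heads (Φ₁ ++ Φ₂)
        Keep : V → Set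
        Keep y = y ∈ S' × y ∉ others
        keep? : ∀ y → Dec (Keep y)
        keep? y = (y ∈? S') ×-dec ¬? (y ∈? others)

      new : List V
      new = filter keep? (after ++ before)

      Φ' : List Dart
      Φ' = Φ₁ ++ map (x ,_) new ++ Φ₂

      heads-Φ' : heads Φ' ≡ heads Φ₁ ++ new ++ heads Φ₂
      heads-Φ' = trans (List.map-++ proj₂ Φ₁ _) (cong (heads Φ₁ ++_) (trans (List.map-++ proj₂ (map (x ,_) new) Φ₂)
        (cong (_++ heads Φ₂) (trans (sym (List.map-∘ new)) (List.map-id new)))))

      private
        in-rot : ∀ {v} → v ∈ after ++ before → v ∈ rot x
        in-rot p with ∈-++⁻ after p
        ... | inj₁ q = subst (_ ∈_) (sym rot-eq) (∈-++⁺ʳ before (there q))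
        ... | inj₂ q = subst (_ ∈_) (sym rot-eq) (∈-++⁺ˡ q)

        from-rot : ∀ {v} → v ∈ rot x → v ≢ t → v ∈ after ++ before
        from-rot p ne with ∈-++⁻ before (subst (_ ∈_) rot-eq p)
        ... | inj₁ q = ∈-++⁺ʳ after q
        ... | inj₂ (here e) = contradiction e ne
        ... | inj₂ (there q) = ∈-++⁺ˡ q

        unique-cycle : Unique (after ++ before)
        unique-cycle with Unique-++⁻ before (subst Unique rot-eq (rot-unique x))
        ... | p , (_ ∷ q) , r = Unique.++⁺ q p λ (s , s') → r s' (there s)

        heads-split : heads Φ ≡ heads Φ₁ ++ x ∷ heads Φ₂
        heads-split = List.map-++ proj₂ Φ₁ _
        unique-split : Unique (heads Φ₁ ++ x ∷ heads Φ₂)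
        unique-split = subst Unique heads-split Φ-unique
        others-split : others ≡ heads Φ₁ ++ heads Φ₂
        others-split = List.map-++ proj₂ Φ₁ Φ₂

        new⁻ : ∀ {v} → v ∈ new → x ~ v × Keep v
        new⁻ p with ∈-filter⁻ keep? {xs = after ++ before} p
        ... | q , k = rot⁻ (in-rot q) , k

        Φ'⁻ : ∀ {u v} → (u , v) ∈ Φ' → ((u , v) ∈ Φ₁ ++ Φ₂) ⊎ (u ≡ x × v ∈ new)
        Φ'⁻ p with ∈-++⁻ Φ₁ p
        ... | inj₁ q = inj₁ (∈-++⁺ˡ q)
        ... | inj₂ q with ∈-++⁻ (map (x ,_) new) q
        ... | inj₂ r = inj₁ (∈-++⁺ʳ Φ₁ r)
        ... | inj₁ r with ∈-map⁻ _ r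
        ... | _ , s , refl = inj₂ (refl , s)

        weaken : ∀ {A : Set} (xs : List A) {y ys δ} → δ ∈ xs ++ ys → δ ∈ xs ++ y ∷ ys
        weaken xs p = either ∈-++⁺ˡ (∈-++⁺ʳ xs ∘ there) (∈-++⁻ xs p)

        strengthen : ∀ {A : Set} (xs : List A) {y ys δ} → δ ∈ xs ++ y ∷ ys → δ ≢ y → δ ∈ xs ++ ys
        strengthen xs p ne with ∈-++⁻ xs p
        ... | inj₁ q = ∈-++⁺ˡ q
        ... | inj₂ (here e) = contradiction e ne
        ... | inj₂ (there q) = ∈-++⁺ʳ xs q

        old-in-Φ' : ∀ {δ} → δ ∈ Φ₁ ++ Φ₂ → δ ∈ Φ'
        old-in-Φ' p = either ∈-++⁺ˡ (∈-++⁺ʳ Φ₁ ∘ ∈-++⁺ʳ (map (x ,_) new)) (∈-++⁻ Φ₁ p)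

        new-in-Φ' : ∀ {v} → v ∈ new → (x , v) ∈ Φ'
        new-in-Φ' p = ∈-++⁺ʳ Φ₁ (∈-++⁺ˡ (∈-map⁺ _ p))

        old-head≢x : ∀ {u v} → (u , v) ∈ Φ₁ ++ Φ₂ → v ≢ x
        old-head≢x p refl with ∈-++⁻ Φ₁ p | Unique-middle (heads Φ₁) unique-split
        ... | inj₁ q | ne , _ = ne (∈-map⁺ proj₂ q)
        ... | inj₂ q | _ , ne = ne (∈-map⁺ proj₂ q)

        S'⊆ : ∀ {v} → v ∈ S' → v ∈ S
        S'⊆ p = proj₁ (∈-remove⁻ {xs = S} p)

        x∉S' : x ∉ S'
        x∉S' p = proj₂ (∈-remove⁻ {xs = S} p) refl

        head-in : ∀ {u v} → (u , v) ∈ Φ₁ ++ Φ₂ → v ∈ S'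
        head-in p = ∈-remove⁺ (head∈ (weaken Φ₁ p)) (old-head≢x p)

        only-t : ∀ {u} → (u , x) ∈ Φ → u ≡ t
        only-t p with ∈-++⁻ Φ₁ p
        ... | inj₁ q = ⊥-elim (old-head≢x (∈-++⁺ˡ q) refl)
        ... | inj₂ (here refl) = refl
        ... | inj₂ (there q) = ⊥-elim (old-head≢x (∈-++⁺ʳ Φ₁ q) refl)

        Tree' : V → V → Set
        Tree' u v = Tree u v ⊎ (u ≡ x × v ∈ new)

        Legal' : V → V → Set
        Legal' u v = (u ∈ S' × v ∈ S') ⊎ Tree' u v ⊎ Tree' v u

        -- Every newly added tree edge joins two vertices of the old `S`, where all edges were
        -- allowed.
        legal-old : ∀ {u v} → Legal' u v → Legal u v
        legal-old (inj₁ (p , q)) = inj₁ (S'⊆ p , S'⊆ q)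
        legal-old (inj₂ (inj₁ (inj₁ p))) = inj₂ (inj₁ p)
        legal-old (inj₂ (inj₂ (inj₁ p))) = inj₂ (inj₂ p)
        legal-old (inj₂ (inj₁ (inj₂ (refl , p)))) = inj₁ (x∈S , S'⊆ (proj₁ (proj₂ (new⁻ p))))
        legal-old (inj₂ (inj₂ (inj₂ (refl , p)))) = inj₁ (S'⊆ (proj₁ (proj₂ (new⁻ p))) , x∈S)

        -- Since `x` has left the remaining set, only tree edges at `x` are legal. The only older
        -- one comes from `t`, because `x` occurs once among the heads, and the others lead to
        -- `new`.
        dropped-illegal : ∀ {v} → v ∈ after ++ before → ¬ Keep v → ¬ Legal' x v
        dropped-illegal q k (inj₁ (p , _)) = x∉S' p
        dropped-illegal q k (inj₂ (inj₁ (inj₁ p))) = tree-tail p x∈S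
        dropped-illegal q k (inj₂ (inj₁ (inj₂ (_ , p)))) = k (proj₂ (new⁻ p))
        dropped-illegal q k (inj₂ (inj₂ (inj₂ (refl , p)))) = ~-irrefl (rot⁻ (in-rot q))
        dropped-illegal q k (inj₂ (inj₂ (inj₁ p))) with only-t (tree-dart p x∈S)
        ... | refl with ∈-++⁻ after q | Unique-middle before (subst Unique rot-eq (rot-unique x))
        ... | inj₁ r | _ , ne = ne r
        ... | inj₂ r | ne , _ = ne r

        legal-sym : ∀ {u v} → Legal' u v → Legal' v u
        legal-sym (inj₁ (p , q)) = inj₁ (q , p)
        legal-sym (inj₂ (inj₁ p)) = inj₂ (inj₂ p)
        legal-sym (inj₂ (inj₂ p)) = inj₂ (inj₁ p)

        -- The turn around `x` leads from one side of the edge xt to the other. By `flip` its two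
        -- end colours are those on the sides of the dart `(t , x)`, so the turn fits exactly where
        -- that dart stood. Legal walks do not use the skipped darts, and hence the colours agree
        -- across them.
        flow' : ∀ {a} (w : Walk a a) → AllSteps Legal' w → let open Colouring (bounding w) in ∃ λ b → ∃ λ c → Flow L R b Φ' c
        flow' w legal with flow w (AllSteps-map (λ _ → legal-old) w legal)
        ... | b , c , f with Flow-++⁻ Φ₁ f | Colouring.turn (bounding w) x
        ... | _ , f₁ , (e ∷ f₂) | β , r
            with Flow-++⁻ (map (x ,_) before) (subst (λ z → Flow _ _ β z β) (trans (cong (map (x ,_)) rot-eq) (List.map-++ _ before _)) r)
        ... | _ , r₁ , (e' ∷ r₂) = b , c , Flow-++⁺ f₁ (Flow-++⁺ kept f₂)
          where
            open Colouring (bounding w)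
            around : Flow L R (L x t) (map (x ,_) (after ++ before)) (R x t)
            around = subst₂ (Flow L R (L x t)) (sym (List.map-++ _ after before)) (sym e') (Flow-++⁺ r₂ r₁)
            unused : ∀ {v} → v ∈ after ++ before → ¬ Keep v → L x v ≡ R x v
            unused {v} q k = trans (cross (rot⁻ (in-rot q))) (trans (cong (R x v xor_)
              (parity-unused w (AllSteps-map (λ _ l → λ { (inj₁ (refl , refl)) → dropped-illegal q k l
                                                        ; (inj₂ (refl , refl)) → dropped-illegal q k (legal-sym l) }) w legal)))
              (xor-identityʳ _))
            kept : Flow L R _ (map (x ,_) new) (L t x)
            kept = subst₂ (λ a b → Flow L R a (map (x ,_) new) b) (trans (sym (flip t~x)) e) (flip (~-sym t~x))
              (Flow-filter keep? (after ++ before) unused around)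

      removeHead : State S' Φ'
      removeHead = record
        { root = root
        ; Φ-unique = subst Unique (sym heads-Φ') unique'
        ; head∈ = λ p → either head-in (λ (_ , q) → proj₁ (proj₂ (new⁻ q))) (Φ'⁻ p)
        ; tail∉ = λ p → tail∉' (Φ'⁻ p)
        ; dart = λ p → dart' (Φ'⁻ p)
        ; complete = complete'
        ; Tree = Tree'
        ; tree-tail = λ { (inj₁ p) q → tree-tail p (S'⊆ q) ; (inj₂ (refl , _)) q → x∉S' q }
        ; tree-dart = λ { (inj₁ p) q → old-in-Φ' (strengthen Φ₁ (tree-dart p (S'⊆ q)) λ { refl → x∉S' q })
                        ; (inj₂ (refl , p)) _ → new-in-Φ' p }
        ; dart-tree = λ p → either (inj₁ ∘ dart-tree ∘ weaken Φ₁) inj₂ (Φ'⁻ p)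
        ; path = λ p → path' (Φ'⁻ p)
        ; flow = flow' }
        where
          unique' : Unique (heads Φ₁ ++ new ++ heads Φ₂)
          unique' with Unique-++⁻ (heads Φ₁) (Unique-drop (heads Φ₁) unique-split)
          ... | p , q , r = Unique.++⁺ p (Unique.++⁺ (Unique.filter⁺ keep? unique-cycle) q
                (λ (s , s') → fresh s (∈-++⁺ʳ (heads Φ₁) s')))
                (λ (s , s') → either (λ s'' → fresh s'' (∈-++⁺ˡ s)) (r s) (∈-++⁻ new s'))
            where
              fresh : ∀ {v} → v ∈ new → v ∉ heads Φ₁ ++ heads Φ₂
              fresh p q = proj₂ (proj₂ (new⁻ p)) (subst (_ ∈_) (sym others-split) q)
          tail∉' : ∀ {u v} → ((u , v) ∈ Φ₁ ++ Φ₂) ⊎ (u ≡ x × v ∈ new) → u ∉ S'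
          tail∉' (inj₁ p) q = tail∉ (weaken Φ₁ p) (S'⊆ q)
          tail∉' (inj₂ (refl , _)) = x∉S'
          dart' : ∀ {u v} → ((u , v) ∈ Φ₁ ++ Φ₂) ⊎ (u ≡ x × v ∈ new) → u ~ v
          dart' (inj₁ p) = dart (weaken Φ₁ p)
          dart' (inj₂ (refl , p)) = proj₁ (new⁻ p)
          path' : ∀ {u v} → ((u , v) ∈ Φ₁ ++ Φ₂) ⊎ (u ≡ x × v ∈ new) →
            Σ (Walk root u) (AllSteps λ x y → x ∉ S' × y ∉ S' × (Tree' x y ⊎ Tree' y x))
          path' (inj₁ p) with path (weaken Φ₁ p)
          ... | w , a = w , AllSteps-map (λ _ (p , q , r) → p ∘ S'⊆ , q ∘ S'⊆ , either (inj₁ ∘ inj₁) (inj₂ ∘ inj₁) r) w a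
          path' (inj₂ (refl , _)) with path tx∈
          ... | w , a = w ⁀ step t~x [] , AllSteps-⁀ w
            (AllSteps-map (λ _ (p , q , r) → p ∘ S'⊆ , q ∘ S'⊆ , either (inj₁ ∘ inj₁) (inj₂ ∘ inj₁) r) w a)
            ((t∉S ∘ S'⊆ , x∉S' , inj₁ (inj₁ (dart-tree tx∈))) , tt)
          complete' : ∀ {u v} → u ∉ S' → v ∈ S' → u ~ v → v ∈ heads Φ'
          complete' {u} {v} u∉ v∈ e with v ∈? others
          ... | yes p with ∈-map⁻ proj₂ p
          ... | _ , q , refl = ∈-map⁺ proj₂ (old-in-Φ' q)
          complete' {u} {v} u∉ v∈ e | no p with u Fin.≟ x
          ... | yes refl = ∈-map⁺ proj₂ (new-in-Φ' (∈-filter⁺ keep? (from-rot (rot⁺ e) (λ { refl → t∉S (S'⊆ v∈) })) (v∈ , p)))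
          ... | no u≢x with ∈-map⁻ proj₂ (complete (λ q → u∉ (∈-remove⁺ q u≢x)) (S'⊆ v∈) e)
          ... | _ , q , refl = ⊥-elim (p (∈-map⁺ proj₂ (strengthen Φ₁ q λ { refl → x∉S' v∈ })))

      neighbours : ∀ {u} → u ∈ S → u ~ x → u ∈ heads Φ ⊎ u ∈ new
      neighbours {u} u∈ e with u ∈? heads Φ
      ... | yes p = inj₁ p
      ... | no p = inj₂ (∈-filter⁺ keep? (from-rot (rot⁺ (~-sym e)) (λ { refl → t∉S u∈ }))
          (∈-remove⁺ u∈ (λ { refl → ~-irrefl e }) , λ q → p (subst (u ∈_) (sym heads-split) (weaken (heads Φ₁) (subst (u ∈_) others-split q)))))

    layout-from : ∀ m {S Φ} → length S ℕ.≤ m → State S Φ → Layout S (heads Φ)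
    layout-nonempty : ∀ m {S Φ y ys} → length S ℕ.≤ suc m → State S Φ → heads Φ ≡ y ∷ ys → Layout S (heads Φ)
    layout-from m {[]} {[]} _ _ = emptyLayout λ ()
    layout-from m {[]} {_ ∷ _} _ st with () ← State.head∈ st (here refl)
    -- A component is finished and `x` becomes the root of the next one. As `x` has no removed
    -- neighbour, no edge leaves it upwards and it need not stay in the frontier.
    layout-from (suc m) {S@(x ∷ _)} {[]} len st = forgetFrontier (AddTop.addTop x (here refl) [] (rot x) []
      (subst (Layout (remove x S)) eq (layout-from m smaller (rootState x (here refl) st))) (λ _ e → inj₂ (inj₁ (rot⁺ (~-sym e)))))
      where
        smaller = ℕ.≤-pred (ℕ.≤-trans (length-remove {x} {S} (here refl)) len)
        eq : heads (map (x ,_) (rot x)) ≡ rot x ++ []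
        eq = trans (sym (List.map-∘ (rot x))) (trans (List.map-id (rot x)) (sym (List.++-identityʳ (rot x))))
    layout-from (suc m) {_ ∷ _} {_ ∷ _} len st = layout-nonempty m len st refl
    layout-nonempty m {S} {Φ} len st nonempty with chordless (nonCrossing st) nonempty
    ... | P , x , Q , e , near with map-++⁻ proj₂ Φ {P} e
    ... | Φ₁ , rest , refl , refl , e₁ with map-∷⁻ proj₂ rest e₁
    ... | (t , x) , Φ₂ , refl , refl , refl = subst (Layout S) (sym e)
      (AddTop.addTop x x∈S (heads Φ₁) new (heads Φ₂)
        (subst (Layout (remove x S)) heads-Φ' (layout-from m smaller removeHead))
        -- A remaining neighbour of `x` on the contour is next to `x` there, by the choice of `x`;
        -- one off the contour belongs to `new`.
        (λ u∈ u~x → either (λ p → either inj₁ (inj₂ ∘ inj₂) (near p u~x)) (inj₂ ∘ inj₁) (neighbours u∈ u~x)))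
      where
        open RemoveHead {S} {Φ₁} {Φ₂} st
        x∈S = State.head∈ st (∈-++⁺ʳ Φ₁ (here refl))
        smaller = ℕ.≤-pred (ℕ.≤-trans (length-remove x∈S) len)

    initialState : V → State (allFin n) []
    initialState x = record
      { root = x ; Φ-unique = [] ; head∈ = λ () ; tail∉ = λ () ; dart = λ ()
      ; complete = λ u∉ → ⊥-elim (u∉ (∈-allFin _))
      ; Tree = λ _ _ → ⊥ ; tree-tail = λ () ; tree-dart = λ () ; dart-tree = λ () ; path = λ ()
      ; flow = λ _ _ → true , true , [] }

    layout : Layout (allFin n) []
    layout with allFin n in eq
    ... | [] = emptyLayout λ ()
    ... | xs@(x ∷ _) = subst (λ S → Layout S []) eq (layout-from (length (allFin n)) ℕ.≤-refl (initialState x))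

-- Edges with one bend

module Elbows (ℝ : RealField) where
  open OrderedField ℝ
  open Geometry ℝ
  open Incidence ℝ

  convex-≤ : ∀ {a b c t} → 0# ≤ t → t ≤ 1# → a ≤ c → b ≤ c → a + t * (b - a) ≤ c
  convex-≤ {a} {b} {c} {t} t≥0 t≤1 p q = 0≤-by (0≤+ (0≤* (≤⇒0≤ t≤1) (≤⇒0≤ p)) (0≤* t≥0 (≤⇒0≤ q)))
    (solve 4 (λ a b c t → c :- (a :+ t :* (b :- a)) := (:1 :- t) :* (c :- a) :+ t :* (c :- b)) refl a b c t)

  convex-≥ : ∀ {a b c t} → 0# ≤ t → t ≤ 1# → c ≤ a → c ≤ b → c ≤ (a + t * (b - a))
  convex-≥ {a} {b} {c} {t} t≥0 t≤1 p q = 0≤-by (0≤+ (0≤* (≤⇒0≤ t≤1) (≤⇒0≤ p)) (0≤* t≥0 (≤⇒0≤ q)))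
    (solve 4 (λ a b c t → (a :+ t :* (b :- a)) :- c := (:1 :- t) :* (a :- c) :+ t :* (b :- c)) refl a b c t)

  convex-> : ∀ {a b c t} → 0# ≤ t → t ≤ 1# → c < a → c < b → c < a + t * (b - a)
  convex-> {a} {b} {c} {t} t≥0 t≤1 p q with compare a b
  ... | tri< a<b _ _ = <-≤-trans p (convex-≥ t≥0 t≤1 ≤-refl (inj₁ a<b))
  ... | tri≈ _ refl _ = <-≤-trans p (convex-≥ t≥0 t≤1 ≤-refl ≤-refl)
  ... | tri> _ _ b<a = <-≤-trans q (convex-≥ t≥0 t≤1 (inj₁ b<a) ≤-refl)

  two four : Carrier
  two = 1# + 1#
  four = 1# + 1# + 1# + 1#

  :2 :4 : ∀ {n} → Polynomial n
  :2 = :1 :+ :1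
  :4 = :1 :+ :1 :+ :1 :+ :1

  0<two : 0# < two
  0<two = 0<+ 0<1 0<1

  0<four : 0# < four
  0<four = 0<+ (0<+ 0<two 0<1) 0<1

  lines-meet : ∀ {a b s h} → 0# < 1# - s * h → a ≡ s * b → b ≡ h * a → a ≡ 0# × b ≡ 0#
  lines-meet {a} {b} {s} {h} p e e' = a≡0 , trans e' (trans (cong (h *_) a≡0) (zeroʳ h))
    where
      eq : a * (1# - s * h) ≡ 0#
      eq = trans (solve 3 (λ a s h → a :* (:1 :- s :* h) := a :- s :* (h :* a)) refl a s h)
        (≡⇒-≡0 (trans e (cong (s *_) e')))
      a≡0 : a ≡ 0#
      a≡0 = *-cancel eq (λ z → <-irr (subst (0# <_) z p))

  -- A bend near (xu , yv), with slightly tilted sides.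
  record Elbow (xu yu xv yv s h : Carrier) : Set where
    field
      bx by : Carrier
      steep : bx - xu ≡ s * (by - yu)
      flat : by - yv ≡ h * (bx - xv)
      xu≤bx : xu ≤ bx
      bx≤xu+1 : bx ≤ (xu + 1#)
      yv-1≤by : (yv - 1#) ≤ by
      by≤yv+1 : by ≤ (yv + 1#)

    point : Point
    point = bx , by

  -- `W` bounds all distances that occur, so a line of slope `s` deviates by at most 1 over the
  -- whole drawing.
  record Small (W s : Carrier) : Set where
    field
      nonneg : 0# ≤ s
      bound : (s * W) ≤ 1#

  -- The margin of two pays for the displacement of a bend: distances measured from the bend are
  -- still at most `W`.
  Within : Carrier → Carrier → Set
  Within W a = ((two - W) ≤ a) × (a ≤ (W - two))

  module _ {W s : Carrier} (W≥2 : two ≤ W) (σ : Small W s) where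
    open Small σ

    small-*≤ : ∀ {a} → a ≤ W → (s * a) ≤ 1#
    small-*≤ {a} p = 0≤-by (0≤+ (≤⇒0≤ bound) (0≤* nonneg (≤⇒0≤ p)))
      (solve 3 (λ s a W → :1 :- s :* a := (:1 :- s :* W) :+ s :* (W :- a)) refl s a W)

    small-*≥ : ∀ {a} → (- W) ≤ a → (- 1#) ≤ (s * a)
    small-*≥ {a} p = 0≤-by (0≤+ (≤⇒0≤ bound) (0≤* nonneg (≤⇒0≤ p)))
      (solve 3 (λ s a W → s :* a :- (:- :1) := (:1 :- s :* W) :+ s :* (a :- (:- W))) refl s a W)

    small-half : (s * two) ≤ 1#
    small-half = small-*≤ W≥2

  module _ {W s h : Carrier} (W≥2 : two ≤ W) (σ : Small W s) (χ : Small W h) where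
    private
      module s = Small σ
      module h = Small χ

    -- As `W` is at least 2, both slopes are at most one half. The case of slope zero is separate
    -- because `s` itself is the strictly positive summand of the certificate.
    small-product : 0# < 1# - s * h
    small-product with s.nonneg
    ... | inj₂ refl = subst (0# <_) (solve 1 (λ h → :1 := :1 :- :0 :* h) refl h) 0<1
    ... | inj₁ 0<s = subst (0# <_)
      (solve 2 (λ s h → s :+ ((:1 :- s :* :2) :+ s :* ((:1 :- h :* :2) :+ h)) := :1 :- s :* h) refl s h)
      (0<+≤ 0<s (0≤+ (≤⇒0≤ (small-half W≥2 σ)) (0≤* s.nonneg (0≤+ (≤⇒0≤ (small-half W≥2 χ)) h.nonneg))))

    -- The height τ of the bend over (xu , yu) solves τ (1 - s h) = Δy + h Δx.
    elbow : ∀ {xu yu xv yv} → Within W (xu - xv) → Within W (yv - yu) → (yu + four) ≤ yv → Elbow xu yu xv yv s h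
    elbow {xu} {yu} {xv} {yv} (x≥ , x≤) (_ , y≤) y≥ = record
      { bx = bx ; by = by
      ; steep = solve 4 (λ x y s τ → x :+ s :* τ :- x := s :* (y :+ τ :- y)) refl xu yu s τ
      ; flat = flat
      ; xu≤bx = 0≤-by (0≤* s.nonneg (inj₁ 0<τ)) (solve 3 (λ x s τ → x :+ s :* τ :- x := s :* τ) refl xu s τ)
      ; bx≤xu+1 = 0≤-by (≤⇒0≤ sτ≤1) (solve 3 (λ x s τ → x :+ :1 :- (x :+ s :* τ) := :1 :- s :* τ) refl xu s τ)
      ; yv-1≤by = 0≤-by (≤⇒0≤ (small-*≥ W≥2 χ -W≤dx))
          (trans (solve 2 (λ y b → b :- (y :- :1) := (b :- y) :- (:- :1)) refl yv by) (cong (_- (- 1#)) flat))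
      ; by≤yv+1 = 0≤-by (≤⇒0≤ (small-*≤ W≥2 χ dx≤W))
          (trans (solve 2 (λ y b → (y :+ :1) :- b := :1 :- (b :- y)) refl yv by) (cong (λ z → 1# - z) flat)) }
      where
        inverse' = inv⁺ small-product
        k = proj₁ inverse'
        num = (yv - yu) + h * (xu - xv)
        τ = num * k
        bx = xu + s * τ
        by = yu + τ
        τ-eq : τ * (1# - s * h) ≡ num
        τ-eq = trans (solve 3 (λ n k d → n :* k :* d := n :* (d :* k)) refl num k (1# - s * h))
          (trans (cong (num *_) (proj₂ (proj₂ inverse'))) (*-identityʳ num))
        flat : by - yv ≡ h * (bx - xv)
        flat = trans (solve 7 (λ xu yu xv yv s h τ → yu :+ τ :- yv
                  := (τ :* (:1 :- s :* h) :- ((yv :- yu) :+ h :* (xu :- xv))) :+ h :* (xu :+ s :* τ :- xv)) refl xu yu xv yv s h τ)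
          (trans (cong (_+ h * (bx - xv)) (≡⇒-≡0 τ-eq)) (+-identityˡ _))
        -W≤ : ∀ {a} → (two - W) ≤ a → (- W) ≤ a
        -W≤ {a} p = 0≤-by (0≤+ (≤⇒0≤ p) (inj₁ 0<two)) (solve 2 (λ a W → a :- (:- W) := (a :- (:2 :- W)) :+ :2) refl a W)
        ≤W : ∀ {a} → a ≤ (W - two) → a ≤ W
        ≤W {a} p = 0≤-by (0≤+ (≤⇒0≤ p) (inj₁ 0<two)) (solve 2 (λ a W → W :- a := ((W :- :2) :- a) :+ :2) refl a W)
        0<num : 0# < num
        0<num = subst (0# <_)
          (solve 3 (λ yu yv m → (yv :- (yu :+ :4)) :+ ((m :- (:- :1)) :+ (:2 :+ :1)) := (yv :- yu) :+ m) refl yu yv (h * (xu - xv)))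
          (subst (0# <_) (+-comm _ _) (0<+≤ (subst (0# <_) (+-comm _ _) (0<+≤ (0<+ 0<two 0<1) (≤⇒0≤ (small-*≥ W≥2 χ (-W≤ x≥))))) (≤⇒0≤ y≥)))
        0<τ : 0# < τ
        0<τ = *-pos 0<num (proj₁ (proj₂ inverse'))
        s≤1 : 0# ≤ (1# - s)
        s≤1 = subst (0# ≤_) (solve 1 (λ s → (:1 :- s :* :2) :+ s := :1 :- s) refl s) (0≤+ (≤⇒0≤ (small-half W≥2 σ)) s.nonneg)
        -- The bound on τ, before division by `1# - s * h`. The margin of two splits into one unit
        -- for the flat tilt `h * (xu - xv)` and one for `s * h * W`, which is at most `s`.
        gap : 0# ≤ (W * (1# - s * h) - num)
        gap = subst (0# ≤_)
          (solve 5 (λ W s h dx dy → ((W :- :2) :- dy) :+ ((:1 :- h :* dx) :+ ((:1 :- s) :+ s :* (:1 :- h :* W)))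
             := W :* (:1 :- s :* h) :- (dy :+ h :* dx)) refl W s h (xu - xv) (yv - yu))
          (0≤+ (≤⇒0≤ y≤) (0≤+ (≤⇒0≤ (small-*≤ W≥2 χ (≤W x≤))) (0≤+ s≤1 (0≤* s.nonneg (≤⇒0≤ h.bound)))))
        τ≤W : τ ≤ W
        τ≤W = 0≤-by (0≤* gap (inj₁ (proj₁ (proj₂ inverse'))))
          (trans (sym (*-identityʳ (W - τ)))
          (trans (cong ((W - τ) *_) (sym (proj₂ (proj₂ inverse'))))
          (trans (solve 4 (λ W n k d → (W :- n :* k) :* (d :* k) := (W :* d :- n :* k :* d) :* k) refl W num k (1# - s * h))
            (cong (λ z → (W * (1# - s * h) - z) * k) τ-eq))))
        sτ≤1 : (s * τ) ≤ 1#
        sτ≤1 = small-*≤ W≥2 σ τ≤W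
        dx≤W : (bx - xv) ≤ W
        dx≤W = 0≤-by (0≤+ (≤⇒0≤ x≤) (0≤+ (≤⇒0≤ sτ≤1) (inj₁ 0<1)))
          (solve 4 (λ W xu xv m → W :- (xu :+ m :- xv) := ((W :- :2) :- (xu :- xv)) :+ ((:1 :- m) :+ :1)) refl W xu xv (s * τ))
        -W≤dx : (- W) ≤ (bx - xv)
        -W≤dx = 0≤-by (0≤+ (≤⇒0≤ x≥) (0≤+ (0≤* s.nonneg (inj₁ 0<τ)) (inj₁ 0<two)))
          (solve 4 (λ W xu xv m → (xu :+ m :- xv) :- (:- W) := ((xu :- xv) :- (:2 :- W)) :+ (m :+ :2)) refl W xu xv (s * τ))

  module Segments {W xu yu xv yv s h} (W≥2 : two ≤ W) (σ : Small W s) (χ : Small W h) (far : (yu + four) ≤ yv)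
    (E : Elbow xu yu xv yv s h) where
    open Elbow E
    private
      module s = Small σ
      module h = Small χ

    0<by-yu : 0# < by - yu
    0<by-yu = subst (0# <_)
      (solve 3 (λ y v b → (:2 :+ :1) :+ ((b :- (v :- :1)) :+ (v :- (y :+ :4))) := b :- y) refl yu yv by)
      (0<+≤ (0<+ 0<two 0<1) (0≤+ (≤⇒0≤ yv-1≤by) (≤⇒0≤ far)))

    steep-line : ∀ {zx zy} → OnSeg (xu , yu) point (zx , zy) → zx - xu ≡ s * (zy - yu)
    steep-line (t , _ , _ , refl , refl) =
      trans (solve 3 (λ x t d → x :+ t :* d :- x := t :* d) refl xu t (bx - xu))
      (trans (cong (t *_) steep) (solve 4 (λ y t s d → t :* (s :* d) := s :* (y :+ t :* d :- y)) refl yu t s (by - yu)))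

    steep-y≥ : ∀ {zx zy} → OnSeg (xu , yu) point (zx , zy) → yu ≤ zy
    steep-y≥ (t , t≥0 , t≤1 , refl , refl) = convex-≥ t≥0 t≤1 ≤-refl (inj₁ (0<⇒< 0<by-yu))

    steep-y≤ : ∀ {zx zy} → OnSeg (xu , yu) point (zx , zy) → zy ≤ (yv + 1#)
    steep-y≤ (t , t≥0 , t≤1 , refl , refl) = ≤-trans (convex-≤ t≥0 t≤1 (inj₁ (0<⇒< 0<by-yu)) ≤-refl) by≤yv+1

    steep-x≥ : ∀ {zx zy} → OnSeg (xu , yu) point (zx , zy) → xu ≤ zx
    steep-x≥ (t , t≥0 , t≤1 , refl , refl) = convex-≥ t≥0 t≤1 ≤-refl xu≤bx

    steep-x≤ : ∀ {zx zy} → OnSeg (xu , yu) point (zx , zy) → zx ≤ (xu + 1#)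
    steep-x≤ (t , t≥0 , t≤1 , refl , refl) = convex-≤ t≥0 t≤1 (inj₁ (0<-by 0<1 (solve 1 (λ x → x :+ :1 :- x := :1) refl xu))) bx≤xu+1

    flat-line : ∀ {zx zy} → OnSeg (xv , yv) point (zx , zy) → zy - yv ≡ h * (zx - xv)
    flat-line (t , _ , _ , refl , refl) =
      trans (solve 3 (λ y t d → y :+ t :* d :- y := t :* d) refl yv t (by - yv))
      (trans (cong (t *_) flat) (solve 4 (λ x t h d → t :* (h :* d) := h :* (x :+ t :* d :- x)) refl xv t h (bx - xv)))

    flat-y≥ : ∀ {zx zy} → OnSeg (xv , yv) point (zx , zy) → (yv - 1#) ≤ zy
    flat-y≥ (t , t≥0 , t≤1 , refl , refl) = convex-≥ t≥0 t≤1 (inj₁ (0<-by 0<1 (solve 1 (λ y → y :- (y :- :1) := :1) refl yv))) yv-1≤by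

    flat-y≤ : ∀ {zx zy} → OnSeg (xv , yv) point (zx , zy) → zy ≤ (yv + 1#)
    flat-y≤ (t , t≥0 , t≤1 , refl , refl) = convex-≤ t≥0 t≤1 (inj₁ (0<-by 0<1 (solve 1 (λ y → y :+ :1 :- y := :1) refl yv))) by≤yv+1

    meet : ∀ {z} → OnSeg (xu , yu) point z → OnSeg (xv , yv) point z → z ≡ point
    meet {zx , zy} p q = cong₂ _,_ (-≡0⇒≡ (proj₁ zero-zero)) (-≡0⇒≡ (proj₂ zero-zero))
      where
        shift : ∀ s {z b x w c y} → z - x ≡ s * (w - y) → b - x ≡ s * (c - y) → z - b ≡ s * (w - c)
        shift s {z} {b} {x} {w} {c} {y} e e' = trans (solve 3 (λ z x b → z :- b := (z :- x) :- (b :- x)) refl z x b)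
          (trans (cong₂ _-_ e e') (solve 4 (λ s w c y → s :* (w :- y) :- s :* (c :- y) := s :* (w :- c)) refl s w c y))
        zero-zero : zx - bx ≡ 0# × zy - by ≡ 0#
        zero-zero = lines-meet (small-product W≥2 σ χ) (shift s (steep-line p) steep) (shift h (flat-line q) flat)

    0<yv-yu : 0# < yv - yu
    0<yv-yu = subst (0# <_) (solve 2 (λ u v → :4 :+ (v :- (u :+ :4)) := v :- u) refl yu yv) (0<+≤ 0<four (≤⇒0≤ far))

    -- The deviation from the steep line is affine along the flat segment and vanishes at the bend,
    -- where t is 1. What is left is `1# - t` times its value at the upper end.
    flat-side-eq : ∀ t → s * (yv + t * (by - yv) - yu) - (xv + t * (bx - xv) - xu) ≡ (1# - t) * (s * (yv - yu) + (xu - xv))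
    flat-side-eq t = trans
      (solve 8 (λ xu yu xv yv bx by s t → s :* (yv :+ t :* (by :- yv) :- yu) :- (xv :+ t :* (bx :- xv) :- xu)
        := (:1 :- t) :* (s :* (yv :- yu) :+ (xu :- xv)) :- t :* ((bx :- xu) :- s :* (by :- yu))) refl xu yu xv yv bx by s t)
      (trans (cong (λ z → (1# - t) * (s * (yv - yu) + (xu - xv)) - t * z) (≡⇒-≡0 steep))
        (solve 2 (λ t m → m :- t :* :0 := m) refl t _))

    steep-side-eq : ∀ g t → g * (xu + t * (bx - xu) - xv) - (yu + t * (by - yu) - yv) ≡
      (g * (xu - xv) - (yu - yv)) + t * ((g * (bx - xv) - (by - yv)) - (g * (xu - xv) - (yu - yv)))
    steep-side-eq g t = solve 8 (λ xu yu xv yv bx by g t → g :* (xu :+ t :* (bx :- xu) :- xv) :- (yu :+ t :* (by :- yu) :- yv)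
        := (g :* (xu :- xv) :- (yu :- yv)) :+ t :* ((g :* (bx :- xv) :- (by :- yv)) :- (g :* (xu :- xv) :- (yu :- yv))))
        refl xu yu xv yv bx by g t

    steep-end-eq : ∀ g → (g - h) * (bx - xv) ≡ g * (bx - xv) - (by - yv)
    steep-end-eq g = trans (solve 3 (λ g h m → (g :- h) :* m := g :* m :- h :* m) refl g h (bx - xv)) (cong (λ z → g * (bx - xv) - z) (sym flat))

    -- The case in which the lower end lies to the right of the upper end; `Left` is the opposite
    -- one.
    module Right (right : (xv + four) ≤ xu) where
      xv≤bx : xv ≤ bx
      xv≤bx = ≤-trans (0≤-by (0≤+ (≤⇒0≤ right) (inj₁ 0<four)) (solve 2 (λ u v → u :- v := (u :- (v :+ :4)) :+ :4) refl xu xv)) xu≤bx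

      flat-x≥ : ∀ {zx zy} → OnSeg (xv , yv) point (zx , zy) → xv ≤ zx
      flat-x≥ (t , t≥0 , t≤1 , refl , refl) = convex-≥ t≥0 t≤1 ≤-refl xv≤bx

      flat-x≤ : ∀ {zx zy} → OnSeg (xv , yv) point (zx , zy) → zx ≤ (xu + 1#)
      flat-x≤ (t , t≥0 , t≤1 , refl , refl) = ≤-trans (convex-≤ t≥0 t≤1 xv≤bx ≤-refl) bx≤xu+1

      0<xu-xv : 0# < xu - xv
      0<xu-xv = subst (0# <_) (solve 2 (λ u v → :4 :+ (u :- (v :+ :4)) := u :- v) refl xu xv) (0<+≤ 0<four (≤⇒0≤ right))

      0<bx-xv : 0# < bx - xv
      0<bx-xv = subst (0# <_) (solve 3 (λ u v b → (u :- v) :+ (b :- u) := b :- v) refl xu xv bx) (0<+≤ 0<xu-xv (≤⇒0≤ xu≤bx))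

      flat-side : ∀ {zx zy} → OnSeg (xv , yv) point (zx , zy) → zx - xu ≤ s * (zy - yu)
      flat-side (t , t≥0 , t≤1 , refl , refl) = 0≤-by
        (0≤* (≤⇒0≤ t≤1) (0≤+ (0≤* s.nonneg (inj₁ 0<yv-yu)) (inj₁ 0<xu-xv))) (flat-side-eq t)

      -- The depth below the line of slope `g` through the upper end is affine along the steep
      -- segment, so its two ends suffice. The lower end is far below, and the bend lies on the line
      -- of the smaller slope `h`, on the side where that line is lower.
      steep-side : ∀ {g} → 0# ≤ g → h < g → ∀ {zx zy} → OnSeg (xu , yu) point (zx , zy) → zy - yv < g * (zx - xv)
      steep-side {g} g≥0 h<g (t , t≥0 , t≤1 , refl , refl) = 0<-by (convex-> t≥0 t≤1 start end) (steep-side-eq g t)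
        where
          start : 0# < g * (xu - xv) - (yu - yv)
          start = subst (0# <_) (solve 3 (λ m u v → (v :- u) :+ m := m :- (u :- v)) refl (g * (xu - xv)) yu yv)
            (0<+≤ 0<yv-yu (0≤* g≥0 (inj₁ 0<xu-xv)))
          end : 0# < g * (bx - xv) - (by - yv)
          end = subst (0# <_) (steep-end-eq g) (*-pos (<⇒0< h<g) 0<bx-xv)

    module Left (left : (xu + four) ≤ xv) where
      bx≤xv : bx ≤ xv
      bx≤xv = ≤-trans bx≤xu+1 (0≤-by (0≤+ (≤⇒0≤ left) (inj₁ (0<+ 0<two 0<1))) (solve 2 (λ u v → v :- (u :+ :1) := (v :- (u :+ :4)) :+ (:2 :+ :1)) refl xu xv))

      flat-x≤ : ∀ {zx zy} → OnSeg (xv , yv) point (zx , zy) → zx ≤ xv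
      flat-x≤ (t , t≥0 , t≤1 , refl , refl) = convex-≤ t≥0 t≤1 ≤-refl bx≤xv

      flat-x≥ : ∀ {zx zy} → OnSeg (xv , yv) point (zx , zy) → xu ≤ zx
      flat-x≥ (t , t≥0 , t≤1 , refl , refl) = convex-≥ t≥0 t≤1 (≤-trans xu≤bx bx≤xv) xu≤bx

      0<xv-bx : 0# < xv - bx
      0<xv-bx = subst (0# <_)
        (solve 3 (λ u v b → (:2 :+ :1) :+ (((u :+ :1) :- b) :+ (v :- (u :+ :4))) := v :- b) refl xu xv bx)
        (0<+≤ (0<+ 0<two 0<1) (0≤+ (≤⇒0≤ bx≤xu+1) (≤⇒0≤ left)))

      -- Here the tilt works against the horizontal gap, but it consumes at most 1 over a height of
      -- at most `W`, while the gap is at least 4.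
      flat-side : yv - yu ≤ W → ∀ {zx zy} → OnSeg (xv , yv) point (zx , zy) → s * (zy - yu) ≤ zx - xu
      flat-side tall (t , t≥0 , t≤1 , refl , refl) = 0≤-by
        (0≤* (≤⇒0≤ t≤1) (0≤+ (≤⇒0≤ left) (0≤+ (inj₁ (0<+ 0<two 0<1)) (≤⇒0≤ (small-*≤ W≥2 σ tall)))))
        (trans (solve 2 (λ a b → a :- b := :- (b :- a)) refl _ _) (trans (cong -_ (flat-side-eq t))
          (solve 4 (λ t m u v → :- ((:1 :- t) :* (m :+ (u :- v))) := (:1 :- t) :* ((v :- (u :+ :4)) :+ ((:2 :+ :1) :+ (:1 :- m)))) refl t (s * (yv - yu)) xu xv)))

      -- To the left of the upper end a smaller slope gives the higher line, hence the reversed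
      -- comparison of `g` and `h`. Over the lower end the line has dropped by at most 1, and that
      -- end is at least 4 lower than the upper one.
      steep-side : ∀ {g} → Small W g → xv - xu ≤ W → g < h → ∀ {zx zy} → OnSeg (xu , yu) point (zx , zy) → zy - yv < g * (zx - xv)
      steep-side {g} γ wide g<h (t , t≥0 , t≤1 , refl , refl) = 0<-by (convex-> t≥0 t≤1 start end) (steep-side-eq g t)
        where
          start : 0# < g * (xu - xv) - (yu - yv)
          start = subst (0# <_)
            (solve 5 (λ g a b u v → (:2 :+ :1) :+ ((:1 :- g :* (b :- a)) :+ (v :- (u :+ :4))) := g :* (a :- b) :- (u :- v)) refl g xu xv yu yv)
            (0<+≤ (0<+ 0<two 0<1) (0≤+ (≤⇒0≤ (small-*≤ W≥2 γ wide)) (≤⇒0≤ far)))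
          end : 0# < g * (bx - xv) - (by - yv)
          end = subst (0# <_) (trans (solve 4 (λ g h b v → (h :- g) :* (v :- b) := (g :- h) :* (b :- v)) refl g h bx xv) (steep-end-eq g))
            (*-pos (<⇒0< g<h) 0<xv-bx)

-- Written so that `degree` is by definition a `count`, which lets ranks be compared with degrees
-- directly.
count : ∀ {A : Set} → (A → Bool) → List A → ℕ
count p xs = sum (map (λ x → if p x then 1 else 0) xs)

module _ {A : Set} {p q : A → Bool} (p⇒q : ∀ x → p x ≡ true → q x ≡ true) where
  count-mono : ∀ xs → count p xs ℕ.≤ count q xs
  count-mono [] = z≤n
  count-mono (x ∷ xs) with p x | q x | p⇒q x
  ... | false | false | _ = count-mono xs
  ... | false | true | _ = ℕ.m≤n⇒m≤1+n (count-mono xs)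
  ... | true | true | _ = s≤s (count-mono xs)
  ... | true | false | r with () ← r refl

  count-strict : ∀ {y xs} → y ∈ xs → p y ≡ false → q y ≡ true → count p xs ℕ.< count q xs
  count-strict {y} {_ ∷ xs} (here refl) e e' with p y | q y
  count-strict {y} {_ ∷ xs} (here refl) refl refl | .false | .true = s≤s (count-mono xs)
  count-strict {y} {x ∷ xs} (there m) e e' with p x | q x | p⇒q x
  ... | false | false | _ = count-strict m e e'
  ... | false | true | _ = ℕ.m≤n⇒m≤1+n (count-strict m e e')
  ... | true | true | _ = s≤s (count-strict m e e')
  ... | true | false | r with () ← r refl

∈⇒≤foldr-⊔ : ∀ {A : Set} (f : A → ℕ) {x xs} → x ∈ xs → f x ℕ.≤ foldr ℕ._⊔_ 0 (map f xs)
∈⇒≤foldr-⊔ f {xs = y ∷ xs} (here refl) = ℕ.m≤m⊔n (f y) _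
∈⇒≤foldr-⊔ f {xs = y ∷ xs} (there p) = ℕ.≤-trans (∈⇒≤foldr-⊔ f p) (ℕ.m≤n⊔m (f y) _)

-- The one-bend drawing of a layout

module LDrawing (ℝ : RealField) {n : ℕ} (G : Graph n) (l : Layouts.Layout G (allFin n) []) where
  open OrderedField ℝ
  open Geometry ℝ
  open Incidence ℝ
  open Elbows ℝ
  open Graph G using (adj)
  open Layouts G
  open Layout l using (X; Y; height)

  d : ℕ
  d = maxDegree G

  X-inj : ∀ {u v} → X u ≡ X v → u ≡ v
  X-inj = Layout.X-injective l (∈-allFin _) (∈-allFin _)

  Y-inj : ∀ {u v} → Y u ≡ Y v → u ≡ v
  Y-inj = Layout.Y-injective l (∈-allFin _) (∈-allFin _)

  Y<height : ∀ v → Y v ℕ.< height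
  Y<height v = Layout.Y<height l (∈-allFin v)

  rank : (V → ℕ) → V → V → ℕ
  rank κ u v = count (λ w → adj u w ∧ does (κ w ℕ.<? κ v)) (allFin n)

  private
    ∧-true : ∀ {a b} → a ∧ b ≡ true → a ≡ true × b ≡ true
    ∧-true {true} {true} refl = refl , refl

    does-true : ∀ {P : Set} (p? : Dec P) → does p? ≡ true → P
    does-true (yes p) _ = p

  -- The neighbour `v` is counted in the degree but not in its own rank, so the ranks run from 0 to
  -- d - 1 and d slopes are enough.
  rank<d : ∀ κ {u v} → u ~ v → rank κ u v ℕ.< d
  rank<d κ {u} {v} e = ℕ.<-≤-trans
    (count-strict (λ _ p → proj₁ (∧-true p)) (∈-allFin v) (trans (cong (_∧ _) e) (dec-false (κ v ℕ.<? κ v) (ℕ.<-irrefl refl))) e)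
    (∈⇒≤foldr-⊔ (degree G) (∈-allFin u))

  rank-mono : ∀ κ {u v w} → u ~ v → κ v ℕ.< κ w → rank κ u v ℕ.< rank κ u w
  rank-mono κ {u} {v} {w} e lt = count-strict
    (λ z p → let (a , b) = ∧-true p in cong₂ _∧_ a (dec-true (κ z ℕ.<? κ w) (ℕ.<-trans (does-true (κ z ℕ.<? κ v) b) lt)))
    (∈-allFin v) (trans (cong (_∧ _) e) (dec-false (κ v ℕ.<? κ v) (ℕ.<-irrefl refl)))
    (cong₂ _∧_ e (dec-true (κ v ℕ.<? κ w) lt))

  -- Around u the bends of the upward edges to the left come first, from the
  -- lowest to the highest, then those to the right, from the highest down.
  key : V → V → ℕ
  key u v = if does (X v ℕ.<? X u) then Y v else height ℕ.+ (height ℕ.∸ Y v)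

  key-left : ∀ {u v} → X v ℕ.< X u → key u v ≡ Y v
  key-left {u} {v} p = cong (λ b → if b then Y v else height ℕ.+ (height ℕ.∸ Y v)) (dec-true (X v ℕ.<? X u) p)

  key-right : ∀ {u v} → X u ℕ.< X v → key u v ≡ height ℕ.+ (height ℕ.∸ Y v)
  key-right {u} {v} p = cong (λ b → if b then Y v else height ℕ.+ (height ℕ.∸ Y v)) (dec-false (X v ℕ.<? X u) (ℕ.<-asym p))

  key-left-< : ∀ {u v w} → X v ℕ.< X u → u ≢ w → Y v ℕ.< Y w → key u v ℕ.< key u w
  key-left-< {u} {v} {w} p ne lt with ℕ.<-cmp (X w) (X u)
  ... | tri< q _ _ = subst₂ ℕ._<_ (sym (key-left p)) (sym (key-left q)) lt
  ... | tri≈ _ q _ = contradiction (sym (X-inj q)) ne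
  ... | tri> _ _ q = subst₂ ℕ._<_ (sym (key-left p)) (sym (key-right q)) (ℕ.<-≤-trans (Y<height v) (ℕ.m≤m+n height _))

  key-right-> : ∀ {u v w} → X u ℕ.< X v → u ≢ w → Y v ℕ.< Y w → key u w ℕ.< key u v
  key-right-> {u} {v} {w} p ne lt with ℕ.<-cmp (X w) (X u)
  ... | tri< q _ _ = subst₂ ℕ._<_ (sym (key-left q)) (sym (key-right p)) (ℕ.<-≤-trans (Y<height w) (ℕ.m≤m+n height _))
  ... | tri≈ _ q _ = contradiction (sym (X-inj q)) ne
  ... | tri> _ _ q = subst₂ ℕ._<_ (sym (key-right q)) (sym (key-right p))
          (ℕ.+-monoʳ-< height (ℕ.∸-monoʳ-< lt (ℕ.<⇒≤ (Y<height w))))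

  ι : ℕ → Carrier
  ι zero = 0#
  ι (suc m) = 1# + ι m

  ι≥0 : ∀ m → 0# ≤ ι m
  ι≥0 zero = 0≤0
  ι≥0 (suc m) = inj₁ (0<+≤ 0<1 (ι≥0 m))

  ι-mono : ∀ {i j} → i ℕ.≤ j → ι i ≤ ι j
  ι-mono {j = j} z≤n = ι≥0 j
  ι-mono {suc i} {suc j} (s≤s p) = 0≤-by (≤⇒0≤ (ι-mono p)) (solve 2 (λ a b → (:1 :+ b) :- (:1 :+ a) := b :- a) refl (ι i) (ι j))

  -- A spacing of four leaves room for displacements by 1 towards each other, with two to spare.
  coord : ℕ → Carrier
  coord m = four * ι m

  coord-sep : ∀ {i j} → i ℕ.< j → coord i + four ≤ coord j
  coord-sep {i} {j} p = 0≤-by (0≤* (inj₁ 0<four) (≤⇒0≤ (ι-mono p)))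
    (solve 2 (λ a b → :4 :* b :- (:4 :* a :+ :4) := :4 :* (b :- (:1 :+ a))) refl (ι i) (ι j))

  coord-mono : ∀ {i j} → i ℕ.≤ j → coord i ≤ coord j
  coord-mono {i} {j} p = 0≤-by (0≤* (inj₁ 0<four) (≤⇒0≤ (ι-mono p)))
    (solve 2 (λ a b → :4 :* b :- :4 :* a := :4 :* (b :- a)) refl (ι i) (ι j))

  coord≥0 : ∀ m → 0# ≤ coord m
  coord≥0 m = 0≤* (inj₁ 0<four) (ι≥0 m)

  -- If `j` were smaller than `i`, the two grid lines would be at least 4 apart, yet `a` exceeds the
  -- lower one by at most 1 and falls short of the upper one by at most 1.
  close-≤ : ∀ {i j a} → coord i - 1# ≤ a → a ≤ coord j + 1# → i ℕ.≤ j
  close-≤ {i} {j} {a} p q = ℕ.≮⇒≥ λ lt → absurd-by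
    (0<+≤ 0<two (0≤+ (≤⇒0≤ p) (0≤+ (≤⇒0≤ q) (≤⇒0≤ (coord-sep lt)))))
    (solve 3 (λ a x y → :2 :+ ((a :- (x :- :1)) :+ (((y :+ :1) :- a) :+ (x :- (y :+ :4)))) := :0) refl a (coord i) (coord j))

  below-1 : ∀ {a b} → a ≤ b → a - 1# ≤ b
  below-1 {a} {b} p = 0≤-by (0≤+ (≤⇒0≤ p) (inj₁ 0<1)) (solve 2 (λ a b → b :- (a :- :1) := (b :- a) :+ :1) refl a b)

  above-1 : ∀ {a b} → a ≤ b → a ≤ b + 1#
  above-1 {a} {b} p = 0≤-by (0≤+ (≤⇒0≤ p) (inj₁ 0<1)) (solve 2 (λ a b → (b :+ :1) :- a := (b :- a) :+ :1) refl a b)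

  M : ℕ
  M = foldr ℕ._⊔_ 0 (map X (allFin n)) ℕ.⊔ height

  X≤M : ∀ v → X v ℕ.≤ M
  X≤M v = ℕ.≤-trans (∈⇒≤foldr-⊔ X (∈-allFin v)) (ℕ.m≤m⊔n _ height)

  Y≤M : ∀ v → Y v ℕ.≤ M
  Y≤M v = ℕ.≤-trans (ℕ.<⇒≤ (Y<height v)) (ℕ.m≤n⊔m _ height)

  -- All coordinates lie between 0 and `coord M`; the summand `two` is the margin required by
  -- `Within`.
  W : Carrier
  W = coord M + two

  W≥2 : two ≤ W
  W≥2 = 0≤-by (coord≥0 M) (solve 1 (λ c → c :+ :2 :- :2 := c) refl (coord M))

  within : ∀ {i j} → i ℕ.≤ M → j ℕ.≤ M → Within W (coord i - coord j)
  within {i} {j} p q =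
    0≤-by (0≤+ (coord≥0 i) (≤⇒0≤ (coord-mono q)))
      (solve 3 (λ a b m → (a :- b) :- (:2 :- (m :+ :2)) := a :+ (m :- b)) refl (coord i) (coord j) (coord M)) ,
    0≤-by (0≤+ (coord≥0 j) (≤⇒0≤ (coord-mono p)))
      (solve 3 (λ a b m → ((m :+ :2) :- :2) :- (a :- b) := b :+ (m :- a)) refl (coord i) (coord j) (coord M))

  private
    -- The unit of slope is the inverse of (d + 1) W. Taking d + 1 instead of d keeps the divisor
    -- positive for a graph without edges.
    scale : ∃ λ η → 0# < η × (ι (suc d) * W) * η ≡ 1#
    scale = inv⁺ (*-pos (0<+≤ 0<1 (ι≥0 d)) (<-≤-trans 0<two W≥2))
    η = proj₁ scale
    0<η = proj₁ (proj₂ scale)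

  slope : ℕ → Carrier
  slope i = ι i * η

  slope-small : ∀ {i} → i ℕ.< d → Small W (slope i)
  slope-small {i} p = record
    { nonneg = 0≤* (ι≥0 i) (inj₁ 0<η)
    ; bound = 0≤-by (0≤* (≤⇒0≤ (ι-mono {i} {suc d} (ℕ.m≤n⇒m≤1+n (ℕ.<⇒≤ p)))) (0≤* (≤-trans (inj₁ 0<two) W≥2) (inj₁ 0<η)))
        (trans (cong (_- (slope i * W)) (sym (proj₂ (proj₂ scale))))
          (solve 4 (λ i D W η → D :* W :* η :- i :* η :* W := (D :- i) :* (W :* η)) refl (ι i) (ι (suc d)) W η)) }

  slope-mono : ∀ {i j} → i ℕ.< j → slope i < slope j
  slope-mono {i} {j} p = 0<-by (*-pos (<⇒0< lt) 0<η) (solve 3 (λ a b η → b :* η :- a :* η := (b :- a) :* η) refl (ι i) (ι j) η)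
    where
      lt : ι i < ι j
      lt = <-≤-trans (0<-by 0<1 (solve 1 (λ a → (:1 :+ a) :- a := :1) refl (ι i))) (ι-mono p)

  -- On either side of an upper end, ranking by abscissa makes the horizontal of a farther edge run
  -- above that of a nearer one.
  steepness flatness : V → V → Carrier
  steepness u v = slope (rank (key u) u v)
  flatness u v = slope (rank X v u)

  position : V → Point
  position v = coord (X v) , coord (Y v)

  Bend : V → V → Set
  Bend u v = Elbow (coord (X u)) (coord (Y u)) (coord (X v)) (coord (Y v)) (steepness u v) (flatness u v)

  steep-small : ∀ {u v} → u ~ v → Small W (steepness u v)
  steep-small {u} e = slope-small (rank<d (key u) e)

  flat-small : ∀ {u v} → u ~ v → Small W (flatness u v)
  flat-small e = slope-small (rank<d X (~-sym e))

  abstract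
    bend : ∀ {u v} → u ~ v → Y u ℕ.< Y v → Bend u v
    bend {u} {v} e lt = elbow W≥2 (steep-small e) (flat-small e) (within (X≤M u) (X≤M v)) (within (Y≤M v) (Y≤M u)) (coord-sep lt)

  record Upward : Set where
    field
      {low high} : V
      edge : low ~ high
      up : Y low ℕ.< Y high

    elbow-at : Bend low high
    elbow-at = bend edge up

    corner : Point
    corner = Elbow.point elbow-at

    OnSteep OnFlat : Point → Set
    OnSteep = OnSeg (position low) corner
    OnFlat = OnSeg (position high) corner

    open Segments W≥2 (steep-small edge) (flat-small edge) (coord-sep up) elbow-at public
    open Elbow elbow-at public

    ends≢ : X low ≢ X high
    ends≢ e = ~-irrefl (subst (low ~_) (sym (X-inj e)) edge)

  open Upward

  same-height : ∀ {i j a} → coord i - 1# ≤ a → a ≤ coord i + 1# → coord j - 1# ≤ a → a ≤ coord j + 1# → i ≡ j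
  same-height p q r s = ℕ.≤-antisym (close-≤ p s) (close-≤ r q)

  point-≡ : ∀ {a b c d : Carrier} → a - c ≡ 0# → b - d ≡ 0# → (a , b) ≡ (c , d)
  point-≡ p q = cong₂ _,_ (-≡0⇒≡ p) (-≡0⇒≡ q)

  diverge : ∀ {a b s t} → a ≡ s * b → a ≡ t * b → s < t → b ≡ 0#
  diverge {a} {b} {s} {t} p q lt = *-cancel
    (trans (solve 3 (λ b s t → b :* (t :- s) := t :* b :- s :* b) refl b s t) (≡⇒-≡0 (trans (sym q) p)))
    (λ e → <-irr (subst (0# <_) e (<⇒0< lt)))

  diverge-any : ∀ {κ : V → ℕ} {u v w a b} → (κ v ≡ κ w → v ≡ w) → v ≢ w → u ~ v → u ~ w →
    a ≡ slope (rank κ u v) * b → a ≡ slope (rank κ u w) * b → b ≡ 0#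
  diverge-any {κ} {u} {v} {w} {a} {b} inj ne e e' p q = go (ℕ.<-cmp (κ v) (κ w))
    where
      go : Tri (κ v ℕ.< κ w) (κ v ≡ κ w) (κ w ℕ.< κ v) → b ≡ 0#
      go (tri< lt _ _) = diverge p q (slope-mono (rank-mono κ e lt))
      go (tri≈ _ eq _) = contradiction (inj eq) ne
      go (tri> _ _ lt) = diverge q p (slope-mono (rank-mono κ e' lt))

  key-inj : ∀ {u v w} → u ~ v → u ~ w → key u v ≡ key u w → v ≡ w
  key-inj {u} {v} {w} e e' eq with ℕ.<-cmp (Y v) (Y w)
  ... | tri≈ _ q _ = Y-inj q
  ... | tri< lt _ _ = ⊥-elim (key-≢ e e' lt eq)
    where
      key-≢ : ∀ {v w} → u ~ v → u ~ w → Y v ℕ.< Y w → key u v ≢ key u w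
      key-≢ {v} {w} e e' lt eq with ℕ.<-cmp (X v) (X u)
      ... | tri< p _ _ = ℕ.<⇒≢ (key-left-< p (λ { refl → ~-irrefl e' }) lt) eq
      ... | tri≈ _ p _ = ~-irrefl (subst (u ~_) (X-inj p) e)
      ... | tri> _ _ p = ℕ.<⇒≢ (key-right-> p (λ { refl → ~-irrefl e' }) lt) (sym eq)
  ... | tri> _ _ lt = sym (key-inj-> lt)
    where
      key-inj-> : Y w ℕ.< Y v → w ≡ v
      key-inj-> lt with ℕ.<-cmp (X w) (X u)
      ... | tri< p _ _ = ⊥-elim (ℕ.<⇒≢ (key-left-< p (λ { refl → ~-irrefl e }) lt) (sym eq))
      ... | tri≈ _ p _ = ⊥-elim (~-irrefl (subst (u ~_) (X-inj p) e'))
      ... | tri> _ _ p = ⊥-elim (ℕ.<⇒≢ (key-right-> p (λ { refl → ~-irrefl e }) lt) eq)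

  Ends : Upward → Point → Set
  Ends e z = z ≡ position (low e) ⊎ z ≡ position (high e)

  Differ : Upward → Upward → Set
  Differ e f = ¬ (low e ≡ low f × high e ≡ high f)

  -- A flat segment stays within 1 of the row of its upper end, so two that meet share that end.
  -- From there they follow lines of different slopes.
  flat-flat : ∀ e f → Differ e f → ∀ {z} → OnFlat e z → OnFlat f z → Ends e z
  flat-flat e f ne {zx , zy} p q = inj₂ (point-≡ dx≡0 (trans (flat-line e p) (trans (cong (flatness (low e) (high e) *_) dx≡0) (zeroʳ _))))
    where
      same : high f ≡ high e
      same = sym (Y-inj (same-height (flat-y≥ e p) (flat-y≤ e p) (flat-y≥ f q) (flat-y≤ f q)))
      line : zy - coord (Y (high e)) ≡ flatness (low f) (high e) * (zx - coord (X (high e)))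
      line = subst (λ v → zy - coord (Y v) ≡ flatness (low f) v * (zx - coord (X v))) same (flat-line f q)
      dx≡0 : zx - coord (X (high e)) ≡ 0#
      dx≡0 = diverge-any X-inj (λ eq → ne (eq , sym same)) (~-sym (edge e)) (~-sym (subst (low f ~_) same (edge f))) (flat-line e p) line

  steep-steep : ∀ e f → Differ e f → ∀ {z} → OnSteep e z → OnSteep f z → Ends e z
  steep-steep e f ne {zx , zy} p q = inj₁ (point-≡ (trans (steep-line e p) (trans (cong (steepness (low e) (high e) *_) dy≡0) (zeroʳ _))) dy≡0)
    where
      same : low f ≡ low e
      same = sym (X-inj (same-height (below-1 (steep-x≥ e p)) (steep-x≤ e p) (below-1 (steep-x≥ f q)) (steep-x≤ f q)))
      line : zx - coord (X (low e)) ≡ steepness (low e) (high f) * (zy - coord (Y (low e)))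
      line = subst (λ u → zx - coord (X u) ≡ steepness u (high f) * (zy - coord (Y u))) same (steep-line f q)
      edge' : low e ~ high f
      edge' = subst (_~ high f) same (edge f)
      dy≡0 : zy - coord (Y (low e)) ≡ 0#
      dy≡0 = diverge-any {key (low e)} (key-inj (edge e) edge') (λ eq → ne (sym same , eq)) (edge e) edge' (steep-line e p) line

  span≤ : ∀ {i j} → i ℕ.≤ M → j ℕ.≤ M → coord i - coord j ≤ W
  span≤ {i} {j} p q = 0≤-by (0≤+ (≤⇒0≤ (proj₂ (within p q))) (inj₁ 0<two))
    (solve 2 (λ a w → w :- a := ((w :- :2) :- a) :+ :2) refl (coord i - coord j) W)

  free : ∀ e f → Y (low f) ℕ.< Y (high e) → Y (high e) ℕ.< Y (high f) → ¬ Between (X (low e)) (X (low f)) (X (high e))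
  free e f = Layout.free l (∈-allFin _) (∈-allFin _) (∈-allFin _) (∈-allFin _) (edge e) (edge f) (up e)

  touch : ∀ e f → low f ≡ high e → ∀ {z} → OnFlat e z → OnSteep f z → z ≡ position (high e)
  touch e f same {zx , zy} p q = point-≡ (proj₁ both) (proj₂ both)
    where
      line : zx - coord (X (high e)) ≡ steepness (low f) (high f) * (zy - coord (Y (high e)))
      line = subst (λ v → zx - coord (X v) ≡ steepness (low f) (high f) * (zy - coord (Y v))) same (steep-line f q)
      both : zx - coord (X (high e)) ≡ 0# × zy - coord (Y (high e)) ≡ 0#
      both = lines-meet (small-product W≥2 (steep-small (edge f)) (flat-small (edge e))) line (flat-line e p)

  -- Two edges with the same lower end: the bend of the higher one lies beyond
  -- the steep line of the lower one.
  fan-low : ∀ e f → low f ≡ low e → Y (high e) ℕ.< Y (high f) → ∀ {z} → OnFlat e z → OnSteep f z → ⊥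
  fan-low e f same lt {zx , zy} p q = go (ℕ.<-cmp (X (high e)) (X (low e)))
    where
      u = low e
      edge' : u ~ high f
      edge' = subst (_~ high f) same (edge f)
      u≢ : u ≢ high f
      u≢ eq = ~-irrefl (subst (u ~_) (sym eq) edge')
      dy = zy - coord (Y u)
      line : zx - coord (X u) ≡ steepness u (high f) * dy
      line = subst (λ u → zx - coord (X u) ≡ steepness u (high f) * (zy - coord (Y u))) same (steep-line f q)
      0<dy : 0# < dy
      0<dy = subst (0# <_)
        (solve 3 (λ u v z → (:2 :+ :1) :+ ((z :- (v :- :1)) :+ (v :- (u :+ :4))) := z :- u) refl (coord (Y u)) (coord (Y (high e))) zy)
        (0<+≤ (0<+ 0<two 0<1) (0≤+ (≤⇒0≤ (flat-y≥ e p)) (≤⇒0≤ (coord-sep (up e)))))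
      contra : ∀ {s t} → s < t → t * dy ≤ s * dy → ⊥
      contra {s} {t} s<t le = absurd-by (0<+≤ (*-pos (<⇒0< s<t) 0<dy) (≤⇒0≤ le))
        (solve 3 (λ s t y → (t :- s) :* y :+ (s :* y :- t :* y) := :0) refl s t dy)
      go : Tri (X (high e) ℕ.< X u) (X (high e) ≡ X u) (X u ℕ.< X (high e)) → ⊥
      go (tri< r _ _) = contra (slope-mono (rank-mono (key u) (edge e) (key-left-< r u≢ lt)))
        (subst (_≤ steepness u (high e) * dy) line (Right.flat-side e (coord-sep r) p))
      go (tri≈ _ eq _) = ends≢ e (sym eq)
      go (tri> _ _ r) = contra (slope-mono (rank-mono (key u) edge' (key-right-> r u≢ lt)))
        (subst (steepness u (high e) * dy ≤_) line (Left.flat-side e (coord-sep r) (span≤ (Y≤M (high e)) (Y≤M u)) p))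

  -- Two edges with the same upper end: the nearer bend lies below the flat
  -- line of the farther one.
  fan-high : ∀ e f → high f ≡ high e → Between (X (low e)) (X (low f)) (X (high e)) → ∀ {z} → OnFlat e z → OnSteep f z → ⊥
  fan-high e f same btw {zx , zy} p q = go btw
    where
      v = high e
      edge' : v ~ low f
      edge' = ~-sym (subst (low f ~_) same (edge f))
      line : zy - coord (Y (high f)) ≡ flatness (low e) v * (zx - coord (X (high f)))
      line = subst (λ w → zy - coord (Y w) ≡ flatness (low e) v * (zx - coord (X w))) (sym same) (flat-line e p)
      go : Between (X (low e)) (X (low f)) (X v) → ⊥
      go (inj₂ (v<f , f<e)) = <-irr (subst (_< flatness (low e) v * (zx - coord (X (high f)))) line
        (Right.steep-side f (coord-sep (subst (λ w → X w ℕ.< X (low f)) (sym same) v<f)) (Small.nonneg (flat-small (edge e)))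
          (subst (λ w → flatness (low f) w < flatness (low e) v) (sym same) (slope-mono (rank-mono X edge' f<e))) q))
      go (inj₁ (e<f , f<v)) = <-irr (subst (_< flatness (low e) v * (zx - coord (X (high f)))) line
        (Left.steep-side f (coord-sep (subst (λ w → X (low f) ℕ.< X w) (sym same) f<v)) (flat-small (edge e))
          (span≤ (X≤M (high f)) (X≤M (low f)))
          (subst (λ w → flatness (low e) v < flatness (low f) w) (sym same) (slope-mono (rank-mono X (~-sym (edge e)) e<f))) q))

  -- Rounding to the grid puts `Y v` between the rows of the ends of `f`, and `X u'` between the
  -- columns of the ends of `e`, ends included. The coincidences are settled by `touch`, `fan-low`
  -- and `fan-high`; the strict case is excluded by `free`.
  flat-steep : ∀ e f → Differ e f → ∀ {z} → OnFlat e z → OnSteep f z → Ends e z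
  flat-steep e f ne {z} p q = heights (ℕ.m≤n⇒m<n∨m≡n f≤v) (ℕ.m≤n⇒m<n∨m≡n v≤f)
    where
      u v u' v' : V
      u = low e
      v = high e
      u' = low f
      v' = high f
      f≤v : Y u' ℕ.≤ Y v
      f≤v = close-≤ (below-1 (steep-y≥ f q)) (flat-y≤ e p)
      v≤f : Y v ℕ.≤ Y v'
      v≤f = close-≤ (flat-y≥ e p) (steep-y≤ f q)
      span : (X u ℕ.≤ X u' × X u' ℕ.≤ X v) ⊎ (X v ℕ.≤ X u' × X u' ℕ.≤ X u)
      span = go (ℕ.<-cmp (X v) (X u))
        where
          go : Tri (X v ℕ.< X u) (X v ≡ X u) (X u ℕ.< X v) → (X u ℕ.≤ X u' × X u' ℕ.≤ X v) ⊎ (X v ℕ.≤ X u' × X u' ℕ.≤ X u)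
          go (tri< r _ _) = inj₂ (close-≤ (below-1 (Right.flat-x≥ e (coord-sep r) p)) (steep-x≤ f q)
                                , close-≤ (below-1 (steep-x≥ f q)) (Right.flat-x≤ e (coord-sep r) p))
          go (tri≈ _ eq _) = ⊥-elim (ends≢ e (sym eq))
          go (tri> _ _ r) = inj₁ (close-≤ (below-1 (Left.flat-x≥ e (coord-sep r) p)) (steep-x≤ f q)
                                , close-≤ (below-1 (steep-x≥ f q)) (above-1 (Left.flat-x≤ e (coord-sep r) p)))
      between : X u' ≢ X u → X u' ≢ X v → Between (X u) (X u') (X v)
      between a b = go span
        where
          go : (X u ℕ.≤ X u' × X u' ℕ.≤ X v) ⊎ (X v ℕ.≤ X u' × X u' ℕ.≤ X u) → Between (X u) (X u') (X v)
          go (inj₁ (r , s)) = inj₁ (ℕ.≤∧≢⇒< r (a ∘ sym) , ℕ.≤∧≢⇒< s b)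
          go (inj₂ (r , s)) = inj₂ (ℕ.≤∧≢⇒< r (b ∘ sym) , ℕ.≤∧≢⇒< s a)
      heights : Y u' ℕ.< Y v ⊎ Y u' ≡ Y v → Y v ℕ.< Y v' ⊎ Y v ≡ Y v' → Ends e z
      heights (inj₂ eq) _ = inj₂ (touch e f (Y-inj eq) p q)
      heights (inj₁ lt) r = ⊥-elim (go (X u' ℕ.≟ X u) r)
        where
          b : X u' ≢ X u → Between (X u) (X u') (X v)
          b a = between a (λ eq → ℕ.<⇒≢ lt (cong Y (X-inj eq)))
          go : Dec (X u' ≡ X u) → Y v ℕ.< Y v' ⊎ Y v ≡ Y v' → ⊥
          go (yes eq) (inj₁ lt') = fan-low e f (X-inj eq) lt' p q
          go (yes eq) (inj₂ eq') = ne (sym (X-inj eq) , Y-inj eq')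
          go (no a) (inj₁ lt') = free e f lt lt' (b a)
          go (no a) (inj₂ eq') = fan-high e f (sym (Y-inj eq')) (b a) p q

  coord-injective : ∀ {i j} → coord i ≡ coord j → i ≡ j
  coord-injective {i} {j} e = same-height {i} {j} {coord i} (below-1 ≤-refl) (above-1 ≤-refl) (below-1 (inj₂ (sym e))) (above-1 (inj₂ e))

  -- Edges are stored with the smaller vertex number first, which says nothing about which end is
  -- higher in the layout.
  record Oriented (e : Edge G) : Set where
    field
      upward : Upward
      ends : (src G e ≡ low upward × tgt G e ≡ high upward) ⊎ (src G e ≡ high upward × tgt G e ≡ low upward)

  orient : ∀ e → Oriented e
  orient e@((s , t) , _ , st) = go (ℕ.<-cmp (Y s) (Y t))
    where
      go : Tri (Y s ℕ.< Y t) (Y s ≡ Y t) (Y t ℕ.< Y s) → Oriented e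
      go (tri< lt _ _) = record { upward = record { edge = st ; up = lt } ; ends = inj₁ (refl , refl) }
      go (tri≈ _ eq _) = ⊥-elim (~-irrefl (subst (s ~_) (sym (Y-inj eq)) st))
      go (tri> _ _ lt) = record { upward = record { edge = ~-sym st ; up = lt } ; ends = inj₂ (refl , refl) }

  upwards : Edge G → Upward
  upwards e = Oriented.upward (orient e)

  low≢corner : ∀ a → position (low a) ≢ corner a
  low≢corner a eq = absurd-by (0<by-yu a) (≡⇒-≡0 (sym (cong proj₂ eq)))

  high≢corner : ∀ a → position (high a) ≢ corner a
  high≢corner a eq = go (ℕ.<-cmp (X (high a)) (X (low a)))
    where
      go : Tri (X (high a) ℕ.< X (low a)) (X (high a) ≡ X (low a)) (X (low a) ℕ.< X (high a)) → ⊥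
      go (tri< r _ _) = absurd-by (Right.0<bx-xv a (coord-sep r)) (≡⇒-≡0 (sym (cong proj₁ eq)))
      go (tri≈ _ e _) = ends≢ a (sym e)
      go (tri> _ _ r) = absurd-by (Left.0<xv-bx a (coord-sep r)) (≡⇒-≡0 (cong proj₁ eq))

  module _ (e : Edge G) where
    private
      a = upwards e
      ends = Oriented.ends (orient e)

    path : List Point
    path = position (src G e) ∷ corner a ∷ position (tgt G e) ∷ []

    first-segment : ∀ {z} → OnSeg (position (src G e)) (corner a) z → OnSteep a z ⊎ OnFlat a z
    first-segment {z} p = either
      (λ (s , _) → inj₁ (subst (λ v → OnSeg (position v) (corner a) z) s p))
      (λ (s , _) → inj₂ (subst (λ v → OnSeg (position v) (corner a) z) s p)) ends

    second-segment : ∀ {z} → OnSeg (corner a) (position (tgt G e)) z → OnSteep a z ⊎ OnFlat a z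
    second-segment {z} p = either
      (λ (_ , t) → inj₂ (OnSeg-reverse (subst (λ v → OnSeg (corner a) (position v) z) t p)))
      (λ (_ , t) → inj₁ (OnSeg-reverse (subst (λ v → OnSeg (corner a) (position v) z) t p))) ends

    on-path : ∀ {z} → OnPoly path z → OnSteep a z ⊎ OnFlat a z
    on-path (here p) = first-segment p
    on-path (there (here p)) = second-segment p

    segments-meet : ∀ {z} → OnSeg (position (src G e)) (corner a) z → OnSeg (corner a) (position (tgt G e)) z → z ≡ corner a
    segments-meet {z} p q = either
      (λ (s , t) → meet a (subst (λ v → OnSeg (position v) (corner a) z) s p) (OnSeg-reverse (subst (λ v → OnSeg (corner a) (position v) z) t q)))
      (λ (s , t) → meet a (OnSeg-reverse (subst (λ v → OnSeg (corner a) (position v) z) t q)) (subst (λ v → OnSeg (position v) (corner a) z) s p)) ends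

    path-nondegenerate : NonDegenerate path
    path-nondegenerate = either
      (λ (s , t) → subst (λ v → position v ≢ corner a) (sym s) (low≢corner a)
                 ∷ subst (λ v → corner a ≢ position v) (sym t) (high≢corner a ∘ sym) ∷ [])
      (λ (s , t) → subst (λ v → position v ≢ corner a) (sym s) (high≢corner a)
                 ∷ subst (λ v → corner a ≢ position v) (sym t) (low≢corner a ∘ sym) ∷ []) ends

    path-simple : Simple path
    path-simple Fin.zero Fin.zero ()
    path-simple Fin.zero (Fin.suc Fin.zero) _ x p q = refl , segments-meet p q
    path-simple (Fin.suc Fin.zero) Fin.zero ()
    path-simple (Fin.suc Fin.zero) (Fin.suc Fin.zero) (s≤s ())

    path-ends : ∀ {z} → Ends a z → z ≡ position (src G e) ⊎ z ≡ position (tgt G e)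
    path-ends {z} (inj₁ p) = either (λ (s , _) → inj₁ (trans p (cong position (sym s)))) (λ (_ , t) → inj₂ (trans p (cong position (sym t)))) ends
    path-ends {z} (inj₂ p) = either (λ (_ , t) → inj₂ (trans p (cong position (sym t)))) (λ (s , _) → inj₁ (trans p (cong position (sym s)))) ends

    -- A vertex on the steep part is within 1 of the column of the lower end, one on the flat part
    -- within 1 of the row of the upper end. Rows and columns determine vertices.
    path-vertex : ∀ {w} → OnPoly path (position w) → w ≡ src G e ⊎ w ≡ tgt G e
    path-vertex {w} p = either low-or-high high-or-low (either (inj₁ ∘ steep→) (inj₂ ∘ flat→) (on-path p))
      where
        steep→ : OnSteep a (position w) → w ≡ low a
        steep→ q = X-inj (same-height {X w} {X (low a)} (below-1 ≤-refl) (above-1 ≤-refl) (below-1 (steep-x≥ a q)) (steep-x≤ a q))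
        flat→ : OnFlat a (position w) → w ≡ high a
        flat→ q = Y-inj (same-height {Y w} {Y (high a)} (below-1 ≤-refl) (above-1 ≤-refl) (flat-y≥ a q) (flat-y≤ a q))
        low-or-high : w ≡ low a → w ≡ src G e ⊎ w ≡ tgt G e
        low-or-high q = either (λ (s , _) → inj₁ (trans q (sym s))) (λ (_ , t) → inj₂ (trans q (sym t))) ends
        high-or-low : w ≡ high a → w ≡ src G e ⊎ w ≡ tgt G e
        high-or-low q = either (λ (_ , t) → inj₂ (trans q (sym t))) (λ (s , _) → inj₁ (trans q (sym s))) ends

  same-ends : ∀ e f → low (upwards e) ≡ low (upwards f) → high (upwards e) ≡ high (upwards f) → proj₁ e ≡ proj₁ f
  same-ends e@((s , t) , s<t , _) f@((s' , t') , s'<t' , _) p q = go (Oriented.ends (orient e)) (Oriented.ends (orient f))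
    where
      go : (s ≡ low (upwards e) × t ≡ high (upwards e)) ⊎ (s ≡ high (upwards e) × t ≡ low (upwards e)) →
           (s' ≡ low (upwards f) × t' ≡ high (upwards f)) ⊎ (s' ≡ high (upwards f) × t' ≡ low (upwards f)) → (s , t) ≡ (s' , t')
      go (inj₁ (a , b)) (inj₁ (c , d)) = cong₂ _,_ (trans a (trans p (sym c))) (trans b (trans q (sym d)))
      go (inj₂ (a , b)) (inj₂ (c , d)) = cong₂ _,_ (trans a (trans q (sym c))) (trans b (trans p (sym d)))
      go (inj₁ (a , b)) (inj₂ (c , d)) = contradiction s'<t'
        (ℕ.<-asym (subst₂ (λ v w → Fin.toℕ v ℕ.< Fin.toℕ w) (trans a (trans p (sym d))) (trans b (trans q (sym c))) s<t))
      go (inj₂ (a , b)) (inj₁ (c , d)) = contradiction s'<t'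
        (ℕ.<-asym (subst₂ (λ v w → Fin.toℕ v ℕ.< Fin.toℕ w) (trans a (trans q (sym d))) (trans b (trans p (sym c))) s<t))

  drawing : Drawing G 1
  drawing = record
    { pos = position
    ; pos-inj = λ u v e → X-inj (coord-injective (cong proj₁ e))
    ; bends = λ e → corner (upwards e) ∷ []
    ; bends-≤ = λ e → s≤s z≤n
    ; nondeg = path-nondegenerate
    ; simple = path-simple
    ; avoids = λ e w w≢s w≢t p → either w≢s w≢t (path-vertex e p)
    ; noncrossing = λ e f ne x p q → cross e f ne (on-path e p) (on-path f q) }
    where
      cross : ∀ e f → proj₁ e ≢ proj₁ f → ∀ {x} → OnSteep (upwards e) x ⊎ OnFlat (upwards e) x → OnSteep (upwards f) x ⊎ OnFlat (upwards f) x →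
        (x ≡ position (src G e) ⊎ x ≡ position (tgt G e)) ⊎ (x ≡ position (src G f) ⊎ x ≡ position (tgt G f))
      cross e f ne = go
        where
          differ : Differ (upwards e) (upwards f)
          differ (p , q) = ne (same-ends e f p q)
          differ' : Differ (upwards f) (upwards e)
          differ' (p , q) = differ (sym p , sym q)
          go : ∀ {x} → OnSteep (upwards e) x ⊎ OnFlat (upwards e) x → OnSteep (upwards f) x ⊎ OnFlat (upwards f) x →
            (x ≡ position (src G e) ⊎ x ≡ position (tgt G e)) ⊎ (x ≡ position (src G f) ⊎ x ≡ position (tgt G f))
          go (inj₁ p) (inj₁ q) = inj₁ (path-ends e (steep-steep (upwards e) (upwards f) differ p q))
          go (inj₁ p) (inj₂ q) = inj₂ (path-ends f (flat-steep (upwards f) (upwards e) differ' q p))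
          go (inj₂ p) (inj₁ q) = inj₁ (path-ends e (flat-steep (upwards e) (upwards f) differ p q))
          go (inj₂ p) (inj₂ q) = inj₁ (path-ends e (flat-flat (upwards e) (upwards f) differ p q))

  -- Rank 0 contributes the exact vertical and the exact horizontal.
  directions : List Point
  directions = map (λ i → slope i , 1#) (upTo d) ++ map (λ i → 1# , slope i) (upTo d)

  drawing-slopes : UsesAtMostSlopes drawing (2 ℕ.* d)
  drawing-slopes = directions , ℕ.≤-reflexive length-directions ,
      All.++⁺ (All.map⁺ (All.universal (λ i e → 0≢1 (sym (cong proj₂ e))) (upTo d)))
              (All.map⁺ (All.universal (λ i e → 0≢1 (sym (cong proj₁ e))) (upTo d))) ,
      λ e → either
        (λ (s , t) → subst (λ v → Any (Parallel (corner (upwards e) -ᵖ position v)) directions) (sym s) (steep-slope (upwards e))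
                   ∷ subst (λ v → Any (Parallel (position v -ᵖ corner (upwards e))) directions) (sym t) (Any.map (λ {v} → turn-around (flat-vector (upwards e)) v) (flat-slope (upwards e))) ∷ [])
        (λ (s , t) → subst (λ v → Any (Parallel (corner (upwards e) -ᵖ position v)) directions) (sym s) (flat-slope (upwards e))
                   ∷ subst (λ v → Any (Parallel (position v -ᵖ corner (upwards e))) directions) (sym t) (Any.map (λ {v} → turn-around (steep-vector (upwards e)) v) (steep-slope (upwards e))) ∷ [])
        (Oriented.ends (orient e))
    where
      length-directions : length directions ≡ 2 ℕ.* d
      length-directions = begin
        length directions            ≡⟨ List.length-++ (map (λ i → slope i , 1#) (upTo d)) ⟩
        length (map (λ i → slope i , 1#) (upTo d)) ℕ.+ length (map (λ i → 1# , slope i) (upTo d))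
          ≡⟨ cong₂ ℕ._+_ (trans (List.length-map _ (upTo d)) (List.length-upTo d)) (trans (List.length-map _ (upTo d)) (List.length-upTo d)) ⟩
        d ℕ.+ d                      ≡⟨ cong (d ℕ.+_) (sym (ℕ.+-identityʳ d)) ⟩
        2 ℕ.* d ∎
        where open ≡-Reasoning
      steep-vector flat-vector : Upward → Point × Point
      steep-vector a = corner a , position (low a)
      flat-vector a = corner a , position (high a)
      turn-around : ∀ (pq : Point × Point) v → Parallel (proj₁ pq -ᵖ proj₂ pq) v → Parallel (proj₂ pq -ᵖ proj₁ pq) v
      turn-around ((p , q) , (r , s)) (a , b) e = trans
        (solve 6 (λ p q r s a b → (r :- p) :* b :- ((s :- q) :* a) := :- ((p :- r) :* b :- ((q :- s) :* a))) refl p q r s a b)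
        (trans (cong -_ e) (solve 0 (:- :0 := :0) refl))
      steep-slope : ∀ a → Any (Parallel (corner a -ᵖ position (low a))) directions
      steep-slope a = Any.++⁺ˡ (Any.map⁺ (lose (∈-upTo⁺ (rank<d (key (low a)) (edge a)))
        (trans (cong (λ z → z * 1# - (by a - coord (Y (low a))) * steepness (low a) (high a)) (steep a))
          (solve 2 (λ s y → s :* y :* :1 :- y :* s := :0) refl (steepness (low a) (high a)) (by a - coord (Y (low a)))))))
      flat-slope : ∀ a → Any (Parallel (corner a -ᵖ position (high a))) directions
      flat-slope a = Any.++⁺ʳ (map (λ i → slope i , 1#) (upTo d)) (Any.map⁺ (lose (∈-upTo⁺ (rank<d X (~-sym (edge a))))
        (trans (cong (λ z → (bx a - coord (X (high a))) * flatness (low a) (high a) - z * 1#) (flat a))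
          (solve 2 (λ h x → x :* h :- h :* x :* :1 := :0) refl (flatness (low a) (high a)) (bx a - coord (X (high a)))))))

-- Parities of closed curves in a straight-line drawing

open CommutativeSemigroup (CommutativeMonoid.commutativeSemigroup (CommutativeRing.+-commutativeMonoid xor-∧-commutativeRing)) using (interchange)

xor-cancel : ∀ {a b} → a xor b ≡ false → a ≡ b
xor-cancel {true} {true} _ = refl
xor-cancel {false} {false} _ = refl

does-cong : ∀ {P Q : Set} (p? : Dec P) (q? : Dec Q) → (P → Q) → (Q → P) → does p? ≡ does q?
does-cong (yes _) (yes _) _ _ = refl
does-cong (yes p) (no ¬q) f _ = contradiction (f p) ¬q
does-cong (no ¬p) (yes q) _ g = contradiction (g q) ¬p
does-cong (no _) (no _) _ _ = refl

∧-falseˡ : ∀ {a} b → a ≡ false → a ∧ b ≡ false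
∧-falseˡ b refl = refl

∧-falseʳ : ∀ a {b} → b ≡ false → a ∧ b ≡ false
∧-falseʳ true refl = refl
∧-falseʳ false refl = refl

∧-trueˡ : ∀ {a} b → a ≡ true → a ∧ b ≡ b
∧-trueˡ b refl = refl

-- Slopes, lines and signs next to a point

module Lines (ℝ : RealField) where
  open OrderedField ℝ
  open Geometry ℝ

  <⇒≢0 : ∀ {a b} → a < b → b - a ≢ 0#
  <⇒≢0 p e = <-irr (subst (0# <_) e (<⇒0< p))

  abstract
    -- Made total by the value 0 at 0, so that slopes can be written without a proof that the
    -- abscissae differ.
    recip : Carrier → Carrier
    recip a with a ≟ᶠ 0#
    ... | yes _ = 0#
    ... | no a≢0 = proj₁ (inverse a a≢0)

    recip-inverse : ∀ {a} → a ≢ 0# → a * recip a ≡ 1#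
    recip-inverse {a} a≢0 with a ≟ᶠ 0#
    ... | yes e = contradiction e a≢0
    ... | no q = proj₂ (inverse a q)

  recip-positive : ∀ {a} → 0# < a → 0# < recip a
  recip-positive {a} p = go (compare 0# (recip a))
    where
      e : a * recip a ≡ 1#
      e = recip-inverse (λ { refl → <-irr p })
      go : Tri (0# < recip a) (0# ≡ recip a) (recip a < 0#) → 0# < recip a
      go (tri< q _ _) = q
      go (tri≈ _ q _) = ⊥-elim (0≢1 (trans (sym (zeroʳ a)) (trans (cong (a *_) q) e)))
      go (tri> _ _ q) = ⊥-elim (absurd-by (0<+ (*-pos p (<⇒0< q)) 0<1)
        (trans (solve 2 (λ x y → x :* (:0 :- y) :+ :1 := :- (x :* y) :+ :1) refl a (recip a))
        (trans (cong (λ z → - z + 1#) e) (-‿inverseˡ 1#))))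

  x y : Point → Carrier
  x = proj₁
  y = proj₂

  infix 4 _≟ᵖ_
  _≟ᵖ_ : (p q : Point) → Dec (p ≡ q)
  _≟ᵖ_ = ≡-dec _≟ᶠ_ _≟ᶠ_

  abstract
    slope : Point → Point → Carrier
    slope p q = (y q - y p) * recip (x q - x p)

    slope-rise : ∀ {p q} → x q - x p ≢ 0# → slope p q * (x q - x p) ≡ y q - y p
    slope-rise {p} {q} ne = trans
      (solve 3 (λ a r d → a :* r :* d := a :* (d :* r)) refl (y q - y p) (recip (x q - x p)) (x q - x p))
      (trans (cong ((y q - y p) *_) (recip-inverse ne)) (*-identityʳ _))

  line : Point → Point → Carrier → Carrier
  line p q t = y p + slope p q * (t - x p)

  line-start : ∀ p q → line p q (x p) ≡ y p
  line-start p q = solve 3 (λ y m x → y :+ m :* (x :- x) := y) refl (y p) (slope p q) (x p)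

  line-end : ∀ {p q} → x p < x q → line p q (x q) ≡ y q
  line-end {p} {q} lt = trans (cong (y p +_) (slope-rise (<⇒≢0 lt))) (solve 2 (λ a b → a :+ (b :- a) := b) refl (y p) (y q))

  slope-sym : ∀ {p q} → x p < x q → slope q p ≡ slope p q
  slope-sym {p} {q} lt = -≡0⇒≡ (*-cancel
    (trans (solve 4 (λ s t a b → (s :- t) :* (b :- a) := :- (s :* (a :- b)) :- t :* (b :- a)) refl (slope q p) (slope p q) (x p) (x q))
    (trans (cong₂ (λ u v → - u - v) (slope-rise ne) (slope-rise (<⇒≢0 lt)))
      (solve 2 (λ a b → :- (a :- b) :- (b :- a) := :0) refl (y p) (y q)))) (<⇒≢0 lt))
    where
      ne : x p - x q ≢ 0#
      ne e = <⇒≢0 lt (trans (solve 2 (λ a b → b :- a := :- (a :- b)) refl (x p) (x q)) (trans (cong -_ e) (solve 0 (:- :0 := :0) refl)))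

  on-line : ∀ {p q t} → x p < x q → x p ≤ t → t ≤ x q → OnSeg p q (t , line p q t)
  on-line {p} {q} {t} lt lo hi = λ' , 0≤* (≤⇒0≤ lo) (inj₁ r>0) , λ'≤1 , xeq , yeq
    where
      w r λ' : Carrier
      w = x q - x p
      r = recip w
      λ' = (t - x p) * r
      r>0 : 0# < r
      r>0 = recip-positive (<⇒0< lt)
      wr : w * r ≡ 1#
      wr = recip-inverse (<⇒≢0 lt)
      λ'≤1 : λ' ≤ 1#
      λ'≤1 = 0≤-by (0≤* (≤⇒0≤ hi) (inj₁ r>0)) (trans (cong (_- λ') (sym wr))
        (solve 4 (λ a b t r → (b :- a) :* r :- (t :- a) :* r := (b :- t) :* r) refl (x p) (x q) t r))
      λ'w : λ' * w ≡ t - x p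
      λ'w = trans (solve 3 (λ d r w → d :* r :* w := d :* (w :* r)) refl (t - x p) r w) (trans (cong ((t - x p) *_) wr) (*-identityʳ _))
      xeq : t ≡ x p + λ' * w
      xeq = trans (solve 2 (λ a t → t := a :+ (t :- a)) refl (x p) t) (cong (x p +_) (sym λ'w))
      yeq : line p q t ≡ y p + λ' * (y q - y p)
      yeq = cong (y p +_) (trans (cong (slope p q *_) (sym λ'w)) (trans
        (solve 3 (λ m l w → m :* (l :* w) := l :* (m :* w)) refl (slope p q) λ' w) (cong (λ' *_) (slope-rise (<⇒≢0 lt)))))

  -- Is D + k ε positive for infinitesimal ε > 0?
  germ : Carrier → Carrier → Bool
  germ D k = if does (0# <? D) then true else (if does (D <? 0#) then false else does (0# <? k))

  if-true : ∀ {b} {c d : Bool} → b ≡ true → (if b then c else d) ≡ c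
  if-true refl = refl

  if-false : ∀ {b} {c d : Bool} → b ≡ false → (if b then c else d) ≡ d
  if-false refl = refl

  germ-positive : ∀ {D k} → 0# < D → germ D k ≡ true
  germ-positive {D} p = if-true (dec-true (0# <? D) p)

  germ-negative : ∀ {D k} → D < 0# → germ D k ≡ false
  germ-negative {D} p = trans (if-false (dec-false (0# <? D) (λ q → <-irr (<-trans p q)))) (if-true (dec-true (D <? 0#) p))

  germ-zero : ∀ {D k} → D ≡ 0# → germ D k ≡ does (0# <? k)
  germ-zero {D} refl = trans (if-false (dec-false (0# <? D) <-irr)) (if-false (dec-false (D <? 0#) <-irr))

  germ-nonzero : ∀ {D k} → D ≢ 0# → germ D k ≡ does (0# <? D)
  germ-nonzero {D} {k} ne = go (compare 0# D)
    where
      go : Tri (0# < D) (0# ≡ D) (D < 0#) → germ D k ≡ does (0# <? D)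
      go (tri< p _ _) = trans (germ-positive p) (sym (dec-true (0# <? D) p))
      go (tri≈ _ e _) = contradiction (sym e) ne
      go (tri> _ _ p) = trans (germ-negative p) (sym (dec-false (0# <? D) (λ q → <-irr (<-trans p q))))

  -- Both germs look into the interval, to the right from its left end and to the left from its
  -- right end. Where an end value vanishes, the slope supplies the sign found at the other end.
  germ-transport : ∀ {DL DR k w} → 0# < w → DR ≡ DL + k * w → ¬ (0# < DL × DR < 0#) → ¬ (DL < 0# × 0# < DR) →
    germ DL k ≡ germ DR (- k)
  germ-transport {DL} {DR} {k} {w} 0<w e down up = go (compare 0# DL) (compare 0# DR)
    where
      zero-neg : ∀ {a} → a < 0# → 0# < - a
      zero-neg {a} p = subst (0# <_) (+-identityˡ _) (<⇒0< p)
      neg-k : ∀ {s} → 0# < s → DR + s ≡ DL → 0# < - k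
      neg-k {s} 0<s q = go′ (compare 0# k)
        where
          go′ : Tri (0# < k) (0# ≡ k) (k < 0#) → 0# < - k
          go′ (tri> _ _ p) = zero-neg p
          go′ (tri≈ _ p _) = ⊥-elim (absurd-by 0<s (trans (solve 3 (λ s l r → s := (r :+ s) :- l :+ (l :- r)) refl s DL DR)
            (trans (cong₂ _+_ (≡⇒-≡0 q) (≡⇒-≡0 (trans (sym (+-identityʳ DL)) (trans (cong (DL +_) (sym (trans (cong (_* w) (sym p)) (zeroˡ w)))) (sym e))))) (+-identityˡ 0#))))
          go′ (tri< p _ _) = ⊥-elim (absurd-by (0<+ 0<s (*-pos p 0<w)) (trans
            (solve 4 (λ s l r m → s :+ m := ((r :+ s) :- l) :- (r :- (l :+ m))) refl s DL DR (k * w))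
            (trans (cong₂ _-_ (≡⇒-≡0 q) (≡⇒-≡0 e)) (-‿inverseʳ 0#))))
      pos-k : ∀ {s} → 0# < s → DL + s ≡ DR → 0# < k
      pos-k {s} 0<s q = go′ (compare 0# k)
        where
          go′ : Tri (0# < k) (0# ≡ k) (k < 0#) → 0# < k
          go′ (tri< p _ _) = p
          go′ (tri≈ _ p _) = ⊥-elim (absurd-by 0<s (trans (solve 3 (λ s l m → s := ((l :+ s) :- (l :+ m)) :+ m) refl s DL (k * w))
            (trans (cong₂ _+_ (≡⇒-≡0 (trans q e)) (trans (cong (_* w) (sym p)) (zeroˡ w))) (+-identityˡ 0#))))
          go′ (tri> _ _ p) = ⊥-elim (absurd-by (0<+ 0<s (*-pos (zero-neg p) 0<w)) (trans
            (solve 4 (λ s l k w → s :+ (:- k) :* w := (l :+ s) :- (l :+ k :* w)) refl s DL k w) (≡⇒-≡0 (trans q e))))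
      not-both : ∀ {a} → 0# < a → ¬ (0# < - a)
      not-both {a} p q = absurd-by (0<+ p q) (-‿inverseʳ a)
      go : Tri (0# < DL) (0# ≡ DL) (DL < 0#) → Tri (0# < DR) (0# ≡ DR) (DR < 0#) → germ DL k ≡ germ DR (- k)
      go (tri< p _ _) (tri< q _ _) = trans (germ-positive p) (sym (germ-positive q))
      go (tri< p _ _) (tri≈ _ q _) = trans (germ-positive p) (sym (trans (germ-zero (sym q))
        (dec-true (0# <? - k) (neg-k p (trans (cong (_+ DL) (sym q)) (+-identityˡ DL))))))
      go (tri< p _ _) (tri> _ _ q) = ⊥-elim (down (p , q))
      go (tri> _ _ p) (tri< q _ _) = ⊥-elim (up (p , q))
      go (tri> _ _ p) (tri≈ _ q _) = trans (germ-negative p) (sym (trans (germ-zero (sym q))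
        (dec-false (0# <? - k) (not-both (pos-k (zero-neg p) (trans (-‿inverseʳ DL) q))))))
      go (tri> _ _ p) (tri> _ _ q) = trans (germ-negative p) (sym (germ-negative q))
      go (tri≈ _ p _) (tri< q _ _) = trans (germ-zero (sym p)) (trans (dec-true (0# <? k) (pos-k q (trans (cong (_+ DR) (sym p)) (+-identityˡ DR))))
        (sym (germ-positive q)))
      go (tri≈ _ p _) (tri> _ _ q) = trans (germ-zero (sym p)) (trans
        (dec-false (0# <? k) (λ r → not-both r (neg-k (zero-neg q) (trans (-‿inverseʳ DR) p)))) (sym (germ-negative q)))
      go (tri≈ _ p _) (tri≈ _ q _) = trans (germ-zero (sym p)) (trans (trans (dec-false (0# <? k) (λ r → <-irr (subst (0# <_) k≡0 r)))
        (sym (dec-false (0# <? - k) (λ r → <-irr (subst (0# <_) (trans (cong -_ k≡0) (solve 0 (:- :0 := :0) refl)) r))))) (sym (germ-zero (sym q))))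
        where
          k≡0 : k ≡ 0#
          k≡0 = *-cancel (trans (solve 2 (λ l m → m := (l :+ m) :- l) refl DL (k * w)) (≡⇒-≡0 (trans (sym e) (trans (sym q) p))))
            (λ z → <-irr (subst (0# <_) z 0<w))

-- `Drawn p q` says that pq is a segment of a straight-line plane drawing whose
-- points have distinct abscissae.
module Sweep (ℝ : RealField) (Drawn : Geometry.Point ℝ → Geometry.Point ℝ → Set)
  (drawn-sym : ∀ {p q} → Drawn p q → Drawn q p)
  (drawn-≢ : ∀ {p q} → Drawn p q → p ≢ q)
  (abscissa : ∀ {p q r s} → Drawn p q → Drawn r s → proj₁ p ≡ proj₁ r → p ≡ r)
  (disjoint : ∀ {p q r s z} → Drawn p q → Drawn r s → Geometry.OnSeg ℝ p q z → Geometry.OnSeg ℝ r s z →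
    ((p ≡ r × q ≡ s) ⊎ (p ≡ s × q ≡ r)) ⊎ ((z ≡ p ⊎ z ≡ q) × (z ≡ r ⊎ z ≡ s))) where
  open OrderedField ℝ
  open Geometry ℝ
  open Incidence ℝ
  open Lines ℝ

  x≢ : ∀ {p q} → Drawn p q → x p ≢ x q
  x≢ d e = drawn-≢ d (abscissa d (drawn-sym d) e)

  side : Point → Point → Bool
  side z b = does (x z <? x b)

  -- Counterclockwise order of the directions at z, from straight down.
  before : Point → Point → Point → Bool
  before z b q =
    if side z b then (if side z q then does (slope z b <? slope z q) else true)
    else (if side z q then false else does (slope z b <? slope z q))

  -- The share of the segment ab in a sum of φ over the directions at `z`: whenever one end is `z`,
  -- the other end names the direction.
  at : Point → (Point → Bool) → Point → Point → Bool
  at z φ a b = (does (a ≟ᵖ z) ∧ φ b) xor (does (b ≟ᵖ z) ∧ φ a)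

  -- The ray goes straight up from `z`. Strict inequalities suffice: by distinct abscissae, a drawn
  -- segment with an end on the vertical through a drawn point `z` ends at `z` itself, and such
  -- segments are counted by `at`.
  under⁺ : Point → Point → Point → Bool
  under⁺ z a b = does (x a <? x z) ∧ (does (x z <? x b) ∧ does (y z <? line a b (x z)))

  under : Point → Point → Point → Bool
  under z a b = if does (x a <? x b) then under⁺ z a b else under⁺ z b a

  data Chain : Point → Point → Set where
    [] : ∀ {p} → Chain p p
    step : ∀ {p q r} → Drawn p q → Chain q r → Chain p r

  _⁀_ : ∀ {p q r} → Chain p q → Chain q r → Chain p r
  [] ⁀ d = d
  step e c ⁀ d = step e (c ⁀ d)

  tally : (Point → Point → Bool) → ∀ {p q} → Chain p q → Bool
  tally f [] = false
  tally f (step {p} {q} _ c) = f p q xor tally f c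

  tally-⁀ : ∀ f {p q r} (c : Chain p q) (d : Chain q r) → tally f (c ⁀ d) ≡ tally f c xor tally f d
  tally-⁀ f [] d = refl
  tally-⁀ f (step {p} {q} _ c) d = trans (cong (f p q xor_) (tally-⁀ f c d)) (sym (xor-assoc (f p q) (tally f c) (tally f d)))

  tally-cong : ∀ {f g} → (∀ {a b} → Drawn a b → f a b ≡ g a b) → ∀ {p q} (c : Chain p q) → tally f c ≡ tally g c
  tally-cong e [] = refl
  tally-cong e (step d c) = cong₂ _xor_ (e d) (tally-cong e c)

  tally-xor : ∀ f g {p q} (c : Chain p q) → tally (λ a b → f a b xor g a b) c ≡ tally f c xor tally g c
  tally-xor f g [] = refl
  tally-xor f g (step {p} {q} _ c) = trans (cong ((f p q xor g p q) xor_) (tally-xor f g c)) (interchange (f p q) (g p q) (tally f c) (tally g c))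

  tally-boundary : ∀ (U : Point → Bool) {p q} (c : Chain p q) → tally (λ a b → U a xor U b) c ≡ U p xor U q
  tally-boundary U {p} [] = sym (xor-same (U p))
  tally-boundary U {p} {r} (step {q = q} _ c) = trans (cong ((U p xor U q) xor_) (tally-boundary U c)) (collapse (U p) (U q) (U r))
    where
      collapse : ∀ a b c → (a xor b) xor (b xor c) ≡ a xor c
      collapse a b c = trans (xor-assoc a b (b xor c)) (cong (a xor_) (trans (sym (xor-assoc b b c)) (cong (_xor c) (xor-same b))))

  -- The differences of `U` telescope along the chain, and a closed chain returns to its starting
  -- value.
  tally-closed : ∀ {f g} (U : Point → Bool) → (∀ {a b} → Drawn a b → f a b xor g a b ≡ U a xor U b) → ∀ {p} (c : Chain p p) → tally f c ≡ tally g c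
  tally-closed {f} {g} U e {p} c = xor-cancel (trans (sym (tally-xor f g c)) (trans (tally-cong e c) (trans (tally-boundary U c) (xor-same (U p)))))

  at-cong : ∀ {z φ ψ} → (∀ {b} → Drawn z b → φ b ≡ ψ b) → ∀ {a b} → Drawn a b → at z φ a b ≡ at z ψ a b
  at-cong {z} {φ} {ψ} e {a} {b} d = cong₂ _xor_ (go (a ≟ᵖ z) d) (go (b ≟ᵖ z) (drawn-sym d))
    where
      go : ∀ {a b} (q : Dec (a ≡ z)) → Drawn a b → does q ∧ φ b ≡ does q ∧ ψ b
      go (yes refl) d = e d
      go (no _) d = refl

  at-xor : ∀ z φ ψ a b → at z φ a b xor at z ψ a b ≡ at z (λ v → φ v xor ψ v) a b
  at-xor z φ ψ a b = trans (interchange (does (a ≟ᵖ z) ∧ φ b) (does (b ≟ᵖ z) ∧ φ a) (does (a ≟ᵖ z) ∧ ψ b) (does (b ≟ᵖ z) ∧ ψ a))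
    (cong₂ _xor_ (factor (does (a ≟ᵖ z)) (φ b) (ψ b)) (factor (does (b ≟ᵖ z)) (φ a) (ψ a)))
    where
      factor : ∀ s t u → (s ∧ t) xor (s ∧ u) ≡ s ∧ (t xor u)
      factor true t u = refl
      factor false t u = refl

  -- Parity of the chain in the corner at z reached after crossing the
  -- directions selected by φ, starting from straight down.
  corner : (Point → Bool) → Point → ∀ {p q} → Chain p q → Bool
  corner φ z c = tally (λ a b → under z a b xor at z (λ v → side z v xor φ v) a b) c

  corner-cong : ∀ {z φ ψ} → (∀ {b} → Drawn z b → φ b ≡ ψ b) → ∀ {p q} (c : Chain p q) → corner φ z c ≡ corner ψ z c
  corner-cong {z} e = tally-cong (λ {a} {b} d → cong (under z a b xor_) (at-cong {z} (λ {v} d' → cong (side z v xor_) (e d')) d))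

  -- The corner just past the direction to `q` is reached by crossing all directions up to and
  -- including `q`, the corner just before it by crossing those strictly earlier.
  left right : Point → Point → ∀ {r s} → Chain r s → Bool
  left z q = corner (λ b → not (before z q b)) z
  right z q = corner (λ b → before z b q) z

  -- A full turn changes the parity once for each segment end at `z`, and a closed chain has an even
  -- number of them.
  corner-around : ∀ z {p} (c : Chain p p) → corner (λ _ → true) z c ≡ corner (λ _ → false) z c
  corner-around z c = tally-closed (λ v → does (v ≟ᵖ z)) (λ {a} {b} _ → around a b) c
    where
      cancel : ∀ u s t → (u xor s) xor (u xor t) ≡ s xor t
      cancel true true true = refl
      cancel true true false = refl
      cancel true false true = refl
      cancel true false false = refl
      cancel false s t = refl
      ∧-true′ : ∀ b → b ∧ true ≡ b
      ∧-true′ true = refl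
      ∧-true′ false = refl
      around : ∀ a b → (under z a b xor at z (λ v → side z v xor true) a b) xor (under z a b xor at z (λ v → side z v xor false) a b)
        ≡ does (a ≟ᵖ z) xor does (b ≟ᵖ z)
      around a b = trans (cancel (under z a b) _ _) (trans (at-xor z (λ v → side z v xor true) (λ v → side z v xor false) a b)
        (cong₂ _xor_ (trans (cong (does (a ≟ᵖ z) ∧_) (diff (side z b))) (∧-true′ _)) (trans (cong (does (b ≟ᵖ z) ∧_) (diff (side z a))) (∧-true′ _))))
        where
          diff : ∀ s → (s xor true) xor (s xor false) ≡ true
          diff true = refl
          diff false = refl

  private
    side-right : ∀ {z b} → x z < x b → side z b ≡ true
    side-right {z} {b} p = dec-true (x z <? x b) p

    side-left : ∀ {z b} → x b < x z → side z b ≡ false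
    side-left {z} {b} p = dec-false (x z <? x b) (λ q → <-irr (<-trans p q))

  before-RR : ∀ {z b q} → x z < x b → x z < x q → before z b q ≡ does (slope z b <? slope z q)
  before-RR {z} {b} {q} l r = trans (if-true (side-right {z} {b} l)) (if-true (side-right {z} {q} r))

  before-RL : ∀ {z b q} → x z < x b → x q < x z → before z b q ≡ true
  before-RL {z} {b} {q} l r = trans (if-true (side-right {z} {b} l)) (if-false (side-left {z} {q} r))

  before-LR : ∀ {z b q} → x b < x z → x z < x q → before z b q ≡ false
  before-LR {z} {b} {q} l r = trans (if-false (side-left {z} {b} l)) (if-true (side-right {z} {q} r))

  before-LL : ∀ {z b q} → x b < x z → x q < x z → before z b q ≡ does (slope z b <? slope z q)
  before-LL {z} {b} {q} l r = trans (if-false (side-left {z} {b} l)) (if-false (side-left {z} {q} r))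

  before-irrefl : ∀ z b → before z b b ≡ false
  before-irrefl z b = go (side z b)
    where
      go : ∀ s → (if s then (if s then does (slope z b <? slope z b) else true) else (if s then false else does (slope z b <? slope z b))) ≡ false
      go true = dec-false (slope z b <? slope z b) <-irr
      go false = dec-false (slope z b <? slope z b) <-irr

  private
    touching : ∀ {z b q} → Drawn z b → Drawn z q → OnSeg z q b → b ≡ q
    touching {z} {b} {q} d e on = go (disjoint d e (OnSeg-right z b) on)
      where
        go : ((z ≡ z × b ≡ q) ⊎ (z ≡ q × b ≡ z)) ⊎ ((b ≡ z ⊎ b ≡ b) × (b ≡ z ⊎ b ≡ q)) → b ≡ q
        go (inj₁ (inj₁ (_ , r))) = r
        go (inj₁ (inj₂ (_ , r))) = contradiction (sym r) (drawn-≢ d)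
        go (inj₂ (_ , inj₁ r)) = contradiction (sym r) (drawn-≢ d)
        go (inj₂ (_ , inj₂ r)) = r

    line-shift : ∀ {z b q} → slope z b ≡ slope z q → ∀ t → line z b t ≡ line z q t
    line-shift {z} e t = cong (λ m → y z + m * (t - x z)) e

    line-swap : ∀ {p q} → x p < x q → ∀ t → line q p t ≡ line p q t
    line-swap {p} {q} lt t = trans (cong (λ m → y q + m * (t - x q)) (slope-sym lt))
      (trans (cong (_+ slope p q * (t - x q)) (sym (line-end lt)))
        (solve 5 (λ yp m xp xq t → (yp :+ m :* (xq :- xp)) :+ m :* (t :- xq) := yp :+ m :* (t :- xp)) refl (y p) (slope p q) (x p) (x q) t))

  -- If the directions agree, the nearer of the two ends lies on the segment to the farther one,
  -- which disjointness forbids unless they coincide.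
  same-direction : ∀ {z b q} → Drawn z b → Drawn z q → slope z b ≡ slope z q →
    (x z < x b × x z < x q) ⊎ (x b < x z × x q < x z) → b ≡ q
  same-direction {z} {b} {q} d e m (inj₁ (p , r)) = go (compare (x b) (x q))
    where
      go : Tri (x b < x q) (x b ≡ x q) (x q < x b) → b ≡ q
      go (tri< l _ _) = touching d e (subst (OnSeg z q) (cong (x b ,_) (trans (sym (line-shift m (x b))) (line-end p))) (on-line r (inj₁ p) (inj₁ l)))
      go (tri≈ _ l _) = abscissa (drawn-sym d) (drawn-sym e) l
      go (tri> _ _ l) = sym (touching e d (subst (OnSeg z b) (cong (x q ,_) (trans (line-shift m (x q)) (line-end r))) (on-line p (inj₁ r) (inj₁ l))))
  same-direction {z} {b} {q} d e m (inj₂ (p , r)) = go (compare (x b) (x q))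
    where
      go : Tri (x b < x q) (x b ≡ x q) (x q < x b) → b ≡ q
      go (tri> _ _ l) = touching d e (OnSeg-reverse (subst (OnSeg q z) (cong (x b ,_)
        (trans (sym (line-swap r (x b))) (trans (sym (line-shift m (x b))) (trans (line-swap p (x b)) (line-start b z))))) (on-line r (inj₁ l) (inj₁ p))))
      go (tri≈ _ l _) = abscissa (drawn-sym d) (drawn-sym e) l
      go (tri< l _ _) = sym (touching e d (OnSeg-reverse (subst (OnSeg b z) (cong (x q ,_)
        (trans (sym (line-swap p (x q))) (trans (line-shift m (x q)) (trans (line-swap r (x q)) (line-start q z))))) (on-line p (inj₁ l) (inj₁ r)))))

  private
    compare-slopes : ∀ {z b q} → slope z b ≢ slope z q → does (slope z b <? slope z q) ≡ not (does (slope z q <? slope z b))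
    compare-slopes {z} {b} {q} ne = go (compare (slope z b) (slope z q))
      where
        go : Tri (slope z b < slope z q) (slope z b ≡ slope z q) (slope z q < slope z b) → does (slope z b <? slope z q) ≡ not (does (slope z q <? slope z b))
        go (tri< p _ r) = trans (dec-true (_ <? _) p) (cong not (sym (dec-false (slope z q <? slope z b) r)))
        go (tri≈ _ e _) = contradiction e ne
        go (tri> p _ r) = trans (dec-false (_ <? _) p) (cong not (sym (dec-true (slope z q <? slope z b) r)))

    Sides : Point → Point → Set
    Sides z b = x z < x b ⊎ x b < x z

  sides : ∀ {z b} → Drawn z b → x z < x b ⊎ x b < x z
  sides {z} {b} d = go (compare (x z) (x b))
    where
      go : Tri (x z < x b) (x z ≡ x b) (x b < x z) → x z < x b ⊎ x b < x z
      go (tri< p _ _) = inj₁ p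
      go (tri≈ _ e _) = contradiction e (x≢ d)
      go (tri> _ _ p) = inj₂ p

  before-total : ∀ {z b q} → Drawn z b → Drawn z q → b ≢ q → before z b q ≡ not (before z q b)
  before-total {z} {b} {q} d e ne = go (sides d) (sides e)
    where
      go : Sides z b → Sides z q → before z b q ≡ not (before z q b)
      go (inj₁ p) (inj₁ r) = trans (before-RR p r) (trans (compare-slopes (λ m → ne (same-direction d e m (inj₁ (p , r))))) (cong not (sym (before-RR r p))))
      go (inj₁ p) (inj₂ r) = trans (before-RL p r) (cong not (sym (before-LR r p)))
      go (inj₂ p) (inj₁ r) = trans (before-LR p r) (cong not (sym (before-RL r p)))
      go (inj₂ p) (inj₂ r) = trans (before-LL p r) (trans (compare-slopes (λ m → ne (same-direction d e m (inj₂ (p , r))))) (cong not (sym (before-LL r p))))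

  before-trans : ∀ z a b c → before z a b ≡ true → before z b c ≡ true → before z a c ≡ true
  before-trans z a b c = go (side z a) (side z b) (side z c)
    where
      S : Point → Point → Bool
      S u v = does (slope z u <? slope z v)
      tr : S a b ≡ true → S b c ≡ true → S a c ≡ true
      tr p q = dec-true (slope z a <? slope z c) (<-trans (fromDoes (slope z a <? slope z b) p) (fromDoes (slope z b <? slope z c) q))
        where
          fromDoes : ∀ {P : Set} (p? : Dec P) → does p? ≡ true → P
          fromDoes (yes p) _ = p
      go : ∀ s t u → (if s then (if t then S a b else true) else (if t then false else S a b)) ≡ true →
        (if t then (if u then S b c else true) else (if u then false else S b c)) ≡ true →
        (if s then (if u then S a c else true) else (if u then false else S a c)) ≡ true
      go true true true p q = tr p q
      go true true false p q = refl
      go true false true p ()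
      go true false false p q = refl
      go false false false p q = tr p q
      go false false true p ()

  uses : Point → Point → Point → Point → Bool
  uses p q = at p (λ b → does (b ≟ᵖ q))

  -- The two selections of directions differ in `q` alone, because `before` is total on the drawn
  -- directions.
  left-right : ∀ {z q} → Drawn z q → ∀ {r s} (c : Chain r s) → left z q c ≡ right z q c xor tally (uses z q) c
  left-right {z} {q} d c = trans (tally-cong pointwise c) (tally-xor _ (uses z q) c)
    where
      crossing : ∀ {b} → Drawn z b → side z b xor not (before z q b) ≡ (side z b xor before z b q) xor does (b ≟ᵖ q)
      crossing {b} e = trans (cong (side z b xor_) (go (b ≟ᵖ q))) (sym (xor-assoc (side z b) (before z b q) (does (b ≟ᵖ q))))
        where
          go : (e' : Dec (b ≡ q)) → not (before z q b) ≡ before z b q xor does e'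
          go (yes refl) = xor-comm true (before z q q)
          go (no ne) = trans (sym (before-total e d ne)) (sym (xor-identityʳ _))
      pointwise : ∀ {a b} → Drawn a b → under z a b xor at z (λ b → side z b xor not (before z q b)) a b
        ≡ (under z a b xor at z (λ b → side z b xor before z b q) a b) xor uses z q a b
      pointwise {a} {b} e = trans (cong (under z a b xor_) (trans (at-cong {z} crossing e) (sym (at-xor z (λ b → side z b xor before z b q) (λ b → does (b ≟ᵖ q)) a b))))
        (sym (xor-assoc (under z a b) _ _))

  private
    -- The summands are those of a segment ab at one end of pq: the ray, the two ends of ab that may
    -- lie there, and the strip over pq. The number tells which of them decides.
    only-1 : ∀ {u s t v w} → u ≡ w → s ≡ false → t ≡ false → v ≡ false → (u xor (s xor t)) xor v ≡ w
    only-1 {true} refl refl refl refl = refl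
    only-1 {false} refl refl refl refl = refl

    only-2 : ∀ {u s t v w} → u ≡ false → s ≡ w → t ≡ false → v ≡ false → (u xor (s xor t)) xor v ≡ w
    only-2 {s = true} refl refl refl refl = refl
    only-2 {s = false} refl refl refl refl = refl

    only-3 : ∀ {u s t v w} → u ≡ false → s ≡ false → t ≡ w → v ≡ false → (u xor (s xor t)) xor v ≡ w
    only-3 {t = true} refl refl refl refl = refl
    only-3 {t = false} refl refl refl refl = refl

    only-4 : ∀ {u s t v w} → u ≡ false → s ≡ false → t ≡ false → v ≡ w → (u xor (s xor t)) xor v ≡ w
    only-4 refl refl refl refl = refl

    x-≢ : ∀ {a b} → x a < x b → a ≢ b
    x-≢ p refl = <-irr p

    <⇒≯ : ∀ {a b} → a < b → ¬ (b < a)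
    <⇒≯ p q = <-irr (<-trans p q)

  interior : ∀ {p q a b} → Drawn p q → Drawn a b → x a < x p → x p < x b → line a b (x p) ≢ y p
  interior {p} {q} {a} {b} d e a<p p<b eq = go (disjoint d e
      (OnSeg-left p q)
      (subst (OnSeg a b) (cong (x p ,_) eq) (on-line (<-trans a<p p<b) (inj₁ a<p) (inj₁ p<b))))
    where
      go : ((p ≡ a × q ≡ b) ⊎ (p ≡ b × q ≡ a)) ⊎ ((p ≡ p ⊎ p ≡ q) × (p ≡ a ⊎ p ≡ b)) → ⊥
      go (inj₁ (inj₁ (r , _))) = x-≢ a<p (sym r)
      go (inj₁ (inj₂ (r , _))) = x-≢ p<b r
      go (inj₂ (_ , inj₁ r)) = x-≢ a<p (sym r)
      go (inj₂ (_ , inj₂ r)) = x-≢ p<b r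

  gap : Point → Point → Point → Point → Carrier → Carrier
  gap p q a b t = line a b t - line p q t

  gap-linear : ∀ p q a b l r → gap p q a b r ≡ gap p q a b l + (slope a b - slope p q) * (r - l)
  gap-linear p q a b l r = solve 8 (λ yp mp xp ya ma xa l r →
      (ya :+ ma :* (r :- xa)) :- (yp :+ mp :* (r :- xp)) :=
      ((ya :+ ma :* (l :- xa)) :- (yp :+ mp :* (l :- xp))) :+ (ma :- mp) :* (r :- l))
    refl (y p) (slope p q) (x p) (y a) (slope a b) (x a) l r

  -- An affine gap changing sign vanishes in between, at the proportion DL / (DL - DR) of the way.
  -- There the two segments would have a common point inside pq.
  no-descent : ∀ {p q a b l r} → Drawn p q → Drawn a b → x p < x q → x a < x b →
    x p ≤ l → x a ≤ l → l < r → r ≤ x q → r ≤ x b → ¬ (0# < gap p q a b l × gap p q a b r < 0#)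
  no-descent {p} {q} {a} {b} {l} {r} d e p<q a<b pl al l<r rq rb (DL>0 , DR<0) = go (disjoint d e
      (on-line p<q (≤-trans pl (inj₁ l<t)) (≤-trans (inj₁ t<r) rq))
      (subst (OnSeg a b) (cong (t ,_) (-≡0⇒≡ Dt≡0)) (on-line a<b (≤-trans al (inj₁ l<t)) (≤-trans (inj₁ t<r) rb))))
    where
      DL DR k S ρ t : Carrier
      DL = gap p q a b l
      DR = gap p q a b r
      k = slope a b - slope p q
      S = DL - DR
      ρ = recip S
      t = l + (r - l) * (DL * ρ)
      0<S : 0# < S
      0<S = subst (0# <_) (solve 2 (λ a b → a :+ (:0 :- b) := a :- b) refl DL DR) (0<+ DL>0 (<⇒0< DR<0))
      Sρ : S * ρ ≡ 1#
      Sρ = recip-inverse (λ z → <-irr (subst (0# <_) z 0<S))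
      0<ρ : 0# < ρ
      0<ρ = recip-positive 0<S
      l<t : l < t
      l<t = 0<-by (*-pos (<⇒0< l<r) (*-pos DL>0 0<ρ)) (solve 2 (λ l m → l :+ m :- l := m) refl l _)
      t<r : t < r
      t<r = 0<-by (*-pos (<⇒0< l<r) (*-pos (<⇒0< DR<0) 0<ρ))
        (trans (solve 4 (λ l r D ρ → r :- (l :+ (r :- l) :* (D :* ρ)) := (r :- l) :* (:1 :- D :* ρ)) refl l r DL ρ)
        (cong ((r - l) *_) (trans (cong (_- DL * ρ) (sym Sρ)) (solve 3 (λ a b ρ → (a :- b) :* ρ :- a :* ρ := (:0 :- b) :* ρ) refl DL DR ρ))))
      Dt≡0 : gap p q a b t ≡ 0#
      Dt≡0 = trans (gap-linear p q a b l t) (trans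
        (solve 5 (λ D k l r s → D :+ k :* ((l :+ (r :- l) :* s) :- l) := D :+ (k :* (r :- l)) :* s) refl DL k l r (DL * ρ))
        (trans (cong (λ z → DL + z * (DL * ρ)) (trans (solve 2 (λ D m → m := (D :+ m) :- D) refl DL (k * (r - l))) (cong (_- DL) (sym (gap-linear p q a b l r)))))
        (trans (solve 3 (λ D E ρ → D :+ (E :- D) :* (D :* ρ) := D :* (:1 :- (D :- E) :* ρ)) refl DL DR ρ)
        (trans (cong (λ z → DL * (1# - z)) Sρ) (solve 1 (λ D → D :* (:1 :- :1) := :0) refl DL)))))
      P : Point
      P = t , line p q t
      go : ((p ≡ a × q ≡ b) ⊎ (p ≡ b × q ≡ a)) ⊎ ((P ≡ p ⊎ P ≡ q) × (P ≡ a ⊎ P ≡ b)) → ⊥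
      go (inj₁ (inj₁ (refl , refl))) = absurd-by DL>0 (-‿inverseʳ (line p q l))
      go (inj₁ (inj₂ (refl , refl))) = <⇒≯ p<q a<b
      go (inj₂ (inj₁ s , _)) = <-irr (subst (_< t) (cong x (sym s)) (≤-<-trans pl l<t))
      go (inj₂ (inj₂ s , _)) = <-irr (subst (t <_) (cong x (sym s)) (<-≤-trans t<r rq))

  module _ {p q : Point} (d : Drawn p q) (p<q : x p < x q) where
    private
      -- Membership in the open strip above pq. A ray just above pq near `p` and one near `q` meet
      -- the same segments, except for those that begin or end inside the strip; this makes the two
      -- corner parities differ by a boundary.
      U : Point → Bool
      U z = does (x p <? x z) ∧ (does (x z <? x q) ∧ does (line p q (x z) <? y z))

      φ ψ : Point → Bool
      φ v = side p v xor not (before p q v)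
      ψ v = side q v xor before q v p

      fL fR : Point → Point → Bool
      fL a b = under p a b xor at p φ a b
      fR a b = under q a b xor at q ψ a b

    module _ {a b : Point} (e : Drawn a b) (a<b : x a < x b) where
      private
        D : Carrier → Carrier
        D = gap p q a b
        k : Carrier
        k = slope a b - slope p q

        under-eq : ∀ z → under z a b ≡ under⁺ z a b
        under-eq z = if-true (dec-true (x a <? x b) a<b)

        below-p : does (y p <? line a b (x p)) ≡ does (0# <? D (x p))
        below-p = does-cong (y p <? line a b (x p)) (0# <? D (x p))
          (λ r → subst (λ z → 0# < line a b (x p) - z) (sym (line-start p q)) (<⇒0< r))
          (λ r → 0<⇒< (subst (λ z → 0# < line a b (x p) - z) (line-start p q) r))

        below-q : does (y q <? line a b (x q)) ≡ does (0# <? D (x q))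
        below-q = does-cong (y q <? line a b (x q)) (0# <? D (x q))
          (λ r → subst (λ z → 0# < line a b (x q) - z) (sym (line-end p<q)) (<⇒0< r))
          (λ r → 0<⇒< (subst (λ z → 0# < line a b (x q) - z) (line-end p<q) r))

        above-a : does (line p q (x a) <? y a) ≡ does (0# <? D (x a))
        above-a = does-cong (line p q (x a) <? y a) (0# <? D (x a))
          (λ r → subst (λ z → 0# < z - line p q (x a)) (sym (line-start a b)) (<⇒0< r))
          (λ r → 0<⇒< (subst (λ z → 0# < z - line p q (x a)) (line-start a b) r))

        above-b : does (line p q (x b) <? y b) ≡ does (0# <? D (x b))
        above-b = does-cong (line p q (x b) <? y b) (0# <? D (x b))
          (λ r → subst (λ z → 0# < z - line p q (x b)) (sym (line-end a<b)) (<⇒0< r))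
          (λ r → 0<⇒< (subst (λ z → 0# < z - line p q (x b)) (line-end a<b) r))

        -- Moving `U a` to the side of `p` and `U b` to the side of `q` splits the balance into what
        -- happens where ab enters the range of pq and where it leaves it.
        Lp Rp : Bool
        Lp = (under⁺ p a b xor at p φ a b) xor U a
        Rp = (under⁺ q a b xor at q ψ a b) xor U b

        -- As a lies to the left of b, only a = p and b = q contribute to these terms.
        φ-a : does (b ≟ᵖ p) ∧ φ a ≡ false
        φ-a = go (b ≟ᵖ p)
          where
            go : (r : Dec (b ≡ p)) → does r ∧ φ a ≡ false
            go (no _) = refl
            go (yes refl) = trans (cong (_xor not (before p q a)) (side-left {p} {a} a<b)) (cong not (before-RL p<q a<b))

        ψ-b : does (a ≟ᵖ q) ∧ ψ b ≡ false
        ψ-b = go (a ≟ᵖ q)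
          where
            go : (r : Dec (a ≡ q)) → does r ∧ ψ b ≡ false
            go (no _) = refl
            go (yes refl) = cong₂ _xor_ (side-right {q} {b} a<b) (before-RL a<b p<q)

        not-at : ∀ {u v w} → u ≢ v → does (u ≟ᵖ v) ∧ w ≡ false
        not-at {u} {v} {w} ne = ∧-falseˡ w (dec-false (u ≟ᵖ v) ne)

        under-false₁ : ∀ {z} → ¬ (x a < x z) → under⁺ z a b ≡ false
        under-false₁ {z} n = ∧-falseˡ _ (dec-false (x a <? x z) n)

        under-false₂ : ∀ {z} → ¬ (x z < x b) → under⁺ z a b ≡ false
        under-false₂ {z} n = ∧-falseʳ (does (x a <? x z)) (∧-falseˡ _ (dec-false (x z <? x b) n))

        under-true : ∀ {z} → x a < x z → x z < x b → under⁺ z a b ≡ does (y z <? line a b (x z))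
        under-true {z} s t = trans (∧-trueˡ _ (dec-true (x a <? x z) s)) (∧-trueˡ _ (dec-true (x z <? x b) t))

        U-false₁ : ∀ {z} → ¬ (x p < x z) → U z ≡ false
        U-false₁ {z} n = ∧-falseˡ _ (dec-false (x p <? x z) n)

        U-false₂ : ∀ {z} → ¬ (x z < x q) → U z ≡ false
        U-false₂ {z} n = ∧-falseʳ (does (x p <? x z)) (∧-falseˡ _ (dec-false (x z <? x q) n))

        U-true : ∀ {z} → x p < x z → x z < x q → U z ≡ does (line p q (x z) <? y z)
        U-true {z} s t = trans (∧-trueˡ _ (dec-true (x p <? x z) s)) (∧-trueˡ _ (dec-true (x z <? x q) t))

        -- The left end of the common range of abscissae of pq and ab. There `Lp` says whether ab
        -- runs above pq immediately to the right; `End` is the mirror image.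
        data Start (l : Carrier) : Set where
          start : x p ≤ l → x a ≤ l → (∀ {r} → x p < r → x a < r → l < r) → Lp ≡ germ (D l) k → Start l

        data End (r : Carrier) : Set where
          end : r ≤ x q → r ≤ x b → x p < r → x a < r → Rp ≡ germ (D r) (- k) → End r

        start-of : x p < x b → x a < x q → ∃ Start
        start-of p<b a<q = go (compare (x a) (x p))
          where
            go : Tri (x a < x p) (x a ≡ x p) (x p < x a) → ∃ Start
            go (tri< a<p _ _) = x p , start ≤-refl (inj₁ a<p) (λ r _ → r)
              (only-1 (trans (under-true a<p p<b) (trans below-p (sym (germ-nonzero
                (λ z → interior d e a<p p<b (trans (-≡0⇒≡ z) (line-start p q)))))))
              (not-at (x-≢ a<p)) φ-a (U-false₁ (<⇒≯ a<p)))
            go (tri> _ _ p<a) = x a , start (inj₁ p<a) ≤-refl (λ _ r → r)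
              (only-4 (under-false₁ (<⇒≯ p<a)) (not-at (λ z → x-≢ p<a (sym z))) φ-a
                (trans (U-true p<a a<q) (trans above-a (sym (germ-nonzero
                  (λ z → interior e d p<a a<q (trans (sym (-≡0⇒≡ z)) (line-start a b))))))))
            go (tri≈ _ a=p _) = x p , start ≤-refl (inj₂ a=p) (λ r _ → r)
              (only-2 (under-false₁ (λ r → <-irr (subst (_< x p) a=p r))) at-p φ-a (U-false₁ (λ r → <-irr (subst (x p <_) a=p r))))
              where
                a≡p : a ≡ p
                a≡p = abscissa e d a=p
                at-p : does (a ≟ᵖ p) ∧ φ b ≡ germ (D (x p)) k
                at-p = go′ a≡p e a<b
                  where
                    go′ : ∀ {a} → a ≡ p → Drawn a b → x a < x b → does (a ≟ᵖ p) ∧ φ b ≡ germ (gap p q a b (x p)) (slope a b - slope p q)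
                    go′ refl e a<b = trans (∧-trueˡ (φ b) (dec-true (p ≟ᵖ p) refl))
                      (trans (cong₂ (λ s t → s xor not t) (side-right {p} {b} a<b) (before-RR p<q a<b))
                      (trans (not-not (does (slope p q <? slope p b)))
                      (trans (does-cong (slope p q <? slope p b) (0# <? slope p b - slope p q) <⇒0< 0<⇒<)
                      (sym (germ-zero (trans (cong₂ _-_ (line-start p b) (line-start p q)) (-‿inverseʳ (y p))))))))
                      where
                        not-not : ∀ s → not (not s) ≡ s
                        not-not true = refl
                        not-not false = refl

        end-of : x p < x b → x a < x q → ∃ End
        end-of p<b a<q = go (compare (x q) (x b))
          where
            go : Tri (x q < x b) (x q ≡ x b) (x b < x q) → ∃ End
            go (tri< q<b _ _) = x q , end ≤-refl (inj₁ q<b) p<q a<q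
              (only-1 (trans (under-true a<q q<b) (trans below-q (sym (germ-nonzero
                (λ z → interior (drawn-sym d) e a<q q<b (trans (-≡0⇒≡ z) (line-end p<q)))))))
              ψ-b (not-at (λ z → x-≢ q<b (sym z))) (U-false₂ (<⇒≯ q<b)))
            go (tri> _ _ b<q) = x b , end (inj₁ b<q) ≤-refl p<b a<b
              (only-4 (under-false₂ (<⇒≯ b<q)) ψ-b (not-at (x-≢ b<q))
                (trans (U-true p<b b<q) (trans above-b (sym (germ-nonzero
                  (λ z → interior (drawn-sym e) d p<b b<q (trans (sym (-≡0⇒≡ z)) (line-end a<b))))))))
            go (tri≈ _ q=b _) = x q , end ≤-refl (inj₂ q=b) p<q a<q
              (only-3 (under-false₂ (λ r → <-irr (subst (x q <_) (sym q=b) r))) ψ-b at-q (U-false₂ (λ r → <-irr (subst (_< x q) (sym q=b) r))))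
              where
                b≡q : b ≡ q
                b≡q = abscissa (drawn-sym e) (drawn-sym d) (sym q=b)
                at-q : does (b ≟ᵖ q) ∧ ψ a ≡ germ (D (x q)) (- k)
                at-q = go′ b≡q a<b
                  where
                    go′ : ∀ {b} → b ≡ q → x a < x b → does (b ≟ᵖ q) ∧ ψ a ≡ germ (gap p q a b (x q)) (- (slope a b - slope p q))
                    go′ refl a<b = trans (∧-trueˡ (ψ a) (dec-true (q ≟ᵖ q) refl))
                      (trans (cong₂ _xor_ (side-left {q} {a} a<b) (before-LL a<b p<q))
                      (trans (does-cong (slope q a <? slope q p) (0# <? - (slope a q - slope p q))
                        (λ r → subst (0# <_) flip-sign (<⇒0< (subst₂ _<_ (slope-sym a<b) (slope-sym p<q) r)))
                        (λ r → subst₂ _<_ (sym (slope-sym a<b)) (sym (slope-sym p<q)) (0<⇒< (subst (0# <_) (sym flip-sign) r))))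
                      (sym (germ-zero (trans (cong₂ _-_ (line-end a<b) (line-end p<q)) (-‿inverseʳ (y q)))))))
                      where
                        flip-sign : slope p q - slope a q ≡ - (slope a q - slope p q)
                        flip-sign = solve 2 (λ s t → s :- t := :- (t :- s)) refl (slope p q) (slope a q)

        -- With overlapping abscissae the segment ab enters and leaves the strip
        -- over pq on the same side; otherwise it does not meet the strip.
        balance⁺ : Lp ≡ Rp
        balance⁺ = go (x p <? x b) (x a <? x q)
          where
            go : Dec (x p < x b) → Dec (x a < x q) → Lp ≡ Rp
            go (yes p<b) (yes a<q) = both (start-of p<b a<q) (end-of p<b a<q)
              where
                transport : ∀ {l r} → Start l → End r → Lp ≡ Rp
                transport {l} {r} (start pl al l< eL) (end rq rb p<r a<r eR) = trans eL (trans
                  (germ-transport (<⇒0< lt) (gap-linear p q a b l r)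
                    (no-descent d e p<q a<b pl al lt rq rb)
                    (λ (s , t) → no-descent e d a<b p<q al pl lt rb rq (neg s , neg′ t)))
                  (sym eR))
                  where
                    lt : l < r
                    lt = l< p<r a<r
                    opposite : ∀ t → gap a b p q t ≡ - D t
                    opposite t = solve 2 (λ u v → u :- v := :- (v :- u)) refl (line p q t) (line a b t)
                    neg : ∀ {t} → D t < 0# → 0# < gap a b p q t
                    neg {t} s = subst (0# <_) (trans (+-identityˡ _) (sym (opposite t))) (<⇒0< s)
                    neg′ : ∀ {t} → 0# < D t → gap a b p q t < 0#
                    neg′ {t} s = 0<-by s (trans (cong (λ z → 0# - z) (opposite t)) (solve 1 (λ z → :0 :- :- z := z) refl (D t)))
                both : ∃ Start → ∃ End → Lp ≡ Rp
                both (_ , s) (_ , t) = transport s t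
            go (no p≮b) _ = trans (only-1 (under-false₂ p≮b) (not-at (λ { refl → p≮b a<b })) φ-a (U-false₁ (λ r → p≮b (<-trans r a<b))))
              (sym (only-1 (under-false₂ (λ r → p≮b (<-trans p<q r))) ψ-b (not-at (λ { refl → p≮b p<q })) (U-false₁ p≮b)))
            go (yes _) (no a≮q) = trans (only-1 (under-false₁ (λ r → a≮q (<-trans r p<q))) (not-at (λ { refl → a≮q p<q })) φ-a (U-false₂ a≮q))
              (sym (only-1 (under-false₁ a≮q) ψ-b (not-at (λ { refl → a≮q a<b })) (U-false₂ (λ r → a≮q (<-trans a<b r)))))

      balance-< : fL a b xor fR a b ≡ U a xor U b
      balance-< = rearrange (fL a b) (fR a b) (U a) (U b)
        (trans (cong (λ u → (u xor at p φ a b) xor U a) (under-eq p)) (trans balance⁺ (cong (λ u → (u xor at q ψ a b) xor U b) (sym (under-eq q)))))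
        where
          rearrange : ∀ s t u v → s xor u ≡ t xor v → s xor t ≡ u xor v
          rearrange s t u v e = xor-cancel (trans (interchange s t u v) (trans (cong (_xor (t xor v)) e) (xor-same (t xor v))))

    private
      balance : ∀ {a b} → Drawn a b → fL a b xor fR a b ≡ U a xor U b
      balance {a} {b} e = go (sides e)
        where
          at-comm : ∀ z χ → at z χ a b ≡ at z χ b a
          at-comm z χ = xor-comm (does (a ≟ᵖ z) ∧ χ b) (does (b ≟ᵖ z) ∧ χ a)
          under-comm : ∀ z → x b < x a → under z a b ≡ under z b a
          under-comm z lt = trans (if-false (dec-false (x a <? x b) (<⇒≯ lt))) (sym (if-true (dec-true (x b <? x a) lt)))
          go : x a < x b ⊎ x b < x a → fL a b xor fR a b ≡ U a xor U b
          go (inj₁ lt) = balance-< e lt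
          go (inj₂ lt) = trans (cong₂ _xor_ (cong₂ _xor_ (under-comm p lt) (at-comm p φ)) (cong₂ _xor_ (under-comm q lt) (at-comm q ψ)))
            (trans (balance-< (drawn-sym e) lt) (xor-comm (U b) (U a)))

    left-flip : ∀ {z} (c : Chain z z) → left p q c ≡ right q p c
    left-flip = tally-closed U balance

  -- For a segment pointing left, the strip argument relates the two corners below it. Each differs
  -- from the wanted corner above by the number of uses of pq, and these cancel.
  flip : ∀ {p q} → Drawn p q → ∀ {z} (c : Chain z z) → left p q c ≡ right q p c
  flip {p} {q} d c = go (sides d)
    where
      go : x p < x q ⊎ x q < x p → left p q c ≡ right q p c
      go (inj₁ lt) = left-flip d lt c
      go (inj₂ lt) = trans (left-right d c) (trans (cong₂ _xor_ (sym (left-flip (drawn-sym d) lt c)) (tally-cong uses-comm c))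
          (trans (cong (_xor tally (uses q p) c) (left-right (drawn-sym d) c)) (cancel (right q p c) (tally (uses q p) c))))
        where
          cancel : ∀ s t → (s xor t) xor t ≡ s
          cancel s t = trans (xor-assoc s t t) (trans (cong (s xor_) (xor-same t)) (xor-identityʳ s))
          uses-comm : ∀ {a b} → Drawn a b → uses p q a b ≡ uses q p a b
          uses-comm {a} {b} _ = trans (xor-comm (does (a ≟ᵖ p) ∧ does (b ≟ᵖ q)) (does (b ≟ᵖ p) ∧ does (a ≟ᵖ q)))
            (cong₂ _xor_ (∧-comm (does (b ≟ᵖ p)) _) (∧-comm (does (a ≟ᵖ p)) _))

  infix 4 _∈ᵇ_
  _∈ᵇ_ : Point → List Point → Bool
  b ∈ᵇ S = does (Any.any? (b ≟ᵖ_) S)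

  Sorted : Point → List Point → Set
  Sorted z = AllPairs (λ b q → before z b q ≡ true)

  module Around {z : Point} {qs : List Point} (sorted : Sorted z qs) (drawn : ∀ {b} → b ∈ qs → Drawn z b)
    (complete : ∀ {b} → Drawn z b → b ∈ qs) where

    private
      asym : ∀ {b q} → before z b q ≡ true → before z q b ≡ false
      asym {b} {q} e = go (before z q b) refl
        where
          go : ∀ s → before z q b ≡ s → s ≡ false
          go false _ = refl
          go true e' with () ← trans (sym (before-irrefl z b)) (before-trans z b q b e e')

      ∈ᵇ-true : ∀ {b S} → b ∈ S → (b ∈ᵇ S) ≡ true
      ∈ᵇ-true {b} {S} p = dec-true (Any.any? (b ≟ᵖ_) S) p

      ∈ᵇ-false : ∀ {b S} → b ∉ S → (b ∈ᵇ S) ≡ false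
      ∈ᵇ-false {b} {S} p = dec-false (Any.any? (b ≟ᵖ_) S) p

    module _ pre {q post} (split : qs ≡ pre ++ q ∷ post) where
      private
        parts = AllPairs-++⁻ pre (subst (Sorted z) split sorted)
        earlier : ∀ {b} → b ∈ pre → before z b q ≡ true
        earlier p = All.lookup (All.lookup (proj₂ (proj₂ parts)) p) (here refl)
        later : ∀ {b} → b ∈ post → before z q b ≡ true
        later p = All.lookup (head (proj₁ (proj₂ parts))) p
          where
            head : ∀ {R : Point → Point → Set} {y ys} → AllPairs R (y ∷ ys) → All (R y) ys
            head (a ∷ _) = a
        absurd : ∀ {s} → s ≡ true → s ≡ false → ⊥
        absurd refl ()
        after∉ : ∀ {b} → before z q b ≡ true → b ∉ pre
        after∉ e p = absurd e (asym (earlier p))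

      right-corner : ∀ {r} (c : Chain r r) → right z q c ≡ corner (_∈ᵇ pre) z c
      right-corner c = corner-cong {z} (λ {b} d → go (∈-++⁻ pre (subst (b ∈_) split (complete d)))) c
        where
          go : ∀ {b} → b ∈ pre ⊎ b ∈ q ∷ post → before z b q ≡ (b ∈ᵇ pre)
          go (inj₁ p) = trans (earlier p) (sym (∈ᵇ-true p))
          go (inj₂ (here refl)) = trans (before-irrefl z q) (sym (∈ᵇ-false (λ p → absurd (earlier p) (before-irrefl z q))))
          go (inj₂ (there p)) = trans (asym (later p)) (sym (∈ᵇ-false (after∉ (later p))))

      left-corner : ∀ {r} (c : Chain r r) → left z q c ≡ corner (_∈ᵇ (pre ++ [ q ])) z c
      left-corner c = corner-cong {z} (λ {b} d → go (∈-++⁻ pre (subst (b ∈_) split (complete d)))) c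
        where
          go : ∀ {b} → b ∈ pre ⊎ b ∈ q ∷ post → not (before z q b) ≡ (b ∈ᵇ (pre ++ [ q ]))
          go (inj₁ p) = trans (cong not (asym (earlier p))) (sym (∈ᵇ-true (∈-++⁺ˡ p)))
          go (inj₂ (here refl)) = trans (cong not (before-irrefl z q)) (sym (∈ᵇ-true (∈-++⁺ʳ pre (here refl))))
          go (inj₂ (there p)) = trans (cong not (later p)) (sym (∈ᵇ-false (λ m → either (after∉ (later p))
            (λ { (here refl) → absurd (later p) (before-irrefl z q) }) (∈-++⁻ pre m))))

    corner-closes : ∀ {r} (c : Chain r r) → corner (_∈ᵇ qs) z c ≡ corner (_∈ᵇ []) z c
    corner-closes c = trans (corner-cong {z} (λ d → ∈ᵇ-true (complete d)) c) (corner-around z c)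

  -- With only two directions at `z`, the corner after `q` is the corner before `r`. If `r` comes
  -- first in the order, this corner contains straight down, so its two descriptions differ by a
  -- full turn.
  bend : ∀ {z q r} → Drawn z q → Drawn z r → q ≢ r → (∀ {b} → Drawn z b → b ≡ q ⊎ b ≡ r) →
    ∀ {s} (c : Chain s s) → left z q c ≡ right z r c
  bend {z} {q} {r} d e ne only c = go (before z q r) refl
    where
      other : ∀ {s} → before z q r ≡ s → before z r q ≡ not s
      other eq = trans (before-total e d (ne ∘ sym)) (cong not eq)
      go : ∀ s → before z q r ≡ s → left z q c ≡ right z r c
      go true eq = corner-cong {z} (λ d' → pick (only d')) c
        where
          pick : ∀ {b} → b ≡ q ⊎ b ≡ r → not (before z q b) ≡ before z b r
          pick (inj₁ refl) = trans (cong not (before-irrefl z q)) (sym eq)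
          pick (inj₂ refl) = trans (cong not eq) (sym (before-irrefl z r))
      go false eq = trans (corner-cong {z} (λ d' → all (only d')) c) (trans (corner-around z c) (corner-cong {z} (λ d' → none (only d')) c))
        where
          all : ∀ {b} → b ≡ q ⊎ b ≡ r → not (before z q b) ≡ true
          all (inj₁ refl) = cong not (before-irrefl z q)
          all (inj₂ refl) = cong not eq
          none : ∀ {b} → b ≡ q ⊎ b ≡ r → false ≡ before z b r
          none (inj₁ refl) = sym eq
          none (inj₂ refl) = sym (before-irrefl z r)

-- From a drawing to its rotation system

uip : ∀ {A : Set} {a b : A} (p q : a ≡ b) → p ≡ q
uip refl refl = refl

second : ∀ {A : Set} → List A → A → A
second [] b = b
second (c ∷ _) _ = c

penultimate : ∀ {A : Set} → A → List A → A
penultimate a [] = a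
penultimate _ (c ∷ cs) = penultimate c cs

module Curves (ℝ : RealField) where
  open OrderedField ℝ
  open Geometry ℝ
  open Incidence ℝ

  Segment : Set
  Segment = Point × Point

  On : Segment → Point → Set
  On s z = OnSeg (proj₁ s) (proj₂ s) z

  End : Segment → Point → Set
  End s z = z ≡ proj₁ s ⊎ z ≡ proj₂ s

  simple-tail : ∀ {p q ps} → Simple (p ∷ q ∷ ps) → Simple (q ∷ ps)
  simple-tail s i j lt z on on' = let (e , f) = s (Fin.suc i) (Fin.suc j) (s≤s lt) z on on' in ℕ.suc-injective e , f

  private
    first-index : ∀ {q r ps} (j : Fin (length (segs (q ∷ r ∷ ps)))) → Fin.toℕ j ≡ 0 → proj₁ (lookup (segs (q ∷ r ∷ ps)) j) ≡ q
    first-index Fin.zero _ = refl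

  simple-segments : ∀ ps → Simple ps → ∀ {s t z} → s ∈ segs ps → t ∈ segs ps → On s z → On t z → s ≡ t ⊎ (End s z × End t z)
  simple-segments (p ∷ q ∷ ps) simple (here refl) (here refl) _ _ = inj₁ refl
  simple-segments (p ∷ q ∷ ps) simple (there s∈) (there t∈) on on' = simple-segments (q ∷ ps) (simple-tail simple) s∈ t∈ on on'
  simple-segments (p ∷ q ∷ ps) simple (here refl) (there t∈) on on' = inj₂ (meeting ps simple t∈ on on')
    where
      meeting : ∀ ps {t z} → Simple (p ∷ q ∷ ps) → t ∈ segs (q ∷ ps) → OnSeg p q z → On t z → End (p , q) z × End t z
      meeting (r ∷ ps) {t} {z} simple t∈ on on' = inj₂ (proj₂ adjacent) , inj₁ (trans (proj₂ adjacent) (sym start))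
        where
          j = Any.index t∈
          t≡ : t ≡ lookup (segs (q ∷ r ∷ ps)) j
          t≡ = Any.lookup-index t∈
          adjacent = simple Fin.zero (Fin.suc j) (s≤s z≤n) z on (subst (λ t → On t z) t≡ on')
          start : proj₁ t ≡ q
          start = trans (cong proj₁ t≡) (first-index j (ℕ.suc-injective (proj₁ adjacent)))
  simple-segments (p ∷ q ∷ ps) simple (there s∈) (here refl) on on'
    = either (inj₁ ∘ sym) (λ (a , b) → inj₂ (b , a)) (simple-segments (p ∷ q ∷ ps) simple (here refl) (there s∈) on' on)

  ends-segment : ∀ {q ps z} → z ∈ ps → ∃ λ s → s ∈ segs (q ∷ ps) × proj₂ s ≡ z
  ends-segment {q} {p ∷ ps} (here refl) = (q , p) , here refl , refl
  ends-segment {q} {p ∷ ps} (there m) with ends-segment {p} m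
  ... | s , s∈ , e = s , there s∈ , e

  -- A repeated starting point would be the end of a later segment; simplicity then makes it the end
  -- of the first segment too, which is nondegenerate.
  simple-unique : ∀ ps → Simple ps → NonDegenerate ps → Unique ps
  simple-unique [] _ _ = []
  simple-unique (p ∷ []) _ _ = [] ∷ []
  simple-unique (p ∷ q ∷ ps) simple (p≢q ∷ nondeg) = All.tabulate (λ { (here refl) → p≢q ; (there m) refl → later m }) ∷ simple-unique (q ∷ ps) (simple-tail simple) nondeg
    where
      later : p ∉ ps
      later m = absurd (ends-segment {q} m)
        where
          absurd : (∃ λ s → s ∈ segs (q ∷ ps) × proj₂ s ≡ p) → ⊥
          absurd ((r , _) , s∈ , refl) = p≢q (proj₂ (simple Fin.zero (Fin.suc (Any.index s∈)) (s≤s z≤n) p (OnSeg-left p q)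
            (subst (λ t → On t p) (Any.lookup-index s∈) (OnSeg-right r p))))

  segment-ends : ∀ ps {s} → s ∈ segs ps → proj₁ s ∈ ps × proj₂ s ∈ ps
  segment-ends (p ∷ q ∷ ps) (here refl) = here refl , there (here refl)
  segment-ends (p ∷ q ∷ ps) (there m) = let (a , b) = segment-ends (q ∷ ps) m in there a , there b

  segment-end∈tail : ∀ {p} ps {s} → s ∈ segs (p ∷ ps) → proj₂ s ∈ ps
  segment-end∈tail (q ∷ ps) (here refl) = here refl
  segment-end∈tail (q ∷ ps) (there m) = there (segment-end∈tail ps m)

  next-unique : ∀ ps → Unique ps → ∀ {c d d'} → (c , d) ∈ segs ps → (c , d') ∈ segs ps → d ≡ d'
  next-unique (p ∷ q ∷ ps) u (here refl) (here refl) = refl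
  next-unique (p ∷ q ∷ ps) (p∉ ∷ _) (here refl) (there m) = contradiction refl (All.lookup p∉ (proj₁ (segment-ends (q ∷ ps) m)))
  next-unique (p ∷ q ∷ ps) (p∉ ∷ _) (there m) (here refl) = contradiction refl (All.lookup p∉ (proj₁ (segment-ends (q ∷ ps) m)))
  next-unique (p ∷ q ∷ ps) (_ ∷ u) (there m) (there m') = next-unique (q ∷ ps) u m m'

  previous-unique : ∀ ps → Unique ps → ∀ {c d d'} → (d , c) ∈ segs ps → (d' , c) ∈ segs ps → d ≡ d'
  previous-unique (p ∷ q ∷ ps) u (here refl) (here refl) = refl
  previous-unique (p ∷ q ∷ ps) (_ ∷ (q∉ ∷ _)) (here refl) (there m) = contradiction refl (All.lookup q∉ (segment-end∈tail ps m))
  previous-unique (p ∷ q ∷ ps) (_ ∷ (q∉ ∷ _)) (there m) (here refl) = contradiction refl (All.lookup q∉ (segment-end∈tail ps m))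
  previous-unique (p ∷ q ∷ ps) (_ ∷ u) (there m) (there m') = previous-unique (q ∷ ps) u m m'

  second-segment∈ : ∀ a bs b → (a , second bs b) ∈ segs (a ∷ bs ++ [ b ])
  second-segment∈ a [] b = here refl
  second-segment∈ a (c ∷ cs) b = here refl

  last-segment∈ : ∀ a bs b → (penultimate a bs , b) ∈ segs (a ∷ bs ++ [ b ])
  last-segment∈ a [] b = here refl
  last-segment∈ a (c ∷ cs) b = there (last-segment∈ c cs b)

  no-return : ∀ a bs b → Unique (a ∷ bs ++ [ b ]) → ∀ {d} → (d , a) ∉ segs (a ∷ bs ++ [ b ])
  no-return a bs b (a∉ ∷ _) m = contradiction refl (All.lookup a∉ (segment-end∈tail (bs ++ [ b ]) m))

  no-exit : ∀ a bs b → Unique (a ∷ bs ++ [ b ]) → ∀ {d} → (b , d) ∉ segs (a ∷ bs ++ [ b ])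
  no-exit a [] b (a∉ ∷ _) (here refl) = contradiction refl (All.lookup a∉ (here refl))
  no-exit a (c ∷ cs) b (a∉ ∷ _) (here refl) = contradiction refl (All.lookup a∉ (∈-++⁺ʳ (c ∷ cs) (here refl)))
  no-exit a (c ∷ cs) b (_ ∷ u) (there m) = no-exit c cs b u m

  on-poly : ∀ ps {s z} → s ∈ segs ps → On s z → OnPoly ps z
  on-poly ps s∈ on = lose s∈ on

  point-on-poly : ∀ a bs b {z} → z ∈ a ∷ bs ++ [ b ] → OnPoly (a ∷ bs ++ [ b ]) z
  point-on-poly a bs b (here refl) = on-poly _ (second-segment∈ a bs b) (OnSeg-left a (second bs b))
  point-on-poly a bs b (there m) with ends-segment {a} m
  ... | (r , _) , s∈ , refl = on-poly _ s∈ (OnSeg-right r _)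

module PlaneGraph (ℝ : RealField) {n : ℕ} (G : Graph n) {k : ℕ} (D : Geometry.Drawing ℝ G k) where
  open OrderedField ℝ
  open Geometry ℝ
  open Incidence ℝ
  open Curves ℝ
  open Drawing D
  open Layouts G using (V; _~_; ~-sym; ~-irrefl)

  edge-≡ : ∀ {e f : Edge G} → proj₁ e ≡ proj₁ f → e ≡ f
  edge-≡ {_ , lt , p} {_ , lt' , q} refl = cong₂ (λ a b → _ , a , b) (ℕ.<-irrelevant lt lt') (uip p q)

  _≟ᵉ_ : (e f : Edge G) → Dec (proj₁ e ≡ proj₁ f)
  e ≟ᵉ f = ≡-dec Fin._≟_ Fin._≟_ (proj₁ e) (proj₁ f)

  curve-unique : ∀ e → Unique (curve e)
  curve-unique e = simple-unique (curve e) (simple e) (nondeg e)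

  IsEnd : V → Edge G → Set
  IsEnd w e = w ≡ src G e ⊎ w ≡ tgt G e

  on-curve-end : ∀ e w → OnPoly (curve e) (pos w) → IsEnd w e
  on-curve-end e w on = go (w Fin.≟ src G e) (w Fin.≟ tgt G e)
    where
      go : Dec (w ≡ src G e) → Dec (w ≡ tgt G e) → IsEnd w e
      go (yes p) _ = inj₁ p
      go (no _) (yes q) = inj₂ q
      go (no p) (no q) = ⊥-elim (avoids e w p q on)

  end-of-segment : ∀ e {w s} → IsEnd w e → s ∈ segs (curve e) → On s (pos w) → End s (pos w)
  end-of-segment e {w} {s} (inj₁ refl) s∈ on =
    finish (simple-segments (curve e) (simple e) s∈ (second-segment∈ (pos w) (bends e) _) on (OnSeg-left _ _))
    where
      finish : ∀ {t} → s ≡ (pos w , t) ⊎ (End s (pos w) × End (pos w , t) (pos w)) → End s (pos w)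
      finish (inj₁ refl) = inj₁ refl
      finish (inj₂ (p , _)) = p
  end-of-segment e {w} {s} (inj₂ refl) s∈ on =
    finish (simple-segments (curve e) (simple e) s∈ (last-segment∈ _ (bends e) (pos w)) on (OnSeg-right _ _))
    where
      finish : ∀ {t} → s ≡ (t , pos w) ⊎ (End s (pos w) × End (t , pos w) (pos w)) → End s (pos w)
      finish (inj₁ refl) = inj₂ refl
      finish (inj₂ (p , _)) = p

  -- `noncrossing` yields an end of one of the two edges, and `avoids` makes that vertex an end of
  -- the other edge as well.
  common : ∀ {e f z} → proj₁ e ≢ proj₁ f → OnPoly (curve e) z → OnPoly (curve f) z → ∃ λ w → z ≡ pos w × IsEnd w e × IsEnd w f
  common {e} {f} {z} ne p q = go (noncrossing e f ne z p q)
    where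
      at-e : ∀ w → IsEnd w e → z ≡ pos w → ∃ λ w → z ≡ pos w × IsEnd w e × IsEnd w f
      at-e w i eq = w , eq , i , on-curve-end f w (subst (OnPoly (curve f)) eq q)
      at-f : ∀ w → IsEnd w f → z ≡ pos w → ∃ λ w → z ≡ pos w × IsEnd w e × IsEnd w f
      at-f w i eq = w , eq , on-curve-end e w (subst (OnPoly (curve e)) eq p) , i
      go : (z ≡ pos (src G e) ⊎ z ≡ pos (tgt G e)) ⊎ (z ≡ pos (src G f) ⊎ z ≡ pos (tgt G f)) → ∃ λ w → z ≡ pos w × IsEnd w e × IsEnd w f
      go (inj₁ (inj₁ eq)) = at-e _ (inj₁ refl) eq
      go (inj₁ (inj₂ eq)) = at-e _ (inj₂ refl) eq
      go (inj₂ (inj₁ eq)) = at-f _ (inj₁ refl) eq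
      go (inj₂ (inj₂ eq)) = at-f _ (inj₂ refl) eq

  segments-disjoint : ∀ {e f s t z} → s ∈ segs (curve e) → t ∈ segs (curve f) → On s z → On t z → s ≡ t ⊎ (End s z × End t z)
  segments-disjoint {e} {f} {s} {t} {z} s∈ t∈ on on' = go (e ≟ᵉ f)
    where
      go : Dec (proj₁ e ≡ proj₁ f) → s ≡ t ⊎ (End s z × End t z)
      go (yes eq) = simple-segments (curve e) (simple e) s∈ (subst (λ f → t ∈ segs (curve f)) (sym (edge-≡ eq)) t∈) on on'
      go (no ne) = finish (common {e} {f} ne (on-poly (curve e) s∈ on) (on-poly (curve f) t∈ on'))
        where
          finish : (∃ λ w → z ≡ pos w × IsEnd w e × IsEnd w f) → s ≡ t ⊎ (End s z × End t z)
          finish (w , eq , i , j) = inj₂ (subst (End s) (sym eq) (end-of-segment e i s∈ (subst (On s) eq on))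
                                        , subst (End t) (sym eq) (end-of-segment f j t∈ (subst (On t) eq on')))

  bend-not-vertex : ∀ e {w} → pos w ∉ bends e
  bend-not-vertex e {w} m = go (on-curve-end e w (point-on-poly _ (bends e) _ (there (∈-++⁺ˡ m)))) (curve-unique e)
    where
      go : IsEnd w e → Unique (curve e) → ⊥
      go (inj₁ refl) (p ∷ _) = All.lookup p (∈-++⁺ˡ m) refl
      go (inj₂ refl) (_ ∷ u) = proj₂ (proj₂ (Unique-++⁻ (bends e) u)) m (here refl)

  data Drawn₀ (p q : Point) : Set where
    forth : ∀ e → (p , q) ∈ segs (curve e) → Drawn₀ p q
    back : ∀ e → (q , p) ∈ segs (curve e) → Drawn₀ p q

  drawn₀-sym : ∀ {p q} → Drawn₀ p q → Drawn₀ q p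
  drawn₀-sym (forth e m) = back e m
  drawn₀-sym (back e m) = forth e m

  segment-≢ : ∀ e {p q} → (p , q) ∈ segs (curve e) → p ≢ q
  segment-≢ e m = All.lookup (nondeg e) m

  drawn₀-≢ : ∀ {p q} → Drawn₀ p q → p ≢ q
  drawn₀-≢ (forth e m) = segment-≢ e m
  drawn₀-≢ (back e m) = segment-≢ e m ∘ sym

  -- Curves of different edges share only positions of vertices, so every segment at a bend belongs
  -- to the same curve, where predecessor and successor are unique.
  at-bend : ∀ e {a c b d} → c ∈ bends e → (a , c) ∈ segs (curve e) → (c , b) ∈ segs (curve e) → Drawn₀ c d → d ≡ b ⊎ d ≡ a
  at-bend e {a} {c} {b} {d} c∈ ac cb dr = go dr
    where
      same : ∀ f → OnPoly (curve f) c → proj₁ f ≡ proj₁ e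
      same f on = decide (f ≟ᵉ e)
        where
          decide : Dec (proj₁ f ≡ proj₁ e) → proj₁ f ≡ proj₁ e
          decide (yes eq) = eq
          decide (no ne) = absurd (common {f} {e} ne on (point-on-poly _ (bends e) _ (there (∈-++⁺ˡ c∈))))
            where
              absurd : (∃ λ w → c ≡ pos w × IsEnd w f × IsEnd w e) → proj₁ f ≡ proj₁ e
              absurd (w , refl , _) = ⊥-elim (bend-not-vertex e c∈)
      go : Drawn₀ c d → d ≡ b ⊎ d ≡ a
      go (forth f m) = inj₁ (next-unique (curve e) (curve-unique e)
        (subst (λ f → (c , d) ∈ segs (curve f)) (edge-≡ (same f (on-poly (curve f) m (OnSeg-left c d)))) m) cb)
      go (back f m) = inj₂ (previous-unique (curve e) (curve-unique e)
        (subst (λ f → (d , c) ∈ segs (curve f)) (edge-≡ (same f (on-poly (curve f) m (OnSeg-right d c)))) m) ac)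

  edge : ∀ {u v} → u ~ v → Fin.toℕ u ℕ.< Fin.toℕ v → Edge G
  edge {u} {v} p lt = (u , v) , lt , p

  data Oriented (u v : V) (p : u ~ v) : Set where
    up : Fin.toℕ u ℕ.< Fin.toℕ v → Oriented u v p
    down : Fin.toℕ v ℕ.< Fin.toℕ u → Oriented u v p

  orientation : ∀ {u v} (p : u ~ v) → Oriented u v p
  orientation {u} {v} p with ℕ.<-cmp (Fin.toℕ u) (Fin.toℕ v)
  ... | tri< lt _ _ = up lt
  ... | tri> _ _ lt = down lt
  ... | tri≈ _ e _ = ⊥-elim (~-irrefl (subst (u ~_) (sym (Fin.toℕ-injective e)) p))

  -- The first point after u on the curve of uv.
  leaving : ∀ {u v} (p : u ~ v) → Oriented u v p → Point
  leaving {u} {v} p (up lt) = second (bends (edge p lt)) (pos v)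
  leaving {u} {v} p (down lt) = penultimate (pos v) (bends (edge (~-sym p) lt))

  leaving-irrelevant : ∀ {u v} (p q : u ~ v) o o' → leaving p o ≡ leaving q o'
  leaving-irrelevant {v = v} p q (up lt) (up lt') =
    cong (λ e → second (bends e) (pos v)) (edge-≡ {edge p lt} {edge q lt'} refl)
  leaving-irrelevant p q (up lt) (down lt') = ⊥-elim (ℕ.<-asym lt lt')
  leaving-irrelevant p q (down lt) (up lt') = ⊥-elim (ℕ.<-asym lt lt')
  leaving-irrelevant {v = v} p q (down lt) (down lt') =
    cong (λ e → penultimate (pos v) (bends e)) (edge-≡ {edge (~-sym p) lt} {edge (~-sym q) lt'} refl)

  leaving-drawn : ∀ {u v} (p : u ~ v) o → Drawn₀ (pos u) (leaving p o)
  leaving-drawn p (up lt) = forth (edge p lt) (second-segment∈ _ (bends (edge p lt)) _)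
  leaving-drawn p (down lt) = back (edge (~-sym p) lt) (last-segment∈ _ (bends (edge (~-sym p) lt)) _)

  leaving-on : ∀ {u v} (p : u ~ v) o → ∃ λ e → OnPoly (curve e) (leaving p o) × (∀ {w} → IsEnd w e → w ≡ u ⊎ w ≡ v) × IsEnd u e × IsEnd v e
  leaving-on p (up lt) = edge p lt , on-poly _ (second-segment∈ _ (bends (edge p lt)) _) (OnSeg-right _ _) , id , inj₁ refl , inj₂ refl
  leaving-on p (down lt) = edge (~-sym p) lt , on-poly _ (last-segment∈ _ (bends (edge (~-sym p) lt)) _) (OnSeg-left _ _)
    , either inj₂ inj₁ , inj₂ refl , inj₁ refl

  -- If the curves of two different edges leave `u` for the same point, that point is the position
  -- of a common end of both. It is not `u`, so it is the other end of each.
  leaving-injective : ∀ {u v w} (p : u ~ v) (q : u ~ w) o o' → leaving p o ≡ leaving q o' → v ≡ w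
  leaving-injective {u} {v} {w} p q o o' eq = go (leaving-on p o) (leaving-on q o')
    where
      z = leaving p o
      On-curve : ∀ {u v} → Point → Set
      On-curve {u} {v} z = ∃ λ e → OnPoly (curve e) z × (∀ {w} → IsEnd w e → w ≡ u ⊎ w ≡ v) × IsEnd u e × IsEnd v e
      v≢u : v ≢ u
      v≢u refl = ~-irrefl p
      w≢u : w ≢ u
      w≢u refl = ~-irrefl q
      other : ∀ {a b} → a ≢ u → b ≢ u → ∀ {t} → pos t ≢ pos u → t ≡ u ⊎ t ≡ a → t ≡ u ⊎ t ≡ b → a ≡ b
      other _ _ ne (inj₁ refl) _ = contradiction refl ne
      other _ _ ne (inj₂ _) (inj₁ refl) = contradiction refl ne
      other _ _ ne (inj₂ refl) (inj₂ refl) = refl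
      go : On-curve {u} {v} z → On-curve {u} {w} (leaving q o') → v ≡ w
      go (e , on , only , _ , ve) (f , on' , only' , _) = decide (e ≟ᵉ f)
        where
          decide : Dec (proj₁ e ≡ proj₁ f) → v ≡ w
          decide (yes same) = either (λ r → contradiction r v≢u) id (only' (subst (IsEnd v) (edge-≡ {e} {f} same) ve))
          decide (no ne) = finish (common {e} {f} ne on (subst (OnPoly (curve f)) (sym eq) on'))
            where
              finish : (∃ λ t → z ≡ pos t × IsEnd t e × IsEnd t f) → v ≡ w
              finish (t , zt , te , tf) = other v≢u w≢u (λ r → drawn₀-≢ (leaving-drawn p o) (sym (trans zt r))) (only te) (only' tf)

  at-vertex : ∀ {u b} → Drawn₀ (pos u) b → ∃ λ v → Σ (u ~ v) λ p → ∀ o → b ≡ leaving p o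
  at-vertex {u} {b} (forth e@((s , t) , lt , p) m) = go (on-curve-end e u (on-poly (curve e) m (OnSeg-left _ _)))
    where
      go : IsEnd u e → ∃ λ v → Σ (u ~ v) λ p → ∀ o → b ≡ leaving p o
      go (inj₁ refl) = t , p , λ o → trans (next-unique (curve e) (curve-unique e) m (second-segment∈ _ (bends e) _)) (leaving-irrelevant p p (up lt) o)
      go (inj₂ refl) = ⊥-elim (no-exit _ (bends e) _ (curve-unique e) m)
  at-vertex {u} {b} (back e@((s , t) , lt , p) m) = go (on-curve-end e u (on-poly (curve e) m (OnSeg-right _ _)))
    where
      go : IsEnd u e → ∃ λ v → Σ (u ~ v) λ p → ∀ o → b ≡ leaving p o
      go (inj₁ refl) = ⊥-elim (no-return _ (bends e) _ (curve-unique e) m)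
      go (inj₂ refl) = s , ~-sym p , λ o → trans (previous-unique (curve e) (curve-unique e) m (last-segment∈ _ (bends e) _))
        (trans (cong (λ f → penultimate (pos s) (bends f)) (edge-≡ {e} {edge (~-sym (~-sym p)) lt} refl)) (leaving-irrelevant (~-sym p) (~-sym p) (down lt) o))

-- Sorting by a Boolean relation

module InsertionSort {A : Set} (r : A → A → Bool) where

  insert : A → List A → List A
  insert x [] = x ∷ []
  insert x (y ∷ ys) = if r x y then x ∷ y ∷ ys else y ∷ insert x ys

  sort : List A → List A
  sort = foldr insert []

  ∈-insert⁺ : ∀ {x z} ys → z ≡ x ⊎ z ∈ ys → z ∈ insert x ys
  ∈-insert⁺ [] (inj₁ refl) = here refl
  ∈-insert⁺ {x} (y ∷ ys) m with r x y
  ... | true = either (λ { refl → here refl }) there m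
  ... | false with m
  ... | inj₁ e = there (∈-insert⁺ ys (inj₁ e))
  ... | inj₂ (here e) = here e
  ... | inj₂ (there p) = there (∈-insert⁺ ys (inj₂ p))

  ∈-insert⁻ : ∀ {x z} ys → z ∈ insert x ys → z ≡ x ⊎ z ∈ ys
  ∈-insert⁻ [] (here e) = inj₁ e
  ∈-insert⁻ {x} (y ∷ ys) m with r x y
  ∈-insert⁻ (y ∷ ys) (here e) | true = inj₁ e
  ∈-insert⁻ (y ∷ ys) (there m) | true = inj₂ m
  ∈-insert⁻ (y ∷ ys) (here e) | false = inj₂ (here e)
  ∈-insert⁻ (y ∷ ys) (there m) | false = either inj₁ (inj₂ ∘ there) (∈-insert⁻ ys m)

  ∈-sort⁺ : ∀ {z} xs → z ∈ xs → z ∈ sort xs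
  ∈-sort⁺ (x ∷ xs) (here e) = ∈-insert⁺ (sort xs) (inj₁ e)
  ∈-sort⁺ (x ∷ xs) (there m) = ∈-insert⁺ (sort xs) (inj₂ (∈-sort⁺ xs m))

  ∈-sort⁻ : ∀ {z} xs → z ∈ sort xs → z ∈ xs
  ∈-sort⁻ (x ∷ xs) m = either here (there ∘ ∈-sort⁻ xs) (∈-insert⁻ (sort xs) m)

  R : A → A → Set
  R a b = r a b ≡ true

  module _ (transitive : ∀ a b c → R a b → R b c → R a c) where
    insert-sorted : ∀ x ys → (∀ {y} → y ∈ ys → r x y ≡ false → R y x) → AllPairs R ys → AllPairs R (insert x ys)
    insert-sorted x [] _ _ = [] ∷ []
    insert-sorted x (y ∷ ys) total (a ∷ as) with r x y in eq
    ... | true = (eq ∷ All.map (λ {z} → transitive x y z eq) a) ∷ a ∷ as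
    ... | false = All.tabulate (λ m → either (λ { refl → total (here refl) eq }) (All.lookup a) (∈-insert⁻ ys m))
                ∷ insert-sorted x ys (total ∘ there) as

    -- Totality is asked of distinct members only, since `before` is irreflexive and compares only
    -- directions of drawn segments.
    sort-sorted : ∀ xs → Unique xs → (∀ {x y} → x ∈ xs → y ∈ xs → x ≢ y → r x y ≡ false → R y x) → AllPairs R (sort xs)
    sort-sorted [] _ _ = []
    sort-sorted (x ∷ xs) (x∉ ∷ u) total = insert-sorted x (sort xs)
      (λ m → total (here refl) (there (∈-sort⁻ xs m)) (All.lookup x∉ (∈-sort⁻ xs m)))
      (sort-sorted xs u (λ p q → total (there p) (there q)))

-- Shearing to distinct abscissae

module Shear (ℝ : RealField) where
  open OrderedField ℝ
  open Geometry ℝ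
  open Lines ℝ using (recip; recip-inverse)

  upper-bound : ∀ xs → ∃ λ m → ∀ {a} → a ∈ xs → a < m
  upper-bound [] = 0# , λ ()
  upper-bound (x ∷ xs) = go (upper-bound xs)
    where
      x<x+1 : ∀ a → a < a + 1#
      x<x+1 a = 0<-by 0<1 (solve 1 (λ a → a :+ :1 :- a := :1) refl a)
      go : (∃ λ m → ∀ {a} → a ∈ xs → a < m) → ∃ λ m → ∀ {a} → a ∈ x ∷ xs → a < m
      go (m , bound) = pick (compare x m)
        where
          pick : Tri (x < m) (x ≡ m) (m < x) → ∃ λ m → ∀ {a} → a ∈ x ∷ xs → a < m
          pick (tri< p _ _) = m , λ { (here refl) → p ; (there q) → bound q }
          pick (tri≈ _ refl _) = x + 1# , λ { (here refl) → x<x+1 x ; (there q) → <-trans (bound q) (x<x+1 x) }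
          pick (tri> _ _ p) = x + 1# , λ { (here refl) → x<x+1 x ; (there q) → <-trans (bound q) (<-trans p (x<x+1 x)) }

  shear : Carrier → Point → Point
  shear t (a , b) = a + t * b , b

  unshear : Carrier → Point → Point
  unshear t (a , b) = a - t * b , b

  unshear-shear : ∀ t p → unshear t (shear t p) ≡ p
  unshear-shear t (a , b) = cong (_, b) (solve 3 (λ a b t → (a :+ t :* b) :- t :* b := a) refl a b t)

  shear-unshear : ∀ t p → shear t (unshear t p) ≡ p
  shear-unshear t (a , b) = cong (_, b) (solve 3 (λ a b t → (a :- t :* b) :+ t :* b := a) refl a b t)

  unshear-OnSeg : ∀ t {p q z} → OnSeg p q z → OnSeg (unshear t p) (unshear t q) (unshear t z)
  unshear-OnSeg t {p₁ , p₂} {q₁ , q₂} (s , s≥0 , s≤1 , refl , refl) = s , s≥0 , s≤1 ,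
    solve 6 (λ a b c d s t → (a :+ s :* (c :- a)) :- t :* (b :+ s :* (d :- b)) := (a :- t :* b) :+ s :* ((c :- t :* d) :- (a :- t :* b)))
      refl p₁ p₂ q₁ q₂ s t , refl

  -- Two points of different heights receive equal abscissae for the single parameter `bad`, so any
  -- `t` above these finitely many values works. Points of equal height, for which `bad` is a
  -- default, keep their horizontal distance.
  generic : ∀ ps → ∃ λ t → ∀ {p q} → p ∈ ps → q ∈ ps → proj₁ (shear t p) ≡ proj₁ (shear t q) → p ≡ q
  generic ps = t , λ {p} {q} p∈ q∈ e → same p∈ q∈ e (proj₂ p ≟ᶠ proj₂ q)
    where
      bad : Point → Point → Carrier
      bad (a , b) (c , d) = (c - a) * recip (b - d)
      bound = upper-bound (cartesianProductWith bad ps ps)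
      t = proj₁ bound
      same : ∀ {p q} → p ∈ ps → q ∈ ps → proj₁ (shear t p) ≡ proj₁ (shear t q) → Dec (proj₂ p ≡ proj₂ q) → p ≡ q
      same {a , b} {c , d} p∈ q∈ e (yes refl) = cong (_, b)
        (trans (solve 2 (λ a m → a := (a :+ m) :- m) refl a (t * b)) (trans (cong (_- t * b) e) (solve 2 (λ a m → (a :+ m) :- m := a) refl c (t * b))))
      same {a , b} {c , d} p∈ q∈ e (no ne) = ⊥-elim (<-irr (subst (_< t) bad≡t (proj₂ bound (∈-cartesianProductWith⁺ bad p∈ q∈))))
        where
          b-d≢0 : b - d ≢ 0#
          b-d≢0 z = ne (-≡0⇒≡ z)
          rise : c - a ≡ t * (b - d)
          rise = -≡0⇒≡ (trans (solve 5 (λ a b c d t → (c :- a) :- t :* (b :- d) := (c :+ t :* d) :- (a :+ t :* b)) refl a b c d t) (≡⇒-≡0 (sym e)))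
          bad≡t : bad (a , b) (c , d) ≡ t
          bad≡t = trans (cong (_* recip (b - d)) rise) (trans (*-assoc t (b - d) (recip (b - d)))
            (trans (cong (t *_) (recip-inverse b-d≢0)) (*-identityʳ t)))

-- Rotation system and colourings of a drawing

module PlaneRotation (ℝ : RealField) {n : ℕ} (G : Graph n) {k : ℕ} (D : Geometry.Drawing ℝ G k) where
  open OrderedField ℝ
  open Geometry ℝ
  open Incidence ℝ
  open Curves ℝ
  open Drawing D
  open Layouts G using (V; _~_; ~-sym; ~-irrefl)
  open Canonical G using (Walk; []; step; parity; SameEdge; sameEdge?; Flow; _∷_; Rotation; module Construction)
  open PlaneGraph ℝ G D
  open Shear ℝ
  open Lines ℝ using (_≟ᵖ_)
  open Graph G using (adj)

  private
    pointsOf : V → V → List Point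
    pointsOf u v with Fin.toℕ u ℕ.<? Fin.toℕ v | adj u v Bool.≟ true
    ... | yes lt | yes p = curve (edge p lt)
    ... | _ | _ = []

    pointsOf-edge : ∀ e → pointsOf (src G e) (tgt G e) ≡ curve e
    pointsOf-edge e@((u , v) , lt , p) with Fin.toℕ u ℕ.<? Fin.toℕ v | adj u v Bool.≟ true
    ... | yes lt' | yes p' = cong curve (edge-≡ {edge p' lt'} {e} refl)
    ... | no ¬lt | _ = contradiction lt ¬lt
    ... | yes _ | no ¬p = contradiction p ¬p

    points : List Point
    points = concatMap (λ u → concatMap (pointsOf u) (allFin n)) (allFin n)

    curve⊆points : ∀ e {z} → z ∈ curve e → z ∈ points
    curve⊆points e {z} z∈ = ∈-concatMap⁺ _ (lose (∈-allFin (src G e))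
      (∈-concatMap⁺ _ (lose (∈-allFin (tgt G e)) (subst (z ∈_) (sym (pointsOf-edge e)) z∈))))

    drawn∈points : ∀ {p q} → Drawn₀ p q → p ∈ points
    drawn∈points (forth e m) = curve⊆points e (proj₁ (segment-ends (curve e) m))
    drawn∈points (back e m) = curve⊆points e (proj₂ (segment-ends (curve e) m))

    t : Carrier
    t = proj₁ (generic points)

    S U : Point → Point
    S = shear t
    U = unshear t

    S-injective : ∀ {p q} → S p ≡ S q → p ≡ q
    S-injective {p} {q} e = trans (sym (unshear-shear t p)) (trans (cong U e) (unshear-shear t q))

    U-injective : ∀ {p q} → U p ≡ U q → p ≡ q
    U-injective {p} {q} e = trans (sym (shear-unshear t p)) (trans (cong S e) (shear-unshear t q))

  -- Defined by pulling back along the shear, so that incidences need to be transported in one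
  -- direction only.
  Drawn : Point → Point → Set
  Drawn p q = Drawn₀ (U p) (U q)

  private
    drawn-abscissa : ∀ {p q r s} → Drawn p q → Drawn r s → proj₁ p ≡ proj₁ r → p ≡ r
    drawn-abscissa {p} {q} {r} d e eq = U-injective (proj₂ (generic points) (drawn∈points d) (drawn∈points e)
      (trans (cong proj₁ (shear-unshear t p)) (trans eq (sym (cong proj₁ (shear-unshear t r))))))

    Meeting : Point → Point → Point → Point → Point → Set
    Meeting p q r s z = ((p ≡ r × q ≡ s) ⊎ (p ≡ s × q ≡ r)) ⊎ ((z ≡ p ⊎ z ≡ q) × (z ≡ r ⊎ z ≡ s))

    swap-second : ∀ {p q r s z} → Meeting p q s r z → Meeting p q r s z
    swap-second (inj₁ (inj₁ x)) = inj₁ (inj₂ x)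
    swap-second (inj₁ (inj₂ x)) = inj₁ (inj₁ x)
    swap-second (inj₂ (x , inj₁ w)) = inj₂ (x , inj₂ w)
    swap-second (inj₂ (x , inj₂ w)) = inj₂ (x , inj₁ w)

    swap-first : ∀ {p q r s z} → Meeting q p r s z → Meeting p q r s z
    swap-first (inj₁ (inj₁ (a , b))) = inj₁ (inj₂ (b , a))
    swap-first (inj₁ (inj₂ (a , b))) = inj₁ (inj₁ (b , a))
    swap-first (inj₂ (inj₁ a , b)) = inj₂ (inj₂ a , b)
    swap-first (inj₂ (inj₂ a , b)) = inj₂ (inj₁ a , b)

    disjoint-forth : ∀ e f {p q r s z} → (p , q) ∈ segs (curve e) → (r , s) ∈ segs (curve f) → OnSeg p q z → OnSeg r s z → Meeting p q r s z
    disjoint-forth e f {p} {q} {r} {s} {z} m m' on on' = go (segments-disjoint {e} {f} m m' on on')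
      where
        go : (p , q) ≡ (r , s) ⊎ ((z ≡ p ⊎ z ≡ q) × (z ≡ r ⊎ z ≡ s)) → Meeting p q r s z
        go (inj₁ refl) = inj₁ (inj₁ (refl , refl))
        go (inj₂ x) = inj₂ x

    drawn₀-disjoint : ∀ {p q r s z} → Drawn₀ p q → Drawn₀ r s → OnSeg p q z → OnSeg r s z → Meeting p q r s z
    drawn₀-disjoint (forth e m) (forth f m') on on' = disjoint-forth e f m m' on on'
    drawn₀-disjoint (forth e m) (back f m') on on' = swap-second (disjoint-forth e f m m' on (OnSeg-reverse on'))
    drawn₀-disjoint (back e m) (forth f m') on on' = swap-first (disjoint-forth e f m m' (OnSeg-reverse on) on')
    drawn₀-disjoint (back e m) (back f m') on on' = swap-first (swap-second (disjoint-forth e f m m' (OnSeg-reverse on) (OnSeg-reverse on')))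

    drawn-disjoint : ∀ {p q r s z} → Drawn p q → Drawn r s → OnSeg p q z → OnSeg r s z → Meeting p q r s z
    drawn-disjoint {p} {q} {r} {s} {z} d e on on' = go (drawn₀-disjoint d e (unshear-OnSeg t on) (unshear-OnSeg t on'))
      where
        go : Meeting (U p) (U q) (U r) (U s) (U z) → Meeting p q r s z
        go (inj₁ (inj₁ (a , b))) = inj₁ (inj₁ (U-injective a , U-injective b))
        go (inj₁ (inj₂ (a , b))) = inj₁ (inj₂ (U-injective a , U-injective b))
        go (inj₂ (a , b)) = inj₂ (either (inj₁ ∘ U-injective) (inj₂ ∘ U-injective) a , either (inj₁ ∘ U-injective) (inj₂ ∘ U-injective) b)

  open Sweep ℝ Drawn (λ d → drawn₀-sym d) (λ d e → drawn₀-≢ d (cong U e)) drawn-abscissa drawn-disjoint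
    renaming (step to chain-step; [] to chain-[]; _⁀_ to _⁀ᶜ_; flip to corner-flip)

  private
    lift : ∀ {p q} → Drawn₀ p q → Drawn (S p) (S q)
    lift {p} {q} = subst₂ Drawn₀ (sym (unshear-shear t p)) (sym (unshear-shear t q))

    lower : ∀ {p q} → Drawn (S p) q → Drawn₀ p (U q)
    lower {p} = subst (λ p → Drawn₀ p _) (unshear-shear t p)

  -- A polygonal path that records, at each inner point, what `bend` needs: two distinct drawn
  -- neighbours and no others.
  data Path : Point → List Point → Point → Set where
    last : ∀ {a b} → Drawn₀ a b → Path a [] b
    cons : ∀ {a b c cs} → Drawn₀ a c → Drawn₀ c (second cs b) → second cs b ≢ a →
      (∀ {d} → Drawn₀ c d → d ≡ second cs b ⊎ d ≡ a) → Path c cs b → Path a (c ∷ cs) b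

  curve-path : ∀ e → Path (pos (src G e)) (bends e) (pos (tgt G e))
  curve-path e = go _ (bends e) _ id id (curve-unique e)
    where
      go : ∀ a bs b → (∀ {s} → s ∈ segs (a ∷ bs ++ [ b ]) → s ∈ segs (curve e)) → (∀ {c} → c ∈ bs → c ∈ bends e) →
        Unique (a ∷ bs ++ [ b ]) → Path a bs b
      go a [] b segs⊆ _ _ = last (forth e (segs⊆ (here refl)))
      go a (c ∷ cs) b segs⊆ bends⊆ (a∉ ∷ u) = cons (forth e ac) (forth e cd) (λ eq → All.lookup a∉ (there (second∈ cs)) (sym eq))
        (at-bend e (bends⊆ (here refl)) ac cd) (go c cs b (segs⊆ ∘ there) (bends⊆ ∘ there) u)
        where
          ac : (a , c) ∈ segs (curve e)
          ac = segs⊆ (here refl)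
          cd : (c , second cs b) ∈ segs (curve e)
          cd = segs⊆ (there (second-segment∈ c cs b))
          second∈ : ∀ cs → second cs b ∈ cs ++ [ b ]
          second∈ [] = here refl
          second∈ (_ ∷ _) = here refl

  chain : ∀ {a bs b} → Path a bs b → Chain (S a) (S b)
  chain (last d) = chain-step (lift d) chain-[]
  chain (cons d _ _ _ p) = chain-step (lift d) (chain p)

  -- `corner-flip` moves the colour along a segment and `bend` moves it across the next inner point.
  path-flip : ∀ {a bs b} → Path a bs b → ∀ {r} (c : Chain r r) →
    left (S a) (S (second bs b)) c ≡ right (S b) (S (penultimate a bs)) c
  path-flip (last d) c = corner-flip (lift d) c
  path-flip (cons {a} {b} {z} {cs} d d' ne only p) c = trans (corner-flip (lift d) c)
    (trans (sym (bend (lift d') (lift (drawn₀-sym d)) (ne ∘ S-injective) only' c)) (path-flip p c))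
    where
      only' : ∀ {q} → Drawn (S z) q → q ≡ S (second cs b) ⊎ q ≡ S a
      only' {q} e = either (λ r → inj₁ (trans (sym (shear-unshear t q)) (cong S r))) (λ r → inj₂ (trans (sym (shear-unshear t q)) (cong S r))) (only (lower e))

  -- As `z` is not a bend, only the first and the last segment of the path can start or end there.
  path-uses : ∀ {a bs b} (p : Path a bs b) {z q} → (∀ {c} → c ∈ bs → S c ≢ z) → tally (uses z q) (chain p) ≡
    (does (S a ≟ᵖ z) ∧ does (S (second bs b) ≟ᵖ q)) xor (does (S b ≟ᵖ z) ∧ does (S (penultimate a bs) ≟ᵖ q))
  path-uses (last d) _ = xor-identityʳ _
  path-uses (cons {a} {b} {c} {cs} d _ _ _ p) {z} {q} avoid = trans
    (cong₂ _xor_ (trans (cong (λ s → A xor (s ∧ does (S a ≟ᵖ q))) (dec-false (S c ≟ᵖ z) (avoid (here refl)))) (xor-identityʳ A))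
      (trans (path-uses p (avoid ∘ there)) (cong (λ s → (s ∧ _) xor B) (dec-false (S c ≟ᵖ z) (avoid (here refl)))))) refl
    where
      A = does (S a ≟ᵖ z) ∧ does (S c ≟ᵖ q)
      B = does (S b ≟ᵖ z) ∧ does (S (penultimate c cs) ≟ᵖ q)

  reverse-chain : ∀ {p q} → Chain p q → Chain q p
  reverse-chain chain-[] = chain-[]
  reverse-chain (chain-step d c) = reverse-chain c ⁀ᶜ chain-step (drawn₀-sym d) chain-[]

  tally-reverse : ∀ z q {r s} (c : Chain r s) → tally (uses z q) (reverse-chain c) ≡ tally (uses z q) c
  tally-reverse z q chain-[] = refl
  tally-reverse z q (chain-step {a} {b} d c) = trans (tally-⁀ (uses z q) (reverse-chain c) _)
    (trans (cong₂ _xor_ (tally-reverse z q c) (trans (xor-identityʳ _) (xor-comm (does (b ≟ᵖ z) ∧ does (a ≟ᵖ q)) (does (a ≟ᵖ z) ∧ does (b ≟ᵖ q)))))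
      (xor-comm (tally (uses z q) c) (uses z q a b)))

  P : V → Point
  P u = S (pos u)

  first : V → V → Point
  first u v with adj u v Bool.≟ true
  ... | yes p = S (leaving p (orientation p))
  ... | no _ = origin

  first-leaving : ∀ {u v} (p : u ~ v) o → first u v ≡ S (leaving p o)
  first-leaving {u} {v} p o with adj u v Bool.≟ true
  ... | yes q = cong S (leaving-irrelevant q p (orientation q) o)
  ... | no ¬p = contradiction p ¬p

  first-injective : ∀ {u v w} → u ~ v → u ~ w → first u v ≡ first u w → v ≡ w
  first-injective p q e = leaving-injective p q (orientation p) (orientation q)
    (S-injective (trans (sym (first-leaving p (orientation p))) (trans e (first-leaving q (orientation q)))))

  first-drawn : ∀ {u v} → u ~ v → Drawn (P u) (first u v)
  first-drawn {u} p = subst (Drawn (P u)) (sym (first-leaving p (orientation p))) (lift (leaving-drawn p (orientation p)))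

  first-complete : ∀ {u b} → Drawn (P u) b → ∃ λ v → u ~ v × b ≡ first u v
  first-complete {u} {b} d = go (at-vertex (lower d))
    where
      go : (∃ λ v → Σ (u ~ v) λ p → ∀ o → U b ≡ leaving p o) → ∃ λ v → u ~ v × b ≡ first u v
      go (v , p , e) = v , p , trans (sym (shear-unshear t b)) (trans (cong S (e (orientation p))) (sym (first-leaving p (orientation p))))

  edge-chain : ∀ {u v} (p : u ~ v) → Oriented u v p → Chain (P u) (P v)
  edge-chain p (up lt) = chain (curve-path (edge p lt))
  edge-chain p (down lt) = reverse-chain (chain (curve-path (edge (~-sym p) lt)))

  walk-chain : ∀ {a b} → Walk a b → Chain (P a) (P b)
  walk-chain [] = chain-[]
  walk-chain (step p w) = edge-chain p (orientation p) ⁀ᶜ walk-chain w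

  private
    does-P : ∀ u v → does (P u ≟ᵖ P v) ≡ does (u Fin.≟ v)
    does-P u v = does-cong (P u ≟ᵖ P v) (u Fin.≟ v) (λ e → pos-inj u v (S-injective e)) (cong P)

    does-first : ∀ {x y u v} → x ~ y → u ~ v → does (x Fin.≟ u) ∧ does (first x y ≟ᵖ first u v) ≡ does (x Fin.≟ u) ∧ does (y Fin.≟ v)
    does-first {x} {y} {u} {v} p q = go (x Fin.≟ u)
      where
        go : (d : Dec (x ≡ u)) → does d ∧ does (first x y ≟ᵖ first u v) ≡ does d ∧ does (y Fin.≟ v)
        go (no _) = refl
        go (yes refl) = does-cong (first x y ≟ᵖ first x v) (y Fin.≟ v) (first-injective p q) (cong (first x))

    Uses : V → V → V → V → Bool
    Uses x y u v = (does (P x ≟ᵖ P u) ∧ does (first x y ≟ᵖ first u v)) xor (does (P y ≟ᵖ P u) ∧ does (first y x ≟ᵖ first u v))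

    edge-chain-uses : ∀ {x y u v} (p : x ~ y) o → tally (uses (P u) (first u v)) (edge-chain p o) ≡ Uses x y u v
    edge-chain-uses {x} {y} {u} {v} p o@(up lt) = trans
      (path-uses (curve-path (edge p lt)) (λ c∈ e → bend-not-vertex (edge p lt) (subst (_∈ bends (edge p lt)) (S-injective e) c∈)))
      (cong₂ (λ s r → (does (P x ≟ᵖ P u) ∧ does (s ≟ᵖ first u v)) xor (does (P y ≟ᵖ P u) ∧ does (r ≟ᵖ first u v)))
        (sym (first-leaving p o)) (sym (trans (first-leaving (~-sym p) (down lt)) (cong (λ f → S (penultimate (pos x) (bends f))) (edge-≡ {edge (~-sym (~-sym p)) lt} {edge p lt} refl)))))
    edge-chain-uses {x} {y} {u} {v} p o@(down lt) = trans (tally-reverse (P u) (first u v) (chain (curve-path e)))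
      (trans (path-uses (curve-path e) (λ c∈ eq → bend-not-vertex e (subst (_∈ bends e) (S-injective eq) c∈)))
      (trans (cong₂ (λ s r → (does (P y ≟ᵖ P u) ∧ does (s ≟ᵖ first u v)) xor (does (P x ≟ᵖ P u) ∧ does (r ≟ᵖ first u v)))
        (sym (first-leaving (~-sym p) (up lt))) (sym (first-leaving p o)))
        (xor-comm (does (P y ≟ᵖ P u) ∧ _) (does (P x ≟ᵖ P u) ∧ _))))
      where e = edge (~-sym p) lt

    uses-same : ∀ {x y u v} → x ~ y → u ~ v → Uses x y u v ≡ does (sameEdge? x y u v)
    uses-same {x} {y} {u} {v} p q = trans
      (cong₂ _xor_ (trans (cong (_∧ does (first x y ≟ᵖ first u v)) (does-P x u)) (does-first p q))
        (trans (cong (_∧ does (first y x ≟ᵖ first u v)) (does-P y u)) (trans (does-first (~-sym p) q) (∧-comm (does (y Fin.≟ u)) (does (x Fin.≟ v))))))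
      (go (x Fin.≟ u) (x Fin.≟ v) (y Fin.≟ v) (y Fin.≟ u))
      where
        go : (a : Dec (x ≡ u)) (b : Dec (x ≡ v)) (c : Dec (y ≡ v)) (d : Dec (y ≡ u)) →
          (does a ∧ does c) xor (does b ∧ does d) ≡ does ((a ×-dec c) ⊎-dec (b ×-dec d))
        go (yes refl) (yes refl) _ _ = ⊥-elim (~-irrefl q)
        go (yes _) (no _) (yes _) _ = refl
        go (yes _) (no _) (no _) _ = refl
        go (no _) (yes _) _ (yes _) = refl
        go (no _) (yes _) _ (no _) = refl
        go (no _) (no _) _ _ = refl

  -- The segment by which the curve of uv leaves `u` stands for the whole edge: no other edge leaves
  -- `u` towards the same point.
  walk-uses : ∀ {a b u v} (w : Walk a b) → u ~ v → tally (uses (P u) (first u v)) (walk-chain w) ≡ parity w u v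
  walk-uses [] q = refl
  walk-uses {u = u} {v} (step p w) q = trans (tally-⁀ (uses (P u) (first u v)) (edge-chain p (orientation p)) (walk-chain w))
    (cong₂ _xor_ (trans (edge-chain-uses p (orientation p)) (uses-same p q)) (walk-uses w q))

  private
    module Sorting u = InsertionSort (λ v w → before (P u) (first u v) (first u w))

    neighbours : V → List V
    neighbours u = filter (λ v → adj u v Bool.≟ true) (allFin n)

    neighbours⁻ : ∀ {u v} → v ∈ neighbours u → u ~ v
    neighbours⁻ {u} m = proj₂ (∈-filter⁻ (λ v → adj u v Bool.≟ true) {xs = allFin n} m)

    ordered : V → List V
    ordered u = Sorting.sort u (neighbours u)

    ordered⁻ : ∀ {u v} → v ∈ ordered u → u ~ v
    ordered⁻ {u} m = neighbours⁻ (Sorting.∈-sort⁻ u (neighbours u) m)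

    ordered⁺ : ∀ {u v} → u ~ v → v ∈ ordered u
    ordered⁺ {u} p = Sorting.∈-sort⁺ u (neighbours u) (∈-filter⁺ (λ v → adj u v Bool.≟ true) (∈-allFin _) p)

    ordered-sorted : ∀ u → AllPairs (Sorting.R u) (ordered u)
    ordered-sorted u = Sorting.sort-sorted u (λ a b c → before-trans (P u) (first u a) (first u b) (first u c)) (neighbours u)
      (Unique.filter⁺ _ (Unique.allFin⁺ n))
      λ {v} {w} v∈ w∈ ne e → trans (before-total (first-drawn (neighbours⁻ w∈)) (first-drawn (neighbours⁻ v∈))
        (λ eq → ne (first-injective (neighbours⁻ v∈) (neighbours⁻ w∈) (sym eq)))) (cong not e)

    ordered-unique : ∀ u → Unique (ordered u)
    ordered-unique u = AllPairs-map (λ {v} {w} r → λ { refl → absurd r (before-irrefl (P u) (first u v)) }) (ordered-sorted u)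
      where
        absurd : ∀ {b} → b ≡ true → b ≡ false → ⊥
        absurd refl ()

  rotation : Rotation
  rotation = record { rot = ordered ; rot-unique = ordered-unique ; rot⁺ = ordered⁺ ; rot⁻ = ordered⁻ }

  open Rotation rotation

  bounding : Bounding
  bounding w = record { L = L ; R = R ; cross = cross ; flip = flip ; turn = turn }
    where
      c = walk-chain w

      L R : V → V → Bool
      L u v = left (P u) (first u v) c
      R u v = right (P u) (first u v) c

      cross : ∀ {u v} → u ~ v → L u v ≡ R u v xor parity w u v
      cross {u} {v} p = trans (left-right (first-drawn p) c) (cong (R u v xor_) (walk-uses w p))

      forward : ∀ {u v} (p : u ~ v) → Fin.toℕ u ℕ.< Fin.toℕ v → L u v ≡ R v u
      forward {u} {v} p lt = trans (cong (λ z → left (P u) z c) (first-leaving p (up lt)))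
        (trans (path-flip (curve-path (edge p lt)) c)
        (cong (λ z → right (P v) z c) (sym (trans (first-leaving (~-sym p) (down lt))
          (cong (λ f → S (penultimate (pos u) (bends f))) (edge-≡ {edge (~-sym (~-sym p)) lt} {edge p lt} refl))))))

      parity-comm : ∀ {a b} (w : Walk a b) u v → parity w u v ≡ parity w v u
      parity-comm [] u v = refl
      parity-comm (step {x} {y} _ w) u v = cong₂ _xor_ (does-cong (sameEdge? x y u v) (sameEdge? x y v u) swap swap) (parity-comm w u v)
        where
          swap : ∀ {x y u v} → SameEdge x y u v → SameEdge x y v u
          swap (inj₁ r) = inj₂ r
          swap (inj₂ r) = inj₁ r

      flip : ∀ {u v} → u ~ v → R u v ≡ L v u
      flip {u} {v} p = go (orientation p)
        where
          undo : ∀ {a b c d e} → a ≡ b xor c → d ≡ e xor c → a ≡ e → b ≡ d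
          undo {b = b} {c} {e = e} refl refl refl = sym (trans (xor-assoc b c c) (trans (cong (b xor_) (xor-same c)) (xor-identityʳ b)))
          go : Oriented u v p → R u v ≡ L v u
          go (down lt) = sym (forward (~-sym p) lt)
          -- The curve runs from `u` to `v` and identifies the corners on its other side. Crossing
          -- the edge at both ends adds the same parity, which does not depend on the direction of
          -- the edge.
          go (up lt) = undo (cross p) (trans (cross (~-sym p)) (cong (R v u xor_) (parity-comm w v u))) (forward p lt)

      turn : ∀ u → ∃ λ b → Flow L R b (map (u ,_) (rot u)) b
      turn u = corner (_∈ᵇ []) (P u) c , subst (Flow L R _ _) (A.corner-closes c) (go [] (rot u) refl)
        where
          f = first u
          qs = map f (rot u)
          sorted-map : ∀ {xs} → AllPairs (Sorting.R u) xs → Sorted (P u) (map f xs)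
          sorted-map = AllPairs.map⁺
          drawn : ∀ {b} → b ∈ qs → Drawn (P u) b
          drawn m = go (∈-map⁻ f m)
            where
              go : ∀ {b} → (∃ λ v → v ∈ rot u × b ≡ f v) → Drawn (P u) b
              go (v , v∈ , refl) = first-drawn (rot⁻ v∈)
          listed : ∀ {b} → Drawn (P u) b → b ∈ qs
          listed d = go (first-complete d)
            where
              go : ∀ {b} → (∃ λ v → u ~ v × b ≡ f v) → b ∈ qs
              go (v , p , refl) = ∈-map⁺ f (rot⁺ p)
          module A = Around (sorted-map (ordered-sorted u)) drawn listed
          -- The corners at `u` correspond to the initial parts of the rotation; by `A.left-corner`
          -- and `A.right-corner`, each dart leads from one such part to the next.
          go : ∀ pre post → rot u ≡ pre ++ post → Flow L R (corner (_∈ᵇ map f pre) (P u) c) (map (u ,_) post) (corner (_∈ᵇ qs) (P u) c)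
          go pre [] e = subst (λ xs → Flow L R (corner (_∈ᵇ map f pre) (P u) c) [] (corner (_∈ᵇ map f xs) (P u) c))
            (sym (trans e (List.++-identityʳ pre))) Flow.[]
          go pre (v ∷ post) e = A.right-corner (map f pre) split c ∷
            subst (λ b → Flow L R b (map (u ,_) post) (corner (_∈ᵇ qs) (P u) c))
              (sym (trans (A.left-corner (map f pre) split c) (cong (λ xs → corner (_∈ᵇ xs) (P u) c) (sym (List.map-++ f pre [ v ])))))
              (go (pre ++ [ v ]) post (trans e (sym (List.++-assoc pre [ v ] post))))
            where
              split : qs ≡ map f pre ++ f v ∷ map f post
              split = trans (cong (map f) e) (List.map-++ f pre (v ∷ post))

  layout : Layouts.Layout G (allFin n) []
  layout = Construction.layout rotation bounding

open import Data.Nat using (ℕ; _*_)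
open import Data.Product using (Σ)
open import Relation.Binary.PropositionalEquality using (_≡_)

theorem8p2 : (ℝ : RealField) → (n : ℕ) → (G : Graph n) → (d : ℕ) →
    Geometry.Planar ℝ G → maxDegree G ≡ d →
    Σ (Geometry.Drawing ℝ G 1) (λ D → Geometry.UsesAtMostSlopes ℝ D (2 * d))
theorem8p2 ℝ n G d (k , D) refl = drawing , drawing-slopes
  where open LDrawing ℝ G (PlaneRotation.layout ℝ G D)
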